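{- Let $\mathcal B$ be a finite set of bad events over independent variables $X_1,\dots,X_n$ drawn from a product distribution $\Omega$, and let $\mu:\mathcal B\to[0,\infty)$ be any mapping. Then there is an algorithm (the Truncated Moser-Tardos Algorithm) whose output distribution $\Omega'$ on the underlying variables $X_1,\dots,X_n$ satisfies $$\forall B\in\mathcal B,\qquad P_{\Omega'}(B)\le \max\bigl(0,\ \theta(B)-\mu(B)\bigr).$$ Moreover, for each $B\in\mathcal B$, the expected number of resamplings of $B$ performed by this algorithm is at most $\mu(B)$.
   Context: Setting. $\Omega$ is a product distribution: the variables $X_1,\dots,X_n$ are independent and integer-valued, $X_i=j$ with probability $p_{i,j}$, $\sum_j p_{i,j}=1$. An event is a Boolean function of a subset of the variables (the variables it involves). Write $E\sim E'$ if $E,E'$ involve a common variable (in particular $E\sim E$). $N(E)=\{B\in\mathcal B: B\sim E\}$ is the inclusive neighborhood. A set of bad events is independent if no two distinct members are related by $\sim$. For any event $E$, $$\theta(E)=P_\Omega(E)\sum_{\substack{I\subseteq N(E)\\ I\text{ independent}}}\ \prod_{B\in I}\mu(B).$$ Moser-Tardos (MT) algorithm for a set of bad events: draw all variables from their product distribution; while some bad event is true, choose a currently-true bad event $B$ (by any fixed, possibly randomized, rule) and resample $B$, i.e. redraw independently all variables involved in $B$ from their distributions. Truncated Moser-Tardos Algorithm for $\mathcal B,\mu$: for each $B\in\mathcal B$ introduce an additional independent binary variable $Y(B)$ which is Bernoulli with mean $q(B)=\min(1,\mu(B)/\theta(B))$, and the new bad event $B'=$ "$B$ is true and $Y(B)=1$";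 run the MT algorithm for the set of bad events $\mathcal B'=\{B':B\in\mathcal B\}$ (on the variables $X_i$ and $Y(B)$), and output $X_1,\dots,X_n$. A resampling of $B$ means a resampling of $B'$ in this algorithm. -}

module Defs where

open import Level using (0ℓ)
open import Algebra.Bundles using (CommutativeRing)
open import Algebra.Structures using (IsCommutativeRing)
import Algebra.Construct.NaturalChoice.Max as NaturalMax
import Algebra.Construct.NaturalChoice.Min as NaturalMin
import Algebra.Definitions.RawMonoid as RawMonoidOps
import Algebra.Properties.Ring as RingProperties
import Relation.Binary.Reasoning.PartialOrder as PosetReasoning
open import Data.Bool.Base using (Bool; true; false; if_then_else_; _∧_)
import Data.Bool.Properties as Bool
open import Data.Empty using (⊥-elim)
open import Data.Fin.Base using (Fin; zero; suc; splitAt; _↑ˡ_; _↑ʳ_)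
import Data.Fin.Properties as Fin
open import Data.Fin.Subset using (Subset; inside; outside; _∈_; _∩_; Nonempty; ⁅_⁆)
open import Data.Fin.Subset.Properties using (_∈?_; nonempty?; x∈⁅x⁆)
open import Data.Integer.Base using (ℤ; +_; -[1+_])
import Data.Integer.Properties as ℤ
open import Data.List.Base as List using (List; []; _∷_; _++_; [_])
open import Data.List.Membership.Propositional using () renaming (_∈_ to _∈ˡ_)
open import Data.List.Membership.Propositional.Properties
  using (∈-∃++; ∈-++⁻; ∈-++⁺ˡ; ∈-++⁺ʳ; ∈-map⁺; ∈-deduplicate⁺; ∈-cartesianProductWith⁺)
open import Data.List.Relation.Unary.All as All using ([]; _∷_)
open import Data.List.Relation.Unary.AllPairs using ([]; _∷_)
open import Data.List.Relation.Unary.Any using (here; there)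
open import Data.List.Relation.Unary.Unique.Propositional using (Unique)
open import Data.List.Relation.Unary.Unique.Propositional.Properties using (cartesianProductWith⁺)
open import Data.List.Relation.Unary.Unique.DecPropositional.Properties using (deduplicate-!)
open import Data.Nat.Base as ℕ using (ℕ; zero; suc)
open import Data.Product.Base using (∃; ∃-syntax; _×_; _,_; proj₁; proj₂)
open import Data.Sum.Base using (_⊎_; inj₁; inj₂; [_,_]′)
open import Data.Vec.Base as Vec using (Vec; []; _∷_; lookup; take)
import Data.Vec.Properties as Vec
open import Function.Base using (_∘_)
open import Relation.Binary.Bundles using (TotalOrder; Poset)
open import Relation.Binary.Definitions using (DecidableEquality)
open import Relation.Binary.PropositionalEquality as ≡ using (_≡_; _≢_; refl)
open import Relation.Binary.Structures using (IsDecTotalOrder)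
open import Relation.Nullary using (Dec; yes; no; ¬_; does)
open import Relation.Nullary.Decidable using (¬?; _⊎-dec_; _×-dec_; _→-dec_)
open import Relation.Unary using (Pred)

IsSup : {A : Set} → (A → A → Set) → Pred A 0ℓ → A → Set
IsSup _≤_ S s = (∀ x → S x → x ≤ s) × (∀ u → (∀ x → S x → x ≤ u) → s ≤ u)

-- Up to isomorphism ℝ is the only complete ordered field, so quantifying over
-- all of them amounts to working with ℝ.  The order is decidable, as it is
-- for ℝ in classical mathematics.
record CompleteOrderedField : Set₁ where
  infix  8 -_
  infix  9 _⁻¹
  infixl 7 _*_
  infixl 6 _+_
  infix  4 _≈_ _≤_
  field
    Carrier           : Set
    _≈_ _≤_           : Carrier → Carrier → Set
    _+_ _*_           : Carrier → Carrier → Carrier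
    -_ _⁻¹            : Carrier → Carrier
    0# 1#             : Carrier
    isCommutativeRing : IsCommutativeRing _≈_ _+_ _*_ -_ 0# 1#
    isDecTotalOrder   : IsDecTotalOrder _≈_ _≤_
    0≉1               : ¬ (0# ≈ 1#)
    *-inverseʳ        : ∀ x → ¬ (x ≈ 0#) → x * x ⁻¹ ≈ 1#
    +-monoʳ-≤         : ∀ z {x y} → x ≤ y → z + x ≤ z + y
    *-nonneg          : ∀ {x y} → 0# ≤ x → 0# ≤ y → 0# ≤ x * y
    supremum          : (S : Pred Carrier 0ℓ) → ∃ S →
                        (∃[ b ] ∀ x → S x → x ≤ b) → ∃[ s ] IsSup _≤_ S s

  commutativeRing : CommutativeRing 0ℓ 0ℓ
  commutativeRing = record { isCommutativeRing = isCommutativeRing }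

  totalOrder : TotalOrder 0ℓ 0ℓ 0ℓ
  totalOrder = record { isTotalOrder = IsDecTotalOrder.isTotalOrder isDecTotalOrder }

  open CommutativeRing commutativeRing public
    hiding (Carrier; _≈_; _+_; _*_; -_; 0#; 1#; isCommutativeRing; refl; sym; trans; zero)
  open IsDecTotalOrder isDecTotalOrder public
    using (_≟_; _≤?_; total; antisym; ≤-respˡ-≈; ≤-respʳ-≈; module Eq)
    renaming (refl to ≤-refl; trans to ≤-trans; reflexive to ≤-reflexive)
  open NaturalMax totalOrder public using (_⊔_)
  open NaturalMin totalOrder public using (_⊓_; ⊓-glb; x⊓y≤x)

module Probability (ℝ : CompleteOrderedField) where

  open CompleteOrderedField ℝ
  open RingProperties ring using (-‿distribˡ-*; -‿involutive)
  open RawMonoidOps +-rawMonoid public using () renaming (sum to sumᶠ; _×_ to _·_)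
  open RawMonoidOps *-rawMonoid public using () renaming (sum to prodᶠ)

  private
    variable
      A B C : Set
      n m : ℕ

    poset : Poset 0ℓ 0ℓ 0ℓ
    poset = TotalOrder.poset totalOrder

  open PosetReasoning poset hiding (start)

  +-mono-≤ : ∀ {w x y z} → w ≤ x → y ≤ z → w + y ≤ x + z
  +-mono-≤ {w} {x} {y} {z} w≤x y≤z = begin
    w + y ≤⟨ +-monoʳ-≤ w y≤z ⟩
    w + z ≈⟨ +-comm w z ⟩
    z + w ≤⟨ +-monoʳ-≤ z w≤x ⟩
    z + x ≈⟨ +-comm z x ⟩
    x + z ∎

  +-nonneg : ∀ {x y} → 0# ≤ x → 0# ≤ y → 0# ≤ x + y
  +-nonneg 0≤x 0≤y = ≤-respˡ-≈ (+-identityˡ 0#) (+-mono-≤ 0≤x 0≤y)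

  x≤y⇒0≤y-x : ∀ {x y} → x ≤ y → 0# ≤ y + - x
  x≤y⇒0≤y-x {x} {y} x≤y = begin
    0#       ≈⟨ -‿inverseʳ x ⟨
    x + - x  ≤⟨ +-mono-≤ x≤y ≤-refl ⟩
    y + - x  ∎

  0≤y-x⇒x≤y : ∀ {x y} → 0# ≤ y + - x → x ≤ y
  0≤y-x⇒x≤y {x} {y} le = begin
    x              ≈⟨ +-identityʳ x ⟨
    x + 0#         ≤⟨ +-monoʳ-≤ x le ⟩
    x + (y + - x)  ≈⟨ +-comm x (y + - x) ⟩
    y + - x + x    ≈⟨ +-assoc y (- x) x ⟩
    y + (- x + x)  ≈⟨ +-congˡ (-‿inverseˡ x) ⟩
    y + 0#         ≈⟨ +-identityʳ y ⟩
    y              ∎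

  *-monoʳ-≤ : ∀ {x y z} → 0# ≤ z → x ≤ y → x * z ≤ y * z
  *-monoʳ-≤ {x} {y} {z} 0≤z x≤y = 0≤y-x⇒x≤y (begin
    0#                ≤⟨ *-nonneg (x≤y⇒0≤y-x x≤y) 0≤z ⟩
    (y + - x) * z     ≈⟨ distribʳ z y (- x) ⟩
    y * z + - x * z   ≈⟨ +-congˡ (-‿distribˡ-* x z) ⟨
    y * z + - (x * z) ∎)

  *-monoˡ-≤ : ∀ {x y z} → 0# ≤ z → x ≤ y → z * x ≤ z * y
  *-monoˡ-≤ {x} {y} {z} 0≤z x≤y = begin
    z * x ≈⟨ *-comm z x ⟩
    x * z ≤⟨ *-monoʳ-≤ 0≤z x≤y ⟩
    y * z ≈⟨ *-comm y z ⟩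
    z * y ∎

  *-mono-≤ : ∀ {w x y z} → 0# ≤ x → 0# ≤ y → w ≤ x → y ≤ z → w * y ≤ x * z
  *-mono-≤ 0≤x 0≤y w≤x y≤z = ≤-trans (*-monoʳ-≤ 0≤y w≤x) (*-monoˡ-≤ 0≤x y≤z)

  x≤0⇒0≤-x : ∀ {x} → x ≤ 0# → 0# ≤ - x
  x≤0⇒0≤-x x≤0 = ≤-respʳ-≈ (+-identityˡ _) (x≤y⇒0≤y-x x≤0)

  0≤1 : 0# ≤ 1#
  0≤1 with total 0# 1#
  ... | inj₁ 0≤1 = 0≤1
  ... | inj₂ 1≤0 = begin
    0#           ≤⟨ *-nonneg (x≤0⇒0≤-x 1≤0) (x≤0⇒0≤-x 1≤0) ⟩
    - 1# * - 1#  ≈⟨ -‿distribˡ-* 1# (- 1#) ⟨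
    - (1# * - 1#) ≈⟨ -‿cong (*-identityˡ (- 1#)) ⟩
    - - 1#       ≈⟨ -‿involutive 1# ⟩
    1#           ∎

  ⁻¹-nonneg : ∀ {x} → 0# ≤ x → ¬ (x ≈ 0#) → 0# ≤ x ⁻¹
  ⁻¹-nonneg {x} 0≤x x≉0 with total 0# (x ⁻¹)
  ... | inj₁ le = le
  ... | inj₂ ge = ⊥-elim (0≉1 (antisym 0≤1 (begin
    1#        ≈⟨ *-inverseʳ x x≉0 ⟨
    x * x ⁻¹  ≤⟨ *-monoˡ-≤ 0≤x ge ⟩
    x * 0#    ≈⟨ zeroʳ x ⟩
    0#        ∎)))

  ∑ : List A → (A → Carrier) → Carrier
  ∑ xs f = List.foldr (λ x s → f x + s) 0# xs

  -- The sum of a family of non-negative reals over an arbitrary index type: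
  -- the supremum of the sums over finite sets of indices.  It is only meant
  -- for non-negative families.
  HasSum : (A → Carrier) → Carrier → Set
  HasSum {A} f = IsSup _≤_ (λ x → ∃[ xs ] (Unique {A = A} xs × ∑ xs f ≈ x))

  hasSum : {f : A → Carrier} {s : Carrier} →
           (∀ xs → Unique xs → ∑ xs f ≤ s) →
           (∀ u → (∀ xs → Unique xs → ∑ xs f ≤ u) → s ≤ u) →
           HasSum f s
  hasSum ub least =
    (λ { x (xs , xs! , eq) → ≤-respˡ-≈ eq (ub xs xs!) }) ,
    (λ u h → least u (λ xs xs! → h _ (xs , xs! , Eq.refl)))

  hasSum-upper : {f : A → Carrier} {s : Carrier} → HasSum f s →
                 ∀ xs → Unique xs → ∑ xs f ≤ s
  hasSum-upper (ub , _) xs xs! = ub _ (xs , xs! , Eq.refl)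

  hasSum-least : {f : A → Carrier} {s : Carrier} → HasSum f s →
                 ∀ u → (∀ xs → Unique xs → ∑ xs f ≤ u) → s ≤ u
  hasSum-least (_ , least) u h =
    least u (λ { x (xs , xs! , eq) → ≤-respˡ-≈ eq (h xs xs!) })

  summable : (f : A → Carrier) (b : Carrier) →
             (∀ xs → Unique xs → ∑ xs f ≤ b) → ∃ (HasSum f)
  summable f b bound = supremum _ (0# , [] , [] , Eq.refl)
    (b , λ { x (xs , xs! , eq) → ≤-respˡ-≈ eq (bound xs xs!) })

  ∑-nonneg : {f : A → Carrier} → (∀ x → 0# ≤ f x) → ∀ xs → 0# ≤ ∑ xs f
  ∑-nonneg 0≤f []       = ≤-refl
  ∑-nonneg 0≤f (x ∷ xs) = +-nonneg (0≤f x) (∑-nonneg 0≤f xs)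

  ∑-mono : {f g : A → Carrier} → (∀ x → f x ≤ g x) → ∀ xs → ∑ xs f ≤ ∑ xs g
  ∑-mono f≤g []       = ≤-refl
  ∑-mono f≤g (x ∷ xs) = +-mono-≤ (f≤g x) (∑-mono f≤g xs)

  ∑-++ : (f : A → Carrier) → ∀ xs ys → ∑ (xs ++ ys) f ≈ ∑ xs f + ∑ ys f
  ∑-++ f []       ys = Eq.sym (+-identityˡ _)
  ∑-++ f (x ∷ xs) ys =
    Eq.trans (+-congˡ (∑-++ f xs ys)) (Eq.sym (+-assoc (f x) (∑ xs f) (∑ ys f)))

  ∑-*ˡ : (c : Carrier) (f : A → Carrier) → ∀ xs → ∑ xs (λ x → c * f x) ≈ c * ∑ xs f
  ∑-*ˡ c f []       = Eq.sym (zeroʳ c)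
  ∑-*ˡ c f (x ∷ xs) =
    Eq.trans (+-congˡ (∑-*ˡ c f xs)) (Eq.sym (distribˡ c (f x) (∑ xs f)))

  ∑-shift : (f : A → Carrier) → ∀ x ys zs → ∑ (ys ++ x ∷ zs) f ≈ f x + ∑ (ys ++ zs) f
  ∑-shift f x ys zs = begin-equality
    ∑ (ys ++ x ∷ zs) f       ≈⟨ ∑-++ f ys (x ∷ zs) ⟩
    ∑ ys f + (f x + ∑ zs f)  ≈⟨ +-assoc (∑ ys f) (f x) (∑ zs f) ⟨
    ∑ ys f + f x + ∑ zs f    ≈⟨ +-congʳ (+-comm (∑ ys f) (f x)) ⟩
    f x + ∑ ys f + ∑ zs f    ≈⟨ +-assoc (f x) (∑ ys f) (∑ zs f) ⟩
    f x + (∑ ys f + ∑ zs f)  ≈⟨ +-congˡ (∑-++ f ys zs) ⟨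
    f x + ∑ (ys ++ zs) f     ∎

  ∑-⊆ : {f : A → Carrier} → (∀ x → 0# ≤ f x) → ∀ xs ys → Unique xs →
        (∀ x → x ∈ˡ xs → x ∈ˡ ys ⊎ f x ≤ 0#) → ∑ xs f ≤ ∑ ys f
  ∑-⊆ 0≤f [] ys _ _ = ∑-nonneg 0≤f ys
  ∑-⊆ {f = f} 0≤f (x ∷ xs) ys (x∉xs ∷ xs!) sub with sub x (here refl)
  ... | inj₂ fx≤0 = begin
    f x + ∑ xs f  ≤⟨ +-mono-≤ fx≤0 (∑-⊆ 0≤f xs ys xs! (λ y → sub y ∘ there)) ⟩
    0# + ∑ ys f   ≈⟨ +-identityˡ (∑ ys f) ⟩
    ∑ ys f        ∎
  ... | inj₁ x∈ys with ∈-∃++ x∈ys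
  ... | us , vs , refl = begin
    f x + ∑ xs f          ≤⟨ +-monoʳ-≤ (f x) (∑-⊆ 0≤f xs (us ++ vs) xs! sub′) ⟩
    f x + ∑ (us ++ vs) f  ≈⟨ ∑-shift f x us vs ⟨
    ∑ (us ++ x ∷ vs) f    ∎
    where
    sub′ : ∀ y → y ∈ˡ xs → y ∈ˡ us ++ vs ⊎ f y ≤ 0#
    sub′ y y∈xs with sub y (there y∈xs)
    ... | inj₂ fy≤0 = inj₂ fy≤0
    ... | inj₁ y∈ with ∈-++⁻ us y∈
    ... | inj₁ y∈us         = inj₁ (∈-++⁺ˡ y∈us)
    ... | inj₂ (here refl)  = ⊥-elim (All.lookup x∉xs y∈xs refl)
    ... | inj₂ (there y∈vs) = inj₁ (∈-++⁺ʳ us y∈vs)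

  ∑-cartesian : (h : C → Carrier) (f : A → Carrier) (g : B → Carrier) (_∙_ : A → B → C) →
                (∀ x y → h (x ∙ y) ≡ f x * g y) → ∀ xs ys →
                ∑ (List.cartesianProductWith _∙_ xs ys) h ≈ ∑ xs f * ∑ ys g
  ∑-cartesian h f g _∙_ eq []       ys = Eq.sym (zeroˡ (∑ ys g))
  ∑-cartesian h f g _∙_ eq (x ∷ xs) ys = begin-equality
    ∑ (List.map (x ∙_) ys ++ List.cartesianProductWith _∙_ xs ys) h
      ≈⟨ ∑-++ h (List.map (x ∙_) ys) _ ⟩
    ∑ (List.map (x ∙_) ys) h + ∑ (List.cartesianProductWith _∙_ xs ys) h
      ≈⟨ +-cong (row ys) (∑-cartesian h f g _∙_ eq xs ys) ⟩
    f x * ∑ ys g + ∑ xs f * ∑ ys g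
      ≈⟨ distribʳ (∑ ys g) (f x) (∑ xs f) ⟨
    (f x + ∑ xs f) * ∑ ys g ∎
    where
    row : ∀ ys → ∑ (List.map (x ∙_) ys) h ≈ f x * ∑ ys g
    row []       = Eq.sym (zeroʳ (f x))
    row (y ∷ ys) = Eq.trans (+-cong (Eq.reflexive (eq x y)) (row ys))
                            (Eq.sym (distribˡ (f x) (g y) (∑ ys g)))

  record PMF (A : Set) : Set where
    field
      mass     : A → Carrier
      nonneg   : ∀ x → 0# ≤ mass x
      hasSum-1 : HasSum mass 1#

  open PMF public

  𝟙 : Bool → Carrier
  𝟙 b = if b then 1# else 0#

  Pr∃ : (P : PMF A) (E : A → Bool) → ∃ (HasSum (λ x → 𝟙 (E x) * mass P x))
  Pr∃ P E = summable _ 1# λ xs xs! →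
    ≤-trans (∑-mono le xs) (hasSum-upper (hasSum-1 P) xs xs!)
    where
    le : ∀ x → 𝟙 (E x) * mass P x ≤ mass P x
    le x with E x
    ... | true  = ≤-reflexive (*-identityˡ (mass P x))
    ... | false = ≤-trans (≤-reflexive (zeroˡ (mass P x))) (nonneg P x)

  Pr : PMF A → (A → Bool) → Carrier
  Pr P E = proj₁ (Pr∃ P E)

  Pr-nonneg : (P : PMF A) (E : A → Bool) → 0# ≤ Pr P E
  Pr-nonneg P E = hasSum-upper (proj₂ (Pr∃ P E)) [] []

  bernoulli : (q : Carrier) → 0# ≤ q → q ≤ 1# → PMF ℤ
  bernoulli q 0≤q q≤1 = record
    { mass     = f
    ; nonneg   = f≥0
    ; hasSum-1 = hasSum
        (λ xs xs! → ≤-trans (∑-⊆ f≥0 xs ends xs! (λ x _ → support x)) (≤-reflexive total-1))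
        (λ u h → ≤-trans (≤-reflexive (Eq.sym total-1)) (h ends (((λ ()) ∷ []) ∷ [] ∷ [])))
    }
    where
    f : ℤ → Carrier
    f (+ 0) = 1# + - q
    f (+ 1) = q
    f _     = 0#

    ends : List ℤ
    ends = + 0 ∷ + 1 ∷ []

    f≥0 : ∀ j → 0# ≤ f j
    f≥0 (+ 0)             = x≤y⇒0≤y-x q≤1
    f≥0 (+ 1)             = 0≤q
    f≥0 (+ suc (suc _))   = ≤-refl
    f≥0 -[1+ _ ]          = ≤-refl

    support : ∀ j → j ∈ˡ ends ⊎ f j ≤ 0#
    support (+ 0)           = inj₁ (here refl)
    support (+ 1)           = inj₁ (there (here refl))
    support (+ suc (suc _)) = inj₂ ≤-refl
    support -[1+ _ ]        = inj₂ ≤-refl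

    total-1 : ∑ ends f ≈ 1#
    total-1 = begin-equality
      1# + - q + (q + 0#)  ≈⟨ +-congˡ (+-identityʳ q) ⟩
      1# + - q + q         ≈⟨ +-assoc 1# (- q) q ⟩
      1# + (- q + q)       ≈⟨ +-congˡ (-‿inverseˡ q) ⟩
      1# + 0#              ≈⟨ +-identityʳ 1# ⟩
      1#                   ∎

  jointMass : (Fin n → PMF ℤ) → Vec ℤ n → Carrier
  jointMass p x = prodᶠ (λ i → mass (p i) (lookup x i))

  jointMass-nonneg : (p : Fin n → PMF ℤ) → ∀ x → 0# ≤ jointMass p x
  jointMass-nonneg p []      = 0≤1
  jointMass-nonneg p (a ∷ x) = *-nonneg (nonneg (p zero) a) (jointMass-nonneg (p ∘ suc) x)

  jointMass-hasSum : (p : Fin n → PMF ℤ) → HasSum (jointMass p) 1#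
  jointMass-hasSum {zero} p = hasSum
    (λ xs xs! → ≤-trans
      (∑-⊆ (jointMass-nonneg p) xs ([] ∷ []) xs! (λ { [] _ → inj₁ (here refl) }))
      (≤-reflexive (+-identityʳ 1#)))
    (λ u h → ≤-trans (≤-reflexive (Eq.sym (+-identityʳ 1#))) (h ([] ∷ []) ([] ∷ [])))
  jointMass-hasSum {suc n} p = hasSum upper least
    where
    f : ℤ → Carrier
    f = mass (p zero)

    g : Vec ℤ n → Carrier
    g = jointMass (p ∘ suc)

    g-sum : HasSum g 1#
    g-sum = jointMass-hasSum (p ∘ suc)

    g≥0 : ∀ ys → 0# ≤ ∑ ys g
    g≥0 = ∑-nonneg (jointMass-nonneg (p ∘ suc))

    _≟ⱽ_ : DecidableEquality (Vec ℤ n)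
    _≟ⱽ_ = Vec.≡-dec ℤ._≟_

    upper : ∀ xs → Unique xs → ∑ xs (jointMass p) ≤ 1#
    upper xs xs! = begin
      ∑ xs (jointMass p)
        ≤⟨ ∑-⊆ (jointMass-nonneg p) xs _ xs! (λ x x∈xs → inj₁ (covered x x∈xs)) ⟩
      ∑ (List.cartesianProductWith _∷_ hs ts) (jointMass p)
        ≈⟨ ∑-cartesian (jointMass p) f g _∷_ (λ _ _ → refl) hs ts ⟩
      ∑ hs f * ∑ ts g
        ≤⟨ *-mono-≤ 0≤1 (g≥0 ts)
             (hasSum-upper (hasSum-1 (p zero)) hs (deduplicate-! ℤ._≟_ _))
             (hasSum-upper g-sum ts (deduplicate-! _≟ⱽ_ _)) ⟩
      1# * 1# ≈⟨ *-identityˡ 1# ⟩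
      1# ∎
      where
      hs : List ℤ
      hs = List.deduplicate ℤ._≟_ (List.map Vec.head xs)

      ts : List (Vec ℤ n)
      ts = List.deduplicate _≟ⱽ_ (List.map Vec.tail xs)

      covered : ∀ x → x ∈ˡ xs → x ∈ˡ List.cartesianProductWith _∷_ hs ts
      covered (a ∷ x) x∈xs = ∈-cartesianProductWith⁺ _∷_
        (∈-deduplicate⁺ ℤ._≟_ (∈-map⁺ Vec.head x∈xs))
        (∈-deduplicate⁺ _≟ⱽ_ (∈-map⁺ Vec.tail x∈xs))

    least : ∀ u → (∀ xs → Unique xs → ∑ xs (jointMass p) ≤ u) → 1# ≤ u
    least u bound = hasSum-least (hasSum-1 (p zero)) u λ hs hs! → fibre hs hs! (∑ hs f ≟ 0#)
      where
      rect : ∀ hs ts → Unique hs → Unique ts → ∑ hs f * ∑ ts g ≤ u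
      rect hs ts hs! ts! = ≤-respˡ-≈
        (∑-cartesian (jointMass p) f g _∷_ (λ _ _ → refl) hs ts)
        (bound _ (cartesianProductWith⁺ _∷_ Vec.∷-injective hs! ts!))

      fibre : ∀ hs → Unique hs → Dec (∑ hs f ≈ 0#) → ∑ hs f ≤ u
      fibre hs hs! (yes a≈0) = ≤-respˡ-≈ (Eq.sym a≈0) (bound [] [])
      fibre hs hs! (no a≉0) = begin
        a             ≈⟨ *-identityʳ a ⟨
        a * 1#        ≤⟨ *-monoˡ-≤ a≥0 (hasSum-least g-sum (a ⁻¹ * u) below) ⟩
        a * (a ⁻¹ * u) ≈⟨ *-assoc a (a ⁻¹) u ⟨
        a * a ⁻¹ * u  ≈⟨ *-congʳ (*-inverseʳ a a≉0) ⟩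
        1# * u        ≈⟨ *-identityˡ u ⟩
        u             ∎
        where
        a : Carrier
        a = ∑ hs f

        a≥0 : 0# ≤ a
        a≥0 = ∑-nonneg (nonneg (p zero)) hs

        below : ∀ ts → Unique ts → ∑ ts g ≤ a ⁻¹ * u
        below ts ts! = begin
          ∑ ts g              ≈⟨ *-identityˡ (∑ ts g) ⟨
          1# * ∑ ts g         ≈⟨ *-congʳ (*-inverseʳ a a≉0) ⟨
          a * a ⁻¹ * ∑ ts g   ≈⟨ *-congʳ (*-comm a (a ⁻¹)) ⟩
          a ⁻¹ * a * ∑ ts g   ≈⟨ *-assoc (a ⁻¹) a (∑ ts g) ⟩
          a ⁻¹ * (a * ∑ ts g) ≤⟨ *-monoˡ-≤ (⁻¹-nonneg a≥0 a≉0) (rect hs ts hs! ts!) ⟩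
          a ⁻¹ * u            ∎

  product : (Fin n → PMF ℤ) → PMF (Vec ℤ n)
  product p = record
    { mass     = jointMass p
    ; nonneg   = jointMass-nonneg p
    ; hasSum-1 = jointMass-hasSum p
    }

  record Event (n : ℕ) : Set where
    field
      vars  : Subset n
      holds : Vec ℤ n → Bool
      local : ∀ x y → (∀ i → i ∈ vars → lookup x i ≡ lookup y i) → holds x ≡ holds y

  open Event public

  -- A finite record of an execution: the initial state, followed by the bad
  -- events resampled so far and the state after each resampling.
  data History (n m : ℕ) : Set where
    start    : Vec ℤ n → History n m
    resample : History n m → Fin m → Vec ℤ n → History n m

  current : History n m → Vec ℤ n
  current (start x)        = x
  current (resample _ _ x) = x

  #resamplings : Fin m → History n m → ℕ
  #resamplings B (start _)        = 0
  #resamplings B (resample h A _) =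
    (if does (A Fin.≟ B) then 1 else 0) ℕ.+ #resamplings B h

  -- A randomized rule for selecting a true bad event, possibly depending on
  -- the whole execution so far.
  record Rule (ℬ : Fin m → Event n) : Set where
    field
      choose    : History n m → Fin m → Carrier
      nonneg    : ∀ h B → 0# ≤ choose h B
      true-only : ∀ h B → holds (ℬ B) (current h) ≡ false → choose h B ≈ 0#
      total     : ∀ h B → holds (ℬ B) (current h) ≡ true → sumᶠ (choose h) ≈ 1#

  module MoserTardos {n m} (p : Fin n → PMF ℤ) (ℬ : Fin m → Event n) (rule : Rule ℬ) where

    open Rule rule using (choose)

    resampleMass : Fin m → Vec ℤ n → Vec ℤ n → Carrier
    resampleMass B x y = prodᶠ λ i →
      if does (i ∈? vars (ℬ B)) then mass (p i) (lookup y i)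
                                else 𝟙 (does (lookup x i ℤ.≟ lookup y i))

    -- The probability that the execution starts with the given history.
    weight : History n m → Carrier
    weight (start x)        = jointMass p x
    weight (resample h B y) = weight h * choose h B * resampleMass B (current h) y

    halted : History n m → Bool
    halted h = does (Fin.all? λ B → holds (ℬ B) (current h) Bool.≟ false)

    -- The probability that the execution terminates with exactly this history.
    runMass : History n m → Carrier
    runMass h = 𝟙 (halted h) * weight h

    -- Since Ω has total mass 1, this includes termination with probability 1.
    HasOutput : {k : ℕ} → (Vec ℤ n → Vec ℤ k) → PMF (Vec ℤ k) → Set
    HasOutput out Ω = ∀ x →
      HasSum (λ h → 𝟙 (does (Vec.≡-dec ℤ._≟_ (out (current h)) x)) * runMass h) (mass Ω x)

    -- The expectation over terminating executions, hence over all executions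
    -- when termination has probability 1.
    ExpectedResamplings : Fin m → Carrier → Set
    ExpectedResamplings B = HasSum (λ h → #resamplings B h · runMass h)

  subsets : ∀ m → List (Subset m)
  subsets zero    = [ [] ]
  subsets (suc m) = List.cartesianProductWith _∷_ (outside ∷ inside ∷ []) (subsets m)

  module Truncated {n m} (p : Fin n → PMF ℤ) (ℬ : Fin m → Event n)
                   (μ : Fin m → Carrier) (μ≥0 : ∀ B → 0# ≤ μ B) where

    infix 4 _∼_ _∼?_

    -- Reflexivity is imposed so that it also holds for an event involving no
    -- variables.
    _∼_ : Fin m → Fin m → Set
    A ∼ B = A ≡ B ⊎ Nonempty (vars (ℬ A) ∩ vars (ℬ B))

    _∼?_ : ∀ A B → Dec (A ∼ B)
    A ∼? B = (A Fin.≟ B) ⊎-dec nonempty? (vars (ℬ A) ∩ vars (ℬ B))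

    Independent : Subset m → Set
    Independent I = ∀ A B → A ∈ I → B ∈ I → A ≢ B → ¬ (A ∼ B)

    independent? : ∀ I → Dec (Independent I)
    independent? I = Fin.all? λ A → Fin.all? λ B →
      (A ∈? I) →-dec (B ∈? I) →-dec ¬? (A Fin.≟ B) →-dec ¬? (A ∼? B)

    _⊆N_ : Subset m → Fin m → Set
    I ⊆N E = ∀ B → B ∈ I → B ∼ E

    _⊆N?_ : ∀ I E → Dec (I ⊆N E)
    I ⊆N? E = Fin.all? λ B → (B ∈? I) →-dec (B ∼? E)

    μ-product : Subset m → Carrier
    μ-product I = prodᶠ λ B → if does (B ∈? I) then μ B else 1#

    independentSets : Fin m → List (Subset m)
    independentSets E = List.filter (λ I → (I ⊆N? E) ×-dec independent? I) (subsets m)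

    θ : Fin m → Carrier
    θ E = Pr (product p) (holds (ℬ E)) * ∑ (independentSets E) μ-product

    prodᶠ-nonneg : ∀ {k} (f : Fin k → Carrier) → (∀ i → 0# ≤ f i) → 0# ≤ prodᶠ f
    prodᶠ-nonneg {zero}  f 0≤f = 0≤1
    prodᶠ-nonneg {suc k} f 0≤f = *-nonneg (0≤f zero) (prodᶠ-nonneg (f ∘ suc) (0≤f ∘ suc))

    θ≥0 : ∀ E → 0# ≤ θ E
    θ≥0 E = *-nonneg (Pr-nonneg _ _)
                     (∑-nonneg (λ I → prodᶠ-nonneg _ (factor I)) (independentSets E))
      where
      factor : ∀ I B → 0# ≤ (if does (B ∈? I) then μ B else 1#)
      factor I B with does (B ∈? I)
      ... | true  = μ≥0 B
      ... | false = 0≤1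

    -- min(1, μ/θ), reading μ/0 as ∞.
    q : Fin m → Carrier
    q B with θ B ≟ 0#
    ... | yes _ = 1#
    ... | no  _ = 1# ⊓ (μ B * θ B ⁻¹)

    q≥0 : ∀ B → 0# ≤ q B
    q≥0 B with θ B ≟ 0#
    ... | yes _   = 0≤1
    ... | no  θ≉0 = ⊓-glb 0≤1 (*-nonneg (μ≥0 B) (⁻¹-nonneg (θ≥0 B) θ≉0))

    q≤1 : ∀ B → q B ≤ 1#
    q≤1 B with θ B ≟ 0#
    ... | yes _ = ≤-refl
    ... | no  _ = x⊓y≤x 1# (μ B * θ B ⁻¹)

    -- The variables X₁, …, Xₙ come first, followed by Y(B) for each B.
    p′ : Fin (n ℕ.+ m) → PMF ℤ
    p′ i = [ p , (λ B → bernoulli (q B) (q≥0 B) (q≤1 B)) ]′ (splitAt n i)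

    ℬ′ : Fin m → Event (n ℕ.+ m)
    ℬ′ B = record
      { vars  = vars (ℬ B) Vec.++ ⁅ B ⁆
      ; holds = λ z → holds (ℬ B) (take n z) ∧ does (lookup z (n ↑ʳ B) ℤ.≟ + 1)
      ; local = λ x y eq → ≡.cong₂ _∧_
          (local (ℬ B) (take n x) (take n y) λ i i∈ →
            ≡.trans (lookup-take x i)
              (≡.trans (eq (i ↑ˡ m) (∈-++⁺ᴸ (vars (ℬ B)) ⁅ B ⁆ i∈))
                (≡.sym (lookup-take y i))))
          (≡.cong (λ a → does (a ℤ.≟ + 1))
            (eq (n ↑ʳ B) (∈-++⁺ᴿ (vars (ℬ B)) ⁅ B ⁆ (x∈⁅x⁆ B))))
      }
      where
      lookup-take : (z : Vec ℤ (n ℕ.+ m)) (i : Fin n) →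
                    lookup (take n z) i ≡ lookup z (i ↑ˡ m)
      lookup-take z i = ≡.trans
        (≡.sym (Vec.lookup-++ˡ (take n z) (Vec.drop n z) i))
        (≡.cong (λ v → lookup v (i ↑ˡ m)) (Vec.take++drop≡id n z))

      ∈-++⁺ᴸ : (S : Subset n) (T : Subset m) {i : Fin n} → i ∈ S → (i ↑ˡ m) ∈ (S Vec.++ T)
      ∈-++⁺ᴸ S T {i} i∈ = Vec.lookup⇒[]= (i ↑ˡ m) (S Vec.++ T)
        (≡.trans (Vec.lookup-++ˡ S T i) (Vec.[]=⇒lookup i∈))

      ∈-++⁺ᴿ : (S : Subset n) (T : Subset m) {j : Fin m} → j ∈ T → (n ↑ʳ j) ∈ (S Vec.++ T)
      ∈-++⁺ᴿ S T {j} j∈ = Vec.lookup⇒[]= (n ↑ʳ j) (S Vec.++ T)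
        (≡.trans (Vec.lookup-++ʳ S T j) (Vec.[]=⇒lookup j∈))

{-# OPTIONS --safe #-}

-- A final event A is charged, at a state x, the total mass φ(x) of all stacks of
-- independent layers of bad events that could lead from x to A; the mass of a stack
-- is the probability that its events hold when they are resampled one after the
-- other, starting from x.  Resampling an event B either adds B to the layer of the
-- stack that it sinks to or, when B is unrelated to the whole stack, leaves the mass
-- unchanged.  Hence φ is a supermartingale that pays for every occurrence of A,
-- whatever the selection rule.  Under the product distribution the mass of a stack
-- factors into the probabilities of its events, and the sum over all stacks
-- telescopes layer by layer because q(B) θ(B) ≤ μ(B).  As the expected number of
-- resamplings is finite, the execution terminates with probability 1; at termination
-- B can only be true if Y(B) = 0, which is an event about the same variables as B′.
module Submission where

open import Defs
open import Level using (0ℓ)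
import Algebra.Construct.NaturalChoice.Max as NaturalMax
import Algebra.Construct.NaturalChoice.Min as NaturalMin
import Algebra.Properties.CommutativeSemigroup as CommutativeSemigroupProperties
import Algebra.Properties.Ring as RingProperties
import Relation.Binary.Reasoning.PartialOrder as PosetReasoning
open import Data.Bool.Base using (Bool; true; false; if_then_else_; _∧_; not)
import Data.Bool.Properties as Bool
open import Data.Empty using (⊥-elim)
open import Data.Fin.Base using (Fin; zero; suc; splitAt; _↑ˡ_; _↑ʳ_)
import Data.Fin.Properties as Fin
open import Data.Fin.Subset
  using (Subset; inside; outside; _∈_; _∉_; _∩_; _∪_; ∁; ⁅_⁆; ⊤; ⊥)
open import Data.Fin.Subset.Properties
  using (_∈?_; x∈⁅x⁆; x∈⁅y⁆⇒x≡y; ∉⊥; x∈p∩q⁺; x∈p∩q⁻; x∈∁p⇒x∉p; Empty-unique;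
         ∪-comm; ∩-distribˡ-∪; p∪∁p≡⊤; ∩-identityʳ)
open import Data.Integer.Base using (ℤ; +_; -[1+_])
import Data.Integer.Properties as ℤ
open import Data.List.Base as List using (List; []; _∷_; _++_; [_]; concatMap; allFin; upTo)
open import Data.List.Membership.Propositional using () renaming (_∈_ to _∈ˡ_)
open import Data.List.Membership.Propositional.Properties
  using (∈-++⁺ˡ; ∈-++⁺ʳ; ∈-map⁺; ∈-map⁻; ∈-deduplicate⁺; ∈-cartesianProductWith⁺;
         ∈-filter⁺; ∈-filter⁻; ∈-concatMap⁺; ∈-concatMap⁻; ∈-allFin)
open import Data.List.Relation.Unary.All as All using (All; []; _∷_)
import Data.List.Relation.Unary.All.Properties as All
open import Data.List.Relation.Unary.AllPairs as AllPairs using ([]; _∷_)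
import Data.List.Relation.Unary.AllPairs.Properties as AllPairs
open import Data.List.Relation.Unary.Any as Any using (here; there)
open import Data.List.Relation.Unary.Unique.Propositional using (Unique)
import Data.List.Relation.Unary.Unique.Propositional.Properties as Unique
open import Data.List.Relation.Unary.Unique.DecPropositional.Properties using (deduplicate-!)
open import Data.Nat.Base as ℕ using (ℕ; zero; suc)
open import Data.Nat.ListAction using (sum)
import Data.Nat.Properties as ℕ
open import Data.Product.Base
  using (Σ-syntax; ∃; ∃-syntax; _×_; _,_; proj₁; proj₂)
open import Data.Product.Properties using (,-injective)
open import Data.Sum.Base using (_⊎_; inj₁; inj₂; [_,_]′)
open import Data.Vec.Base as Vec using (Vec; []; _∷_; lookup; take; drop; _[_]≔_; here; there)
open import Data.Vec.Membership.Propositional.Properties using (∈-toList⁺; ∈-lookup)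
import Data.Vec.Properties as Vec
open import Function.Base using (_∘_; id)
open import Function.Bundles using (mk⇔)
open import Relation.Binary.Bundles using (TotalOrder)
open import Relation.Binary.Definitions using (DecidableEquality; tri<; tri≈; tri>)
open import Relation.Binary.PropositionalEquality as ≡ using (_≡_; _≢_; refl)
open import Relation.Nullary using (Dec; yes; no; ¬_; does)
open import Relation.Nullary.Decidable using (_×-dec_; _→-dec_; dec-true; dec-false; does-⇔)
open import Relation.Unary using (Pred; Decidable)

-- The potential depends on the present state alone and not on past choices, which is why an
-- adaptive randomized rule costs nothing; a witness tree would be read off a log instead. Layers
-- are independent sets because the operators of unrelated events commute, so a new event can slide
-- past one layer and settle in another. Layers also account for the sum in θ(B): the events
-- directly above B in a stack form an independent subset of its inclusive neighbourhood, so that B′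
-- with all that lies above it costs at most q(B) θ(B). The final event is kept general because two
-- are needed: B′ itself, and "B is true but its coin Y(B) fails", of probability P(B)(1 - q(B)),
-- which leads to (1 - q(B)) θ(B). Infinite sums exist only as suprema of finite ones. Upper bounds
-- are therefore proved for finitely many histories, with stacks whose fixed height limits the
-- number of remaining steps; the bound from below, that halting executions have mass 1, has to pass
-- through suprema.

does-true : {A : Set} (A? : Dec A) → does A? ≡ true → A
does-true (yes a) _ = a

-- Finite sums, their suprema, and the resampling kernel.

module Sums (ℝ : CompleteOrderedField) where

  open CompleteOrderedField ℝ
  open Probability ℝ
  open PosetReasoning (TotalOrder.poset totalOrder) hiding (start)
  open CommutativeSemigroupProperties *-commutativeSemigroup
    using () renaming (x∙yz≈y∙xz to *-swap)
  open CommutativeSemigroupProperties +-commutativeSemigroup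
    using () renaming (interchange to +-interchange)

  private
    variable
      A B C : Set
      n m : ℕ

  𝟙-nonneg : ∀ b → 0# ≤ 𝟙 b
  𝟙-nonneg true  = 0≤1
  𝟙-nonneg false = ≤-refl

  𝟙≤1 : ∀ b → 𝟙 b ≤ 1#
  𝟙≤1 true  = ≤-refl
  𝟙≤1 false = 0≤1

  *-≤ˡ : ∀ {x y} → 0# ≤ y → x ≤ 1# → x * y ≤ y
  *-≤ˡ {x} {y} 0≤y x≤1 = ≤-respʳ-≈ (*-identityˡ y) (*-monoʳ-≤ 0≤y x≤1)

  x≤x+y : ∀ {x y} → 0# ≤ y → x ≤ x + y
  x≤x+y {x} {y} 0≤y = ≤-respˡ-≈ (+-identityʳ x) (+-monoʳ-≤ x 0≤y)

  x+y≤z⇒y≤z-x : ∀ {x y z} → x + y ≤ z → y ≤ z + - x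
  x+y≤z⇒y≤z-x {x} {y} {z} le = begin
    y              ≈⟨ +-identityʳ y ⟨
    y + 0#         ≈⟨ +-congˡ (-‿inverseʳ x) ⟨
    y + (x + - x)  ≈⟨ +-assoc y x (- x) ⟨
    y + x + - x    ≈⟨ +-congʳ (+-comm y x) ⟩
    x + y + - x    ≤⟨ +-mono-≤ le ≤-refl ⟩
    z + - x        ∎

  y≤z-x⇒x+y≤z : ∀ {x y z} → y ≤ z + - x → x + y ≤ z
  y≤z-x⇒x+y≤z {x} {y} {z} le = begin
    x + y            ≤⟨ +-monoʳ-≤ x le ⟩
    x + (z + - x)    ≈⟨ +-comm x (z + - x) ⟩
    z + - x + x      ≈⟨ +-assoc z (- x) x ⟩
    z + (- x + x)    ≈⟨ +-congˡ (-‿inverseˡ x) ⟩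
    z + 0#           ≈⟨ +-identityʳ z ⟩
    z                ∎

  x≤y+z⇒x-y≤z : ∀ {x y z} → x ≤ y + z → x + - y ≤ z
  x≤y+z⇒x-y≤z {x} {y} {z} le = begin
    x + - y        ≤⟨ +-mono-≤ le ≤-refl ⟩
    y + z + - y    ≈⟨ +-congʳ (+-comm y z) ⟩
    z + y + - y    ≈⟨ +-assoc z y (- y) ⟩
    z + (y + - y)  ≈⟨ +-congˡ (-‿inverseʳ y) ⟩
    z + 0#         ≈⟨ +-identityʳ z ⟩
    z              ∎

  ∑-mono-∈ : {f g : A → Carrier} → ∀ xs → (∀ x → x ∈ˡ xs → f x ≤ g x) → ∑ xs f ≤ ∑ xs g
  ∑-mono-∈ []       f≤g = ≤-refl
  ∑-mono-∈ (x ∷ xs) f≤g = +-mono-≤ (f≤g x (here refl)) (∑-mono-∈ xs (λ y → f≤g y ∘ there))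

  ∑-cong : {f g : A → Carrier} → (∀ x → f x ≈ g x) → ∀ xs → ∑ xs f ≈ ∑ xs g
  ∑-cong eq []       = Eq.refl
  ∑-cong eq (x ∷ xs) = +-cong (eq x) (∑-cong eq xs)

  ∑-+ : (f g : A → Carrier) → ∀ xs → ∑ xs (λ x → f x + g x) ≈ ∑ xs f + ∑ xs g
  ∑-+ f g []       = Eq.sym (+-identityˡ 0#)
  ∑-+ f g (x ∷ xs) =
    Eq.trans (+-congˡ (∑-+ f g xs)) (+-interchange (f x) (g x) (∑ xs f) (∑ xs g))

  ∑-*ʳ : (c : Carrier) (f : A → Carrier) → ∀ xs → ∑ xs (λ x → f x * c) ≈ ∑ xs f * c
  ∑-*ʳ c f xs = begin-equality
    ∑ xs (λ x → f x * c)  ≈⟨ ∑-cong (λ x → *-comm (f x) c) xs ⟩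
    ∑ xs (λ x → c * f x)  ≈⟨ ∑-*ˡ c f xs ⟩
    c * ∑ xs f            ≈⟨ *-comm c (∑ xs f) ⟩
    ∑ xs f * c            ∎

  ∑-0 : {f : A → Carrier} → (∀ x → f x ≈ 0#) → ∀ xs → ∑ xs f ≈ 0#
  ∑-0 eq []       = Eq.refl
  ∑-0 eq (x ∷ xs) = Eq.trans (+-cong (eq x) (∑-0 eq xs)) (+-identityˡ 0#)

  ∑-map : (φ : A → B) (f : B → Carrier) → ∀ xs → ∑ (List.map φ xs) f ≡ ∑ xs (f ∘ φ)
  ∑-map φ f []       = refl
  ∑-map φ f (x ∷ xs) = ≡.cong (λ s → f (φ x) + s) (∑-map φ f xs)

  ∑-concatMap : (k : A → List B) (f : B → Carrier) → ∀ xs →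
                ∑ (concatMap k xs) f ≈ ∑ xs (λ x → ∑ (k x) f)
  ∑-concatMap k f []       = Eq.refl
  ∑-concatMap k f (x ∷ xs) =
    Eq.trans (∑-++ f (k x) (concatMap k xs)) (+-congˡ (∑-concatMap k f xs))

  ∑-cartesianProductWith : (_∙_ : A → B → C) (f : C → Carrier) → ∀ xs ys →
    ∑ (List.cartesianProductWith _∙_ xs ys) f ≈ ∑ xs (λ x → ∑ ys (λ y → f (x ∙ y)))
  ∑-cartesianProductWith _∙_ f []       ys = Eq.refl
  ∑-cartesianProductWith _∙_ f (x ∷ xs) ys = Eq.trans (∑-++ f (List.map (x ∙_) ys) _)
    (+-cong (Eq.reflexive (∑-map (x ∙_) f ys)) (∑-cartesianProductWith _∙_ f xs ys))

  ∑-swap : (f : A → B → Carrier) → ∀ xs ys →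
           ∑ xs (λ x → ∑ ys (f x)) ≈ ∑ ys (λ y → ∑ xs (λ x → f x y))
  ∑-swap f []       ys = Eq.sym (∑-0 (λ _ → Eq.refl) ys)
  ∑-swap f (x ∷ xs) ys = Eq.trans (+-congˡ (∑-swap f xs ys)) (Eq.sym (∑-+ (f x) _ ys))

  ∑-member : {f : A → Carrier} → (∀ x → 0# ≤ f x) → ∀ {x xs} → x ∈ˡ xs → f x ≤ ∑ xs f
  ∑-member {f = f} 0≤f {x} {xs} x∈xs = ≤-respˡ-≈ (+-identityʳ (f x))
    (∑-⊆ 0≤f (x ∷ []) xs ([] ∷ []) (λ { y (here refl) → inj₁ x∈xs }))

  ∑-filter : (f : A → Carrier) {P : Pred A 0ℓ} (P? : Decidable P) → ∀ xs →
             ∑ xs (λ x → 𝟙 (does (P? x)) * f x) ≈ ∑ (List.filter P? xs) f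
  ∑-filter f P? []       = Eq.refl
  ∑-filter f P? (x ∷ xs) with does (P? x)
  ... | true  = +-cong (*-identityˡ (f x)) (∑-filter f P? xs)
  ... | false = Eq.trans (+-cong (zeroˡ (f x)) (∑-filter f P? xs)) (+-identityˡ _)

  ∑-delta : {f : A → Carrier} → (∀ x → 0# ≤ f x) → (_≟ᴬ_ : DecidableEquality A) →
            ∀ a xs → Unique xs → ∑ xs (λ x → 𝟙 (does (a ≟ᴬ x)) * f x) ≤ f a
  ∑-delta {f = f} 0≤f _≟ᴬ_ a xs xs! = begin
    ∑ xs (λ x → 𝟙 (does (a ≟ᴬ x)) * f x) ≈⟨ ∑-filter f (a ≟ᴬ_) xs ⟩
    ∑ (List.filter (a ≟ᴬ_) xs) f
      ≤⟨ ∑-⊆ 0≤f _ (a ∷ []) (Unique.filter⁺ (a ≟ᴬ_) xs!)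
           (λ x x∈ → inj₁ (here (≡.sym (proj₂ (∈-filter⁻ (a ≟ᴬ_) {xs = xs} x∈))))) ⟩
    f a + 0#                             ≈⟨ +-identityʳ (f a) ⟩
    f a                                  ∎

  ∑-injection : {f : A → Carrier} {g : B → Carrier} (φ : A → B) → (∀ y → 0# ≤ g y) →
                (∀ {x y} → φ x ≡ φ y → x ≡ y) → ∀ {xs ys} → Unique xs →
                (∀ x → x ∈ˡ xs → φ x ∈ˡ ys) → (∀ x → x ∈ˡ xs → f x ≤ g (φ x)) →
                ∑ xs f ≤ ∑ ys g
  ∑-injection {f = f} {g} φ 0≤g inj {xs} {ys} xs! into f≤g = begin
    ∑ xs f               ≤⟨ ∑-mono-∈ xs f≤g ⟩
    ∑ xs (g ∘ φ)         ≡⟨ ∑-map φ g xs ⟨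
    ∑ (List.map φ xs) g  ≤⟨ ∑-⊆ 0≤g _ ys (Unique.map⁺ inj xs!) sub ⟩
    ∑ ys g               ∎
    where
    sub : ∀ y → y ∈ˡ List.map φ xs → y ∈ˡ ys ⊎ g y ≤ 0#
    sub y y∈ with ∈-map⁻ φ y∈
    ... | x , x∈xs , refl = inj₁ (into x x∈xs)

  -- The part of Tonelli's theorem that survives without a notion of infinite
  -- sum: each f a is at most the supremum of the finite sums of g over the
  -- fibre of π above a.
  ∑-fibres : (π : C → A) (f : A → Carrier) (g : C → Carrier) →
             (∀ a u → (∀ cs → Unique cs → All (λ c → π c ≡ a) cs → ∑ cs g ≤ u) → f a ≤ u) →
             ∀ xs → Unique xs → ∀ u →
             (∀ cs → Unique cs → All (λ c → π c ∈ˡ xs) cs → ∑ cs g ≤ u) → ∑ xs f ≤ u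
  ∑-fibres π f g fibre [] _ u bound = bound [] [] []
  ∑-fibres π f g fibre (x ∷ xs) (x∉xs ∷ xs!) u bound =
    -- One supremum is taken at a time: the sum over `xs` is moved to the bound while the fibre
    -- above `x` is exhausted, then the sum over that fibre while `xs` is treated by induction.
    ≤-respˡ-≈ (+-comm (∑ xs f) (f x)) (y≤z-x⇒x+y≤z (fibre x _ λ cs cs! cs∈ →
      x+y≤z⇒y≤z-x (≤-respˡ-≈ (+-comm (∑ cs g) (∑ xs f)) (y≤z-x⇒x+y≤z
        (∑-fibres π f g fibre xs xs! _ λ ds ds! ds∈ → x+y≤z⇒y≤z-x
          (≤-respˡ-≈ (∑-++ g cs ds) (bound (cs ++ ds)
            (Unique.++⁺ cs! ds! λ (c∈cs , c∈ds) → All.lookup x∉xs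
              (≡.subst (_∈ˡ xs) (All.lookup cs∈ c∈cs) (All.lookup ds∈ c∈ds)) refl)
            (All.++⁺ (All.map here cs∈) (All.map there ds∈)))))))))

  -- Multiplication by a constant passes through the supremum: a nonzero `c` is divided out of the
  -- bound, and for `c = 0` the empty sum suffices.
  hasSum-scale : {f : A → Carrier} {c : Carrier} → HasSum f 1# → 0# ≤ c → ∀ u →
                 (∀ xs → Unique xs → c * ∑ xs f ≤ u) → c ≤ u
  hasSum-scale {f = f} {c} f-sum 0≤c u bound with c ≟ 0#
  ... | yes c≈0 = begin
    c       ≈⟨ c≈0 ⟩
    0#      ≈⟨ zeroʳ c ⟨
    c * 0#  ≤⟨ bound [] [] ⟩
    u       ∎
  ... | no c≉0 = begin
    c               ≈⟨ *-identityʳ c ⟨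
    c * 1#          ≤⟨ *-monoˡ-≤ 0≤c (hasSum-least f-sum (c ⁻¹ * u) below) ⟩
    c * (c ⁻¹ * u)  ≈⟨ *-assoc c (c ⁻¹) u ⟨
    c * c ⁻¹ * u    ≈⟨ *-congʳ (*-inverseʳ c c≉0) ⟩
    1# * u          ≈⟨ *-identityˡ u ⟩
    u               ∎
    where
    below : ∀ xs → Unique xs → ∑ xs f ≤ c ⁻¹ * u
    below xs xs! = begin
      ∑ xs f              ≈⟨ *-identityˡ (∑ xs f) ⟨
      1# * ∑ xs f         ≈⟨ *-congʳ (*-inverseʳ c c≉0) ⟨
      c * c ⁻¹ * ∑ xs f   ≈⟨ *-assoc c (c ⁻¹) (∑ xs f) ⟩
      c * (c ⁻¹ * ∑ xs f) ≈⟨ *-swap c (c ⁻¹) (∑ xs f) ⟩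
      c ⁻¹ * (c * ∑ xs f) ≤⟨ *-monoˡ-≤ (⁻¹-nonneg 0≤c c≉0) (bound xs xs!) ⟩
      c ⁻¹ * u            ∎

  -- If `s` is the supremum of the multiples of `a`, then `s - a` bounds them too, because adding
  -- `a` to a multiple gives a multiple. Hence `s ≤ s - a`.
  archimedean : ∀ {a b} → (∀ k → k · a ≤ b) → a ≤ 0#
  archimedean {a} {b} bound with supremum (λ x → ∃[ k ] (k · a ≈ x)) (0# , 0 , Eq.refl)
                                   (b , λ { x (k , eq) → ≤-respˡ-≈ eq (bound k) })
  ... | s , upper , least = begin
    a        ≤⟨ x+y≤z⇒y≤z-x (y≤z-x⇒x+y≤z′ (least (s + - a) λ { x (k , eq) →
                  ≤-respˡ-≈ eq (x+y≤z⇒y≤z-x (upper _ (suc k , Eq.refl))) })) ⟩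
    s + - s  ≈⟨ -‿inverseʳ s ⟩
    0#       ∎
    where
    y≤z-x⇒x+y≤z′ : ∀ {x y z} → y ≤ z + - x → y + x ≤ z
    y≤z-x⇒x+y≤z′ {x} {y} le = ≤-respˡ-≈ (+-comm x y) (y≤z-x⇒x+y≤z le)

  sumᶠ≈∑ : (f : Fin m → Carrier) → sumᶠ f ≈ ∑ (allFin m) f
  sumᶠ≈∑ f = go f id
    where
    go : ∀ {k} (f : A → Carrier) (e : Fin k → A) → sumᶠ (f ∘ e) ≈ ∑ (List.tabulate e) f
    go {k = zero}  f e = Eq.refl
    go {k = suc k} f e = +-congˡ (go f (e ∘ suc))

  prodᶠ-nonneg : {f : Fin n → Carrier} → (∀ i → 0# ≤ f i) → 0# ≤ prodᶠ f
  prodᶠ-nonneg {zero}  0≤f = 0≤1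
  prodᶠ-nonneg {suc n} 0≤f = *-nonneg (0≤f zero) (prodᶠ-nonneg (0≤f ∘ suc))

  prodᶠ-mono : {f g : Fin n → Carrier} → (∀ i → 0# ≤ f i) → (∀ i → f i ≤ g i) →
               prodᶠ f ≤ prodᶠ g
  prodᶠ-mono {zero}  0≤f f≤g = ≤-refl
  prodᶠ-mono {suc n} 0≤f f≤g = *-mono-≤ (≤-trans (0≤f zero) (f≤g zero))
    (prodᶠ-nonneg (0≤f ∘ suc)) (f≤g zero) (prodᶠ-mono (0≤f ∘ suc) (f≤g ∘ suc))

  prodᶠ-cong : {f g : Fin n → Carrier} → (∀ i → f i ≈ g i) → prodᶠ f ≈ prodᶠ g
  prodᶠ-cong {zero}  eq = Eq.refl
  prodᶠ-cong {suc n} eq = *-cong (eq zero) (prodᶠ-cong (eq ∘ suc))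

  hasSum-cong : {f g : A → Carrier} {s : Carrier} → (∀ x → f x ≈ g x) → HasSum f s → HasSum g s
  hasSum-cong f≈g f-sum = hasSum
    (λ xs xs! → ≤-respˡ-≈ (∑-cong f≈g xs) (hasSum-upper f-sum xs xs!))
    (λ u bound → hasSum-least f-sum u λ xs xs! →
      ≤-respˡ-≈ (Eq.sym (∑-cong f≈g xs)) (bound xs xs!))

  dirac : ℤ → PMF ℤ
  dirac a = record
    { mass     = λ b → 𝟙 (does (a ℤ.≟ b))
    ; nonneg   = λ b → 𝟙-nonneg (does (a ℤ.≟ b))
    ; hasSum-1 = hasSum
        (λ bs bs! → ≤-respˡ-≈ (∑-cong (λ b → *-identityʳ (𝟙 (does (a ℤ.≟ b)))) bs)
                              (∑-delta {f = λ _ → 1#} (λ _ → 0≤1) ℤ._≟_ a bs bs!))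
        (λ u bound → ≤-respˡ-≈ (Eq.trans (+-identityʳ _)
           (Eq.reflexive (≡.cong 𝟙 (dec-true (a ℤ.≟ a) refl)))) (bound (a ∷ []) ([] ∷ [])))
    }

  -- Unfolds to `resampleMass B` at `S = vars (ℬ B)`, so the facts about it apply to executions
  -- without conversion.
  transition : (Fin n → PMF ℤ) → Subset n → Vec ℤ n → Vec ℤ n → Carrier
  transition p S x y = prodᶠ λ i →
    if does (i ∈? S) then mass (p i) (lookup y i) else 𝟙 (does (lookup x i ℤ.≟ lookup y i))

  -- Keeping a value is drawing it from a point mass, so the transition is a product distribution.
  transition-hasSum : (p : Fin n → PMF ℤ) → ∀ S x → HasSum (transition p S x) 1#
  transition-hasSum p S x = hasSum-cong
    (λ y → prodᶠ-cong λ i → Eq.reflexive (Bool.if-float (λ P → mass P (lookup y i)) (does (i ∈? S))))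
    (jointMass-hasSum (λ i → if does (i ∈? S) then p i else dirac (lookup x i)))

  transition-nonneg : (p : Fin n → PMF ℤ) → ∀ S x y → 0# ≤ transition p S x y
  transition-nonneg p S x y = prodᶠ-nonneg λ i → factor i (does (i ∈? S))
    where
    factor : ∀ i b → 0# ≤ (if b then mass (p i) (lookup y i)
                                else 𝟙 (does (lookup x i ℤ.≟ lookup y i)))
    factor i true  = nonneg (p i) (lookup y i)
    factor i false = 𝟙-nonneg (does (lookup x i ℤ.≟ lookup y i))

-- Integration over some of the variables, truncated to finitely many values.

module Average (ℝ : CompleteOrderedField) (F : List ℤ) (F! : Unique F) where

  open CompleteOrderedField ℝ
  open Probability ℝ
  open Sums ℝ
  open PosetReasoning (TotalOrder.poset totalOrder) hiding (start)
  open CommutativeSemigroupProperties *-commutativeSemigroup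
    using () renaming (x∙yz≈y∙xz to *-swap)

  private
    variable
      A : Set
      n m : ℕ

  -- The integral over the variables in S, truncated to the values in F.  Working
  -- with finite F avoids infinite sums; every upper bound only concerns finitely
  -- many histories, hence finitely many values.
  𝔼 : (Fin n → PMF ℤ) → Subset n → (Vec ℤ n → Carrier) → Vec ℤ n → Carrier
  𝔼 p []            f []      = f []
  𝔼 p (inside ∷ S)  f (a ∷ x) = ∑ F λ b → mass (p zero) b * 𝔼 (p ∘ suc) S (λ y → f (b ∷ y)) x
  𝔼 p (outside ∷ S) f (a ∷ x) = 𝔼 (p ∘ suc) S (λ y → f (a ∷ y)) x

  Disjoint : Subset n → Subset n → Set
  Disjoint S T = ∀ i → i ∈ S → i ∉ T

  Local : Subset n → (Vec ℤ n → Carrier) → Set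
  Local S f = ∀ x y → (∀ i → i ∈ S → lookup x i ≡ lookup y i) → f x ≈ f y

  Insensitive : Subset n → (Vec ℤ n → Carrier) → Set
  Insensitive S f = ∀ x y → (∀ i → i ∉ S → lookup x i ≡ lookup y i) → f x ≈ f y

  private
    tail-disjoint : ∀ {s t} {S T : Subset n} → Disjoint (s ∷ S) (t ∷ T) → Disjoint S T
    tail-disjoint dis i i∈S i∈T = dis (suc i) (there i∈S) (there i∈T)

    tail-local : ∀ {s} {S : Subset n} {f} → Local (s ∷ S) f → ∀ a → Local S (λ y → f (a ∷ y))
    tail-local loc a x y eq = loc (a ∷ x) (a ∷ y) λ
      { zero _ → refl ; (suc i) (there i∈) → eq i i∈ }

    tail-insensitive : ∀ {s} {S : Subset n} {f} → Insensitive (s ∷ S) f →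
                       ∀ a → Insensitive S (λ y → f (a ∷ y))
    tail-insensitive ins a x y eq = ins (a ∷ x) (a ∷ y) λ
      { zero _ → refl ; (suc i) i∉ → eq i (i∉ ∘ there) }

    head-insensitive : ∀ {S : Subset n} {f} → Insensitive (inside ∷ S) f →
                       ∀ a b y → f (a ∷ y) ≈ f (b ∷ y)
    head-insensitive ins a b y = ins (a ∷ y) (b ∷ y) λ
      { zero z∉ → ⊥-elim (z∉ here) ; (suc i) _ → refl }

    head-local : ∀ {S : Subset n} {f} → Local (outside ∷ S) f → ∀ a b y → f (a ∷ y) ≈ f (b ∷ y)
    head-local loc a b y = loc (a ∷ y) (b ∷ y) λ { (suc i) (there _) → refl }

  local⇒insensitive : ∀ {S T : Subset n} {f} → Local T f → Disjoint S T → Insensitive S f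
  local⇒insensitive loc dis x y eq = loc x y λ i i∈T → eq i λ i∈S → dis i i∈S i∈T

  𝔼-mono : ∀ (p : Fin n → PMF ℤ) S {f g} → (∀ y → f y ≤ g y) → ∀ x → 𝔼 p S f x ≤ 𝔼 p S g x
  𝔼-mono p []            f≤g []      = f≤g []
  𝔼-mono p (inside ∷ S)  f≤g (a ∷ x) = ∑-mono
    (λ b → *-monoˡ-≤ (nonneg (p zero) b) (𝔼-mono (p ∘ suc) S (λ y → f≤g (b ∷ y)) x)) F
  𝔼-mono p (outside ∷ S) f≤g (a ∷ x) = 𝔼-mono (p ∘ suc) S (λ y → f≤g (a ∷ y)) x

  𝔼-cong : ∀ (p : Fin n → PMF ℤ) S {f g} → (∀ y → f y ≈ g y) → ∀ x → 𝔼 p S f x ≈ 𝔼 p S g x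
  𝔼-cong p S f≈g x = antisym (𝔼-mono p S (λ y → ≤-reflexive (f≈g y)) x)
                             (𝔼-mono p S (λ y → ≤-reflexive (Eq.sym (f≈g y))) x)

  𝔼-cong-PMF : ∀ {p p₁ : Fin n → PMF ℤ} → (∀ i → p i ≡ p₁ i) → ∀ S f x → 𝔼 p S f x ≈ 𝔼 p₁ S f x
  𝔼-cong-PMF eq []            f []      = Eq.refl
  𝔼-cong-PMF eq (inside ∷ S)  f (a ∷ x) = ∑-cong (λ b →
    *-cong (Eq.reflexive (≡.cong (λ P → mass P b) (eq zero)))
           (𝔼-cong-PMF (eq ∘ suc) S (λ y → f (b ∷ y)) x)) F
  𝔼-cong-PMF eq (outside ∷ S) f (a ∷ x) = 𝔼-cong-PMF (eq ∘ suc) S (λ y → f (a ∷ y)) x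

  𝔼-nonneg : ∀ (p : Fin n → PMF ℤ) S {f} → (∀ y → 0# ≤ f y) → ∀ x → 0# ≤ 𝔼 p S f x
  𝔼-nonneg p []            0≤f []      = 0≤f []
  𝔼-nonneg p (inside ∷ S)  0≤f (a ∷ x) = ∑-nonneg
    (λ b → *-nonneg (nonneg (p zero) b) (𝔼-nonneg (p ∘ suc) S (λ y → 0≤f (b ∷ y)) x)) F
  𝔼-nonneg p (outside ∷ S) 0≤f (a ∷ x) = 𝔼-nonneg (p ∘ suc) S (λ y → 0≤f (a ∷ y)) x

  𝔼-⊥ : ∀ (p : Fin n → PMF ℤ) f x → 𝔼 p ⊥ f x ≡ f x
  𝔼-⊥ p f []      = refl
  𝔼-⊥ p f (a ∷ x) = 𝔼-⊥ (p ∘ suc) (λ y → f (a ∷ y)) x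

  𝔼-∑ : ∀ (p : Fin n → PMF ℤ) S (f : A → Vec ℤ n → Carrier) ks x →
        𝔼 p S (λ y → ∑ ks (λ k → f k y)) x ≈ ∑ ks (λ k → 𝔼 p S (f k) x)
  𝔼-∑ p []            f ks []      = Eq.refl
  𝔼-∑ p (inside ∷ S)  f ks (a ∷ x) = begin-equality
    ∑ F (λ b → μ b * 𝔼 p′ S (λ y → ∑ ks (λ k → f k (b ∷ y))) x)
      ≈⟨ ∑-cong (λ b → *-congˡ (𝔼-∑ p′ S (λ k y → f k (b ∷ y)) ks x)) F ⟩
    ∑ F (λ b → μ b * ∑ ks (λ k → 𝔼 p′ S (λ y → f k (b ∷ y)) x))
      ≈⟨ ∑-cong (λ b → ∑-*ˡ (μ b) (λ k → 𝔼 p′ S (λ y → f k (b ∷ y)) x) ks) F ⟨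
    ∑ F (λ b → ∑ ks (λ k → μ b * 𝔼 p′ S (λ y → f k (b ∷ y)) x))
      ≈⟨ ∑-swap (λ b k → μ b * 𝔼 p′ S (λ y → f k (b ∷ y)) x) F ks ⟩
    ∑ ks (λ k → ∑ F (λ b → μ b * 𝔼 p′ S (λ y → f k (b ∷ y)) x)) ∎
    where
    p′ = p ∘ suc
    μ  = mass (p zero)
  𝔼-∑ p (outside ∷ S) f ks (a ∷ x) = 𝔼-∑ (p ∘ suc) S (λ k y → f k (a ∷ y)) ks x

  𝔼-pull : ∀ (p : Fin n → PMF ℤ) S {g} → Insensitive S g → ∀ f x →
           𝔼 p S (λ y → g y * f y) x ≈ g x * 𝔼 p S f x
  𝔼-pull p []            ins f []      = Eq.refl
  𝔼-pull p (inside ∷ S) {g} ins f (a ∷ x) = Eq.trans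
    (∑-cong (λ b → begin-equality
      μ b * 𝔼 p′ S (λ y → g (b ∷ y) * f (b ∷ y)) x
        ≈⟨ *-congˡ (𝔼-pull p′ S (tail-insensitive ins b) (λ y → f (b ∷ y)) x) ⟩
      μ b * (g (b ∷ x) * 𝔼 p′ S (λ y → f (b ∷ y)) x)
        ≈⟨ *-swap (μ b) (g (b ∷ x)) _ ⟩
      g (b ∷ x) * (μ b * 𝔼 p′ S (λ y → f (b ∷ y)) x)
        ≈⟨ *-congʳ (head-insensitive ins b a x) ⟩
      g (a ∷ x) * (μ b * 𝔼 p′ S (λ y → f (b ∷ y)) x) ∎) F)
    (∑-*ˡ (g (a ∷ x)) (λ b → μ b * 𝔼 p′ S (λ y → f (b ∷ y)) x) F)
    where
    p′ = p ∘ suc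
    μ  = mass (p zero)
  𝔼-pull p (outside ∷ S) ins f (a ∷ x) =
    𝔼-pull (p ∘ suc) S (tail-insensitive ins a) (λ y → f (a ∷ y)) x

  -- Only an inequality, since the mass outside `F` is lost: every coordinate in `S` contributes a
  -- factor of at most 1.
  𝔼-insensitive-≤ : ∀ (p : Fin n → PMF ℤ) S {f} → (∀ y → 0# ≤ f y) → Insensitive S f →
                    ∀ x → 𝔼 p S f x ≤ f x
  𝔼-insensitive-≤ p []            0≤f ins []      = ≤-refl
  𝔼-insensitive-≤ p (inside ∷ S) {f} 0≤f ins (a ∷ x) = begin
    ∑ F (λ b → mass (p zero) b * 𝔼 (p ∘ suc) S (λ y → f (b ∷ y)) x)
      ≤⟨ ∑-mono (λ b → *-monoˡ-≤ (nonneg (p zero) b)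
           (≤-trans (𝔼-insensitive-≤ (p ∘ suc) S (λ y → 0≤f (b ∷ y)) (tail-insensitive ins b) x)
                    (≤-reflexive (head-insensitive ins b a x)))) F ⟩
    ∑ F (λ b → mass (p zero) b * f (a ∷ x))  ≈⟨ ∑-*ʳ (f (a ∷ x)) (mass (p zero)) F ⟩
    ∑ F (mass (p zero)) * f (a ∷ x)
      ≤⟨ *-≤ˡ (0≤f (a ∷ x)) (hasSum-upper (hasSum-1 (p zero)) F F!) ⟩
    f (a ∷ x) ∎
  𝔼-insensitive-≤ p (outside ∷ S) 0≤f ins (a ∷ x) =
    𝔼-insensitive-≤ (p ∘ suc) S (λ y → 0≤f (a ∷ y)) (tail-insensitive ins a) x

  𝔼-∪ : ∀ (p : Fin n → PMF ℤ) S T → Disjoint S T → ∀ f x →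
        𝔼 p S (𝔼 p T f) x ≈ 𝔼 p (S ∪ T) f x
  𝔼-∪ p []            []            dis f []      = Eq.refl
  𝔼-∪ p (inside ∷ S)  (inside ∷ T)  dis f (a ∷ x) = ⊥-elim (dis zero here here)
  𝔼-∪ p (inside ∷ S)  (outside ∷ T) dis f (a ∷ x) = ∑-cong (λ b → *-congˡ
    (𝔼-∪ (p ∘ suc) S T (tail-disjoint dis) (λ y → f (b ∷ y)) x)) F
  𝔼-∪ p (outside ∷ S) (inside ∷ T)  dis f (a ∷ x) = begin-equality
    𝔼 p′ S (λ y → ∑ F (λ b → μ b * 𝔼 p′ T (λ z → f (b ∷ z)) y)) x
      ≈⟨ 𝔼-∑ p′ S (λ b y → μ b * 𝔼 p′ T (λ z → f (b ∷ z)) y) F x ⟩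
    ∑ F (λ b → 𝔼 p′ S (λ y → μ b * 𝔼 p′ T (λ z → f (b ∷ z)) y) x)
      ≈⟨ ∑-cong (λ b → 𝔼-pull p′ S (λ _ _ _ → Eq.refl) (𝔼 p′ T (λ z → f (b ∷ z))) x) F ⟩
    ∑ F (λ b → μ b * 𝔼 p′ S (𝔼 p′ T (λ z → f (b ∷ z))) x)
      ≈⟨ ∑-cong (λ b → *-congˡ (𝔼-∪ p′ S T (tail-disjoint dis) (λ z → f (b ∷ z)) x)) F ⟩
    ∑ F (λ b → μ b * 𝔼 p′ (S ∪ T) (λ z → f (b ∷ z)) x) ∎
    where
    p′ = p ∘ suc
    μ  = mass (p zero)
  𝔼-∪ p (outside ∷ S) (outside ∷ T) dis f (a ∷ x) =
    𝔼-∪ (p ∘ suc) S T (tail-disjoint dis) (λ y → f (a ∷ y)) x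

  𝔼-commute : ∀ (p : Fin n → PMF ℤ) S T → Disjoint S T → ∀ f x →
              𝔼 p S (𝔼 p T f) x ≈ 𝔼 p T (𝔼 p S f) x
  𝔼-commute p S T dis f x = begin-equality
    𝔼 p S (𝔼 p T f) x  ≈⟨ 𝔼-∪ p S T dis f x ⟩
    𝔼 p (S ∪ T) f x    ≡⟨ ≡.cong (λ U → 𝔼 p U f x) (∪-comm S T) ⟩
    𝔼 p (T ∪ S) f x    ≈⟨ 𝔼-∪ p T S (λ i i∈T i∈S → dis i i∈S i∈T) f x ⟨
    𝔼 p T (𝔼 p S f) x  ∎

  -- Resampling S at a random state that is conditioned on an event about S
  -- restores the product distribution.
  𝔼-regenerate : ∀ (p : Fin n → PMF ℤ) S {g} → Local S g → ∀ f x →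
                 𝔼 p ⊤ (λ y → g y * 𝔼 p S f y) x ≈ 𝔼 p S g x * 𝔼 p ⊤ f x
  𝔼-regenerate p []            loc f []      = Eq.refl
  𝔼-regenerate p (inside ∷ S) {g} loc f (a ∷ x) = begin-equality
    ∑ F (λ b → μ b * 𝔼 p′ ⊤ (λ y → g (b ∷ y) * ∑ F (λ c → μ c * 𝔼 p′ S (f′ c) y)) x)
      ≈⟨ ∑-cong (λ b → *-congˡ (row b)) F ⟩
    ∑ F (λ b → μ b * (𝔼 p′ S (g′ b) x * R))
      ≈⟨ ∑-cong (λ b → *-assoc (μ b) (𝔼 p′ S (g′ b) x) R) F ⟨
    ∑ F (λ b → μ b * 𝔼 p′ S (g′ b) x * R)
      ≈⟨ ∑-*ʳ R (λ b → μ b * 𝔼 p′ S (g′ b) x) F ⟩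
    ∑ F (λ b → μ b * 𝔼 p′ S (g′ b) x) * R ∎
    where
    p′ = p ∘ suc
    μ  = mass (p zero)
    f′ = λ c y → f (c ∷ y)
    g′ = λ c y → g (c ∷ y)
    R  = ∑ F (λ c → μ c * 𝔼 p′ ⊤ (f′ c) x)

    -- The value `b` seen by `g` and the value `c` drawn by the resampling are separate summation
    -- variables, so the sum over `c` can be taken out as `R`.
    row : ∀ b → 𝔼 p′ ⊤ (λ y → g (b ∷ y) * ∑ F (λ c → μ c * 𝔼 p′ S (f′ c) y)) x ≈
                𝔼 p′ S (g′ b) x * R
    row b = begin-equality
      𝔼 p′ ⊤ (λ y → g′ b y * ∑ F (λ c → μ c * 𝔼 p′ S (f′ c) y)) x
        ≈⟨ 𝔼-cong p′ ⊤ (λ y → Eq.trans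
             (Eq.sym (∑-*ˡ (g′ b y) (λ c → μ c * 𝔼 p′ S (f′ c) y) F))
             (∑-cong (λ c → *-swap (g′ b y) (μ c) (𝔼 p′ S (f′ c) y)) F)) x ⟩
      𝔼 p′ ⊤ (λ y → ∑ F (λ c → μ c * (g′ b y * 𝔼 p′ S (f′ c) y))) x
        ≈⟨ 𝔼-∑ p′ ⊤ (λ c y → μ c * (g′ b y * 𝔼 p′ S (f′ c) y)) F x ⟩
      ∑ F (λ c → 𝔼 p′ ⊤ (λ y → μ c * (g′ b y * 𝔼 p′ S (f′ c) y)) x)
        ≈⟨ ∑-cong (λ c → Eq.trans
             (𝔼-pull p′ ⊤ (λ _ _ _ → Eq.refl) (λ y → g′ b y * 𝔼 p′ S (f′ c) y) x)
             (*-congˡ (𝔼-regenerate p′ S (tail-local loc b) (f′ c) x))) F ⟩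
      ∑ F (λ c → μ c * (𝔼 p′ S (g′ b) x * 𝔼 p′ ⊤ (f′ c) x))
        ≈⟨ ∑-cong (λ c → *-swap (μ c) (𝔼 p′ S (g′ b) x) (𝔼 p′ ⊤ (f′ c) x)) F ⟩
      ∑ F (λ c → 𝔼 p′ S (g′ b) x * (μ c * 𝔼 p′ ⊤ (f′ c) x))
        ≈⟨ ∑-*ˡ (𝔼 p′ S (g′ b) x) (λ c → μ c * 𝔼 p′ ⊤ (f′ c) x) F ⟩
      𝔼 p′ S (g′ b) x * R ∎
  𝔼-regenerate p (outside ∷ S) {g} loc f (a ∷ x) = begin-equality
    ∑ F (λ b → μ b * 𝔼 p′ ⊤ (λ y → g′ b y * 𝔼 p′ S (f′ b) y) x)
      ≈⟨ ∑-cong (λ b → *-congˡ (Eq.trans (𝔼-regenerate p′ S (tail-local loc b) (f′ b) x)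
           (*-congʳ (𝔼-cong p′ S (head-local loc b a) x)))) F ⟩
    ∑ F (λ b → μ b * (𝔼 p′ S (g′ a) x * 𝔼 p′ ⊤ (f′ b) x))
      ≈⟨ ∑-cong (λ b → *-swap (μ b) (𝔼 p′ S (g′ a) x) (𝔼 p′ ⊤ (f′ b) x)) F ⟩
    ∑ F (λ b → 𝔼 p′ S (g′ a) x * (μ b * 𝔼 p′ ⊤ (f′ b) x))
      ≈⟨ ∑-*ˡ (𝔼 p′ S (g′ a) x) (λ b → μ b * 𝔼 p′ ⊤ (f′ b) x) F ⟩
    𝔼 p′ S (g′ a) x * ∑ F (λ b → μ b * 𝔼 p′ ⊤ (f′ b) x) ∎
    where
    p′ = p ∘ suc
    μ  = mass (p zero)
    f′ = λ c y → f (c ∷ y)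
    g′ = λ c y → g (c ∷ y)

  -- The link from the truncated integral over `S` to `Pr`, which is a supremum of sums over all
  -- variables. A coordinate outside `S` is filled in with its whole distribution, whose mass 1 is
  -- itself only a supremum; hence `hasSum-scale`.
  𝔼-≤-sup : ∀ (p : Fin n → PMF ℤ) S {g} → (∀ y → 0# ≤ g y) → Local S g → ∀ u →
            (∀ xs → Unique xs → ∑ xs (λ x → g x * jointMass p x) ≤ u) → ∀ x → 𝔼 p S g x ≤ u
  𝔼-≤-sup p [] {g} 0≤g loc u bound [] = begin
    g []            ≈⟨ *-identityʳ (g []) ⟨
    g [] * 1#       ≈⟨ +-identityʳ (g [] * 1#) ⟨
    g [] * 1# + 0#  ≤⟨ bound ([] ∷ []) ([] ∷ []) ⟩
    u               ∎
  𝔼-≤-sup p (inside ∷ S) {g} 0≤g loc u bound (a ∷ x) =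
    ∑-fibres Vec.head _ (λ y → g y * jointMass p y) fibre F F! u (λ cs cs! _ → bound cs cs!)
    where
    p′ = p ∘ suc

    fibre : ∀ b v →
            (∀ cs → Unique cs → All (λ c → Vec.head c ≡ b) cs →
              ∑ cs (λ y → g y * jointMass p y) ≤ v) →
            mass (p zero) b * 𝔼 p′ S (λ y → g (b ∷ y)) x ≤ v
    fibre b v below = begin
      c * 𝔼 p′ S (λ y → g (b ∷ y)) x   ≈⟨ 𝔼-pull p′ S (λ _ _ _ → Eq.refl) (λ y → g (b ∷ y)) x ⟨
      𝔼 p′ S (λ y → c * g (b ∷ y)) x
        ≤⟨ 𝔼-≤-sup p′ S (λ y → *-nonneg (nonneg (p zero) b) (0≤g (b ∷ y)))
             (λ y z eq → *-congˡ (tail-local loc b y z eq)) v rows x ⟩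
      v ∎
      where
      c = mass (p zero) b

      rows : ∀ ys → Unique ys → ∑ ys (λ y → c * g (b ∷ y) * jointMass p′ y) ≤ v
      rows ys ys! = begin
        ∑ ys (λ y → c * g (b ∷ y) * jointMass p′ y)
          ≈⟨ ∑-cong (λ y → Eq.trans (*-assoc c (g (b ∷ y)) (jointMass p′ y))
               (*-swap c (g (b ∷ y)) (jointMass p′ y))) ys ⟩
        ∑ ys (λ y → g (b ∷ y) * jointMass p (b ∷ y))
          ≡⟨ ∑-map (b ∷_) (λ y → g y * jointMass p y) ys ⟨
        ∑ (List.map (b ∷_) ys) (λ y → g y * jointMass p y)
          ≤⟨ below _ (Unique.map⁺ Vec.∷-injectiveʳ ys!) (All.map⁺ (All.universal (λ _ → refl) ys)) ⟩
        v ∎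
  𝔼-≤-sup p (outside ∷ S) {g} 0≤g loc u bound (a ∷ x) =
    𝔼-≤-sup (p ∘ suc) S (λ y → 0≤g (a ∷ y)) (tail-local loc a) u rows x
    where
    rows : ∀ ys → Unique ys → ∑ ys (λ y → g (a ∷ y) * jointMass (p ∘ suc) y) ≤ u
    rows ys ys! = hasSum-scale (hasSum-1 (p zero))
      (∑-nonneg (λ y → *-nonneg (0≤g (a ∷ y)) (jointMass-nonneg (p ∘ suc) y)) ys) u λ bs bs! → begin
        ∑ ys g′ * ∑ bs μ  ≈⟨ *-comm (∑ ys g′) (∑ bs μ) ⟩
        ∑ bs μ * ∑ ys g′  ≈⟨ ∑-*ʳ (∑ ys g′) μ bs ⟨
        ∑ bs (λ b → μ b * ∑ ys g′)
          ≈⟨ ∑-cong (λ b → Eq.trans (Eq.sym (∑-*ˡ (μ b) g′ ys)) (∑-cong (λ y → Eq.trans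
               (*-swap (μ b) (g (a ∷ y)) (jointMass (p ∘ suc) y))
               (*-congʳ (head-local loc a b y))) ys)) bs ⟩
        ∑ bs (λ b → ∑ ys (λ y → g (b ∷ y) * jointMass p (b ∷ y)))
          ≈⟨ ∑-cartesianProductWith _∷_ (λ y → g y * jointMass p y) bs ys ⟨
        ∑ (List.cartesianProductWith _∷_ bs ys) (λ y → g y * jointMass p y)
          ≤⟨ bound _ (Unique.cartesianProductWith⁺ _∷_ Vec.∷-injective bs! ys!) ⟩
        u ∎
      where
      μ  = mass (p zero)
      g′ = λ y → g (a ∷ y) * jointMass (p ∘ suc) y

  𝔼-++ : ∀ (p : Fin (n ℕ.+ m) → PMF ℤ) (S : Subset n) (T : Subset m) f x y →
         𝔼 p (S Vec.++ T) f (x Vec.++ y) ≈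
         𝔼 (λ i → p (i ↑ˡ m)) S (λ x₁ → 𝔼 (λ j → p (n ↑ʳ j)) T (λ y₁ → f (x₁ Vec.++ y₁)) y) x
  𝔼-++ p []            T f []      y = Eq.refl
  𝔼-++ p (inside ∷ S)  T f (a ∷ x) y =
    ∑-cong (λ b → *-congˡ (𝔼-++ (p ∘ suc) S T (λ z → f (b ∷ z)) x y)) F
  𝔼-++ p (outside ∷ S) T f (a ∷ x) y = 𝔼-++ (p ∘ suc) S T (λ z → f (a ∷ z)) x y

  𝔼-singleton : ∀ (p : Fin n → PMF ℤ) i (φ : ℤ → Carrier) x →
                𝔼 p ⁅ i ⁆ (λ y → φ (lookup y i)) x ≈ ∑ F (λ b → mass (p i) b * φ b)
  𝔼-singleton p zero    φ (a ∷ x) = ∑-cong (λ b → *-congˡ (Eq.reflexive (𝔼-⊥ (p ∘ suc) (λ _ → φ b) x))) F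
  𝔼-singleton p (suc i) φ (a ∷ x) = 𝔼-singleton (p ∘ suc) i φ x

  box : ∀ n → List (Vec ℤ n)
  box zero    = [ [] ]
  box (suc n) = List.cartesianProductWith _∷_ F (box n)

  ∈-box : (x : Vec ℤ n) → (∀ i → lookup x i ∈ˡ F) → x ∈ˡ box n
  ∈-box []      x∈ = here refl
  ∈-box (a ∷ x) x∈ = ∈-cartesianProductWith⁺ _∷_ (x∈ zero) (∈-box x (x∈ ∘ suc))

  ∑-box-product : ∀ (p : Fin n → PMF ℤ) f x → ∑ (box n) (λ y → jointMass p y * f y) ≈ 𝔼 p ⊤ f x
  ∑-box-product p f []      = Eq.trans (+-identityʳ _) (*-identityˡ (f []))
  ∑-box-product {suc n} p f (a ∷ x) = Eq.trans (∑-cartesianProductWith _∷_ _ F (box n))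
    (∑-cong (λ b → begin-equality
      ∑ (box n) (λ y → mass (p zero) b * jointMass (p ∘ suc) y * f (b ∷ y))
        ≈⟨ ∑-cong (λ y → *-assoc (mass (p zero) b) (jointMass (p ∘ suc) y) (f (b ∷ y))) (box n) ⟩
      ∑ (box n) (λ y → mass (p zero) b * (jointMass (p ∘ suc) y * f (b ∷ y)))
        ≈⟨ ∑-*ˡ (mass (p zero) b) (λ y → jointMass (p ∘ suc) y * f (b ∷ y)) (box n) ⟩
      mass (p zero) b * ∑ (box n) (λ y → jointMass (p ∘ suc) y * f (b ∷ y))
        ≈⟨ *-congˡ (∑-box-product (p ∘ suc) (λ y → f (b ∷ y)) x) ⟩
      mass (p zero) b * 𝔼 (p ∘ suc) ⊤ (λ y → f (b ∷ y)) x ∎) F)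

  -- Equality can fail because an unchanged coordinate may have a value outside `F`; then the box
  -- contains no successor state.
  ∑-box-transition : ∀ (p : Fin n → PMF ℤ) S {f} → (∀ y → 0# ≤ f y) → ∀ x →
                     ∑ (box n) (λ y → transition p S x y * f y) ≤ 𝔼 p S f x
  ∑-box-transition p [] {f} 0≤f [] =
    ≤-reflexive (Eq.trans (+-identityʳ _) (*-identityˡ (f [])))
  ∑-box-transition {suc n} p (s ∷ S) {f} 0≤f (a ∷ x) = begin
    ∑ (List.cartesianProductWith _∷_ F (box n)) (λ y → transition p (s ∷ S) (a ∷ x) y * f y)
      ≈⟨ ∑-cartesianProductWith _∷_ _ F (box n) ⟩
    ∑ F (λ b → ∑ (box n) (λ y → transition p (s ∷ S) (a ∷ x) (b ∷ y) * f (b ∷ y)))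
      ≤⟨ last-step s ⟩
    𝔼 p (s ∷ S) f (a ∷ x) ∎
    where
    p′ = p ∘ suc

    row : ∀ c → 0# ≤ c → ∀ b → ∑ (box n) (λ y → c * transition p′ S x y * f (b ∷ y)) ≤
                               c * 𝔼 p′ S (λ y → f (b ∷ y)) x
    row c 0≤c b = begin
      ∑ (box n) (λ y → c * transition p′ S x y * f (b ∷ y))
        ≈⟨ ∑-cong (λ y → *-assoc c (transition p′ S x y) (f (b ∷ y))) (box n) ⟩
      ∑ (box n) (λ y → c * (transition p′ S x y * f (b ∷ y)))
        ≈⟨ ∑-*ˡ c (λ y → transition p′ S x y * f (b ∷ y)) (box n) ⟩
      c * ∑ (box n) (λ y → transition p′ S x y * f (b ∷ y))
        ≤⟨ *-monoˡ-≤ 0≤c (∑-box-transition p′ S (λ y → 0≤f (b ∷ y)) x) ⟩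
      c * 𝔼 p′ S (λ y → f (b ∷ y)) x ∎

    last-step : ∀ s → ∑ F (λ b → ∑ (box n) (λ y → transition p (s ∷ S) (a ∷ x) (b ∷ y) * f (b ∷ y))) ≤
                      𝔼 p (s ∷ S) f (a ∷ x)
    last-step inside  = ∑-mono (λ b → row (mass (p zero) b) (nonneg (p zero) b) b) F
    last-step outside = ≤-trans
      (∑-mono (λ b → row (𝟙 (does (a ℤ.≟ b))) (𝟙-nonneg (does (a ℤ.≟ b))) b) F)
      (∑-delta (λ b → 𝔼-nonneg p′ S (λ y → 0≤f (b ∷ y)) x) ℤ._≟_ a F F!)

-- Potentials and upper bounds for sums over execution histories.

module Runs (ℝ : CompleteOrderedField) {n m : ℕ} (p : Fin n → Probability.PMF ℝ ℤ)
            (ℬ : Fin m → Probability.Event ℝ n) (rule : Probability.Rule ℝ ℬ) where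

  open CompleteOrderedField ℝ
  open Probability ℝ
  open Sums ℝ
  open PosetReasoning (TotalOrder.poset totalOrder) hiding (start)
  open CommutativeSemigroupProperties *-commutativeSemigroup
    using () renaming (x∙yz≈y∙xz to *-swap)
  open MoserTardos p ℬ rule
  open Rule rule using (choose)

  ℋ : Set
  ℋ = History n m

  length : ℋ → ℕ
  length (start _)        = 0
  length (resample h _ _) = suc (length h)

  values : ℋ → List ℤ
  values (start x)        = Vec.toList x
  values (resample h _ x) = Vec.toList x ++ values h

  weight-nonneg : ∀ h → 0# ≤ weight h
  weight-nonneg (start x)        = jointMass-nonneg p x
  weight-nonneg (resample h B y) = *-nonneg (*-nonneg (weight-nonneg h) (Rule.nonneg rule h B))
                                            (transition-nonneg p (vars (ℬ B)) (current h) y)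

  runMass-nonneg : ∀ h → 0# ≤ runMass h
  runMass-nonneg h = *-nonneg (𝟙-nonneg (halted h)) (weight-nonneg h)

  halted⇒false : ∀ h → halted h ≡ true → ∀ B → holds (ℬ B) (current h) ≡ false
  halted⇒false h = does-true (Fin.all? (λ B → holds (ℬ B) (current h) Bool.≟ false))

  ¬halted⇒true : ∀ h → halted h ≡ false → ∃[ B ] holds (ℬ B) (current h) ≡ true
  ¬halted⇒true h eq with Fin.any? (λ B → holds (ℬ B) (current h) Bool.≟ true)
  ... | yes some-true = some-true
  ... | no ¬some-true with () ← ≡.trans (≡.sym eq) (dec-true
    (Fin.all? (λ B → holds (ℬ B) (current h) Bool.≟ false))
    (λ B → Bool.¬-not (λ B-true → ¬some-true (B , B-true))))

  alive : ℋ → Bool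
  alive h = not (halted h)

  halted+alive : ∀ h → 𝟙 (halted h) + 𝟙 (alive h) ≈ 1#
  halted+alive h with halted h
  ... | true  = +-identityʳ 1#
  ... | false = +-identityˡ 1#

  ∑-choose : ∀ h → ∑ (allFin m) (choose h) ≈ 𝟙 (alive h)
  ∑-choose h with halted h in eq
  ... | true  = ∑-0 (λ B → Rule.true-only rule h B (halted⇒false h eq B)) (allFin m)
  ... | false with ¬halted⇒true h eq
  ... | B , B-true = Eq.trans (Eq.sym (sumᶠ≈∑ (choose h))) (Rule.total rule h B B-true)

  -- Makes the truth of the selected event part of the formula; later this indicator becomes the
  -- factor `true′ B` of the operator `R`.
  choose-true : ∀ h B → choose h B ≈ choose h B * 𝟙 (holds (ℬ B) (current h))
  choose-true h B with holds (ℬ B) (current h) in eq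
  ... | true  = Eq.sym (*-identityʳ (choose h B))
  ... | false = Eq.trans (Rule.true-only rule h B eq) (Eq.sym (zeroʳ (choose h B)))

  module Truncation (F : List ℤ) (F! : Unique F) where

    open Average ℝ F F!

    levels : ℕ → List ℋ
    levels zero    = List.map start (box n)
    levels (suc t) =
      concatMap (λ h → concatMap (λ B → List.map (resample h B) (box n)) (allFin m)) (levels t)

    levelsBelow : ℕ → List ℋ
    levelsBelow zero    = []
    levelsBelow (suc t) = levels t ++ levelsBelow t

    -- The one-step operator of the execution, restricted to the box. It gives 0 at a halted
    -- history, because `choose` vanishes there.
    𝒫 : (ℋ → Carrier) → ℋ → Carrier
    𝒫 φ h = ∑ (allFin m) λ B → choose h B *
              ∑ (box n) λ y → resampleMass B (current h) y * φ (resample h B y)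

    -- The potential Φ d bounds the expected total reward ρ over the next d steps; its
    -- expectation over the initial state is at most u.
    HasPotential : (ℋ → Carrier) → Carrier → Set
    HasPotential ρ u = Σ[ Φ ∈ (ℕ → ℋ → Carrier) ]
      ( (∀ d h → 0# ≤ Φ d h)
      × (∀ d h → ρ h + 𝒫 (Φ d) h ≤ Φ (suc d) h)
      × (∀ d → ∑ (box n) (λ x → jointMass p x * Φ d (start x)) ≤ u) )

    ∑-levels-suc : ∀ φ t → ∑ (levels (suc t)) (λ h → weight h * φ h) ≈
                           ∑ (levels t) (λ h → weight h * 𝒫 φ h)
    ∑-levels-suc φ t = Eq.trans (∑-concatMap _ _ (levels t)) (∑-cong per-history (levels t))
      where
      g : ℋ → Carrier
      g h = weight h * φ h

      per-event : ∀ h B → ∑ (List.map (resample h B) (box n)) g ≈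
        weight h * (choose h B * ∑ (box n) λ y → resampleMass B (current h) y * φ (resample h B y))
      per-event h B = begin-equality
        ∑ (List.map (resample h B) (box n)) g
          ≡⟨ ∑-map (resample h B) g (box n) ⟩
        ∑ (box n) (λ y → weight h * choose h B * resampleMass B (current h) y * φ (resample h B y))
          ≈⟨ ∑-cong (λ y → *-assoc (weight h * choose h B) (resampleMass B (current h) y)
                                   (φ (resample h B y))) (box n) ⟩
        ∑ (box n) (λ y → weight h * choose h B * (resampleMass B (current h) y * φ (resample h B y)))
          ≈⟨ ∑-*ˡ (weight h * choose h B) _ (box n) ⟩
        weight h * choose h B * ∑ (box n) (λ y → resampleMass B (current h) y * φ (resample h B y))
          ≈⟨ *-assoc (weight h) (choose h B) _ ⟩
        weight h * (choose h B * ∑ (box n) (λ y → resampleMass B (current h) y * φ (resample h B y))) ∎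

      per-history : ∀ h →
        ∑ (concatMap (λ B → List.map (resample h B) (box n)) (allFin m)) g ≈ weight h * 𝒫 φ h
      per-history h = Eq.trans (∑-concatMap (λ B → List.map (resample h B) (box n)) g (allFin m))
        (Eq.trans (∑-cong (per-event h) (allFin m)) (∑-*ˡ (weight h) _ (allFin m)))

    -- Telescoping: on each level the potential with horizon `suc d` pays for the reward and for the
    -- potential with horizon `d` one level further. The initial horizon grows with `t`, which is
    -- harmless because the initial bound in `HasPotential` is uniform in it.
    supermartingale : (Φ : ℕ → ℋ → Carrier) (ρ : ℋ → Carrier) →
                      (∀ d h → ρ h + 𝒫 (Φ d) h ≤ Φ (suc d) h) → ∀ t d →
                      ∑ (levelsBelow t) (λ h → weight h * ρ h) + ∑ (levels t) (λ h → weight h * Φ d h) ≤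
                      ∑ (levels 0) (λ h → weight h * Φ (t ℕ.+ d) h)
    supermartingale Φ ρ step zero    d = ≤-reflexive (+-identityˡ _)
    supermartingale Φ ρ step (suc t) d = begin
      ∑ (levels t ++ levelsBelow t) (λ h → weight h * ρ h) + ∑ (levels (suc t)) (λ h → weight h * Φ d h)
        ≈⟨ +-cong (Eq.trans (∑-++ _ (levels t) (levelsBelow t)) (+-comm _ _)) (∑-levels-suc (Φ d) t) ⟩
      old + ∑ (levels t) (λ h → weight h * ρ h) + ∑ (levels t) (λ h → weight h * 𝒫 (Φ d) h)
        ≈⟨ +-assoc old _ _ ⟩
      old + (∑ (levels t) (λ h → weight h * ρ h) + ∑ (levels t) (λ h → weight h * 𝒫 (Φ d) h))
        ≈⟨ +-congˡ (Eq.trans (Eq.sym (∑-+ _ _ (levels t)))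
                             (∑-cong (λ h → Eq.sym (distribˡ (weight h) (ρ h) (𝒫 (Φ d) h))) (levels t))) ⟩
      old + ∑ (levels t) (λ h → weight h * (ρ h + 𝒫 (Φ d) h))
        ≤⟨ +-monoʳ-≤ old (∑-mono (λ h → *-monoˡ-≤ (weight-nonneg h) (step d h)) (levels t)) ⟩
      old + ∑ (levels t) (λ h → weight h * Φ (suc d) h)
        ≤⟨ supermartingale Φ ρ step t (suc d) ⟩
      ∑ (levels 0) (λ h → weight h * Φ (t ℕ.+ suc d) h)
        ≡⟨ ≡.cong (λ e → ∑ (levels 0) (λ h → weight h * Φ e h)) (ℕ.+-suc t d) ⟩
      ∑ (levels 0) (λ h → weight h * Φ (suc t ℕ.+ d) h) ∎
      where
      old = ∑ (levelsBelow t) (λ h → weight h * ρ h)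

    𝒫-current : ∀ {f} → (∀ x → 0# ≤ f x) → ∀ h →
                𝒫 (f ∘ current) h ≤ ∑ (allFin m) (λ B → choose h B * 𝔼 p (vars (ℬ B)) f (current h))
    𝒫-current 0≤f h = ∑-mono (λ B → *-monoˡ-≤ (Rule.nonneg rule h B)
      (∑-box-transition p (vars (ℬ B)) 0≤f (current h))) (allFin m)

    𝒫-+ : ∀ φ ψ h → 𝒫 (λ h → φ h + ψ h) h ≈ 𝒫 φ h + 𝒫 ψ h
    𝒫-+ φ ψ h = Eq.trans (∑-cong (λ B → Eq.trans (*-congˡ (Eq.trans
        (∑-cong (λ y → distribˡ (resampleMass B (current h) y) (φ (resample h B y))
                                (ψ (resample h B y))) (box n))
        (∑-+ _ _ (box n))))
      (distribˡ (choose h B) _ _)) (allFin m)) (∑-+ _ _ (allFin m))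

    𝒫-∑ : ∀ {A : Set} (φ : A → ℋ → Carrier) ks h →
          𝒫 (λ h → ∑ ks (λ k → φ k h)) h ≈ ∑ ks (λ k → 𝒫 (φ k) h)
    𝒫-∑ φ []       h = ∑-0 (λ B → Eq.trans (*-congˡ (∑-0 (λ y → zeroʳ _) (box n)))
                                           (zeroʳ (choose h B))) (allFin m)
    𝒫-∑ φ (k ∷ ks) h =
      Eq.trans (𝒫-+ (φ k) (λ h → ∑ ks (λ k → φ k h)) h) (+-congˡ (𝒫-∑ φ ks h))

    𝔼-1≤1 : ∀ S x → 𝔼 p S (λ _ → 1#) x ≤ 1#
    𝔼-1≤1 S x = 𝔼-insensitive-≤ p S (λ _ → 0≤1) (λ _ _ _ → Eq.refl) x

    ∑-box-transition-≤1 : ∀ S x → ∑ (box n) (transition p S x) ≤ 1#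
    ∑-box-transition-≤1 S x = begin
      ∑ (box n) (transition p S x)                  ≈⟨ ∑-cong (λ y → *-identityʳ _) (box n) ⟨
      ∑ (box n) (λ y → transition p S x y * 1#)     ≤⟨ ∑-box-transition p S (λ _ → 0≤1) x ⟩
      𝔼 p S (λ _ → 1#) x                            ≤⟨ 𝔼-1≤1 S x ⟩
      1#                                            ∎

    ∈-levels : ∀ h → (∀ a → a ∈ˡ values h → a ∈ˡ F) → h ∈ˡ levels (length h)
    ∈-levels (start x)        sub =
      ∈-map⁺ start (∈-box x λ i → sub _ (∈-toList⁺ (∈-lookup i x)))
    ∈-levels (resample h B y) sub = ∈-concatMap⁺ _ (Any.map (λ { refl →
        ∈-concatMap⁺ _ (Any.map (λ { refl → ∈-map⁺ (resample h B) (∈-box y λ i →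
          sub _ (∈-++⁺ˡ (∈-toList⁺ (∈-lookup i y)))) }) (∈-allFin B)) })
      (∈-levels h λ a a∈ → sub a (∈-++⁺ʳ (Vec.toList y) a∈)))

    ∈-levelsBelow : ∀ {h s t} → s ℕ.< t → h ∈ˡ levels s → h ∈ˡ levelsBelow t
    ∈-levelsBelow {s = s} {suc t} s<1+t h∈ with s ℕ.≟ t
    ... | yes refl = ∈-++⁺ˡ h∈
    ... | no s≢t   = ∈-++⁺ʳ (levels t) (∈-levelsBelow (ℕ.≤∧≢⇒< (ℕ.s≤s⁻¹ s<1+t) s≢t) h∈)

  -- Finitely many histories involve finitely many values and have bounded length. With `F`
  -- consisting of these values they all appear in some `levelsBelow t`.
  ∑-histories-≤ :
    (ρ : ℋ → Carrier) → (∀ h → 0# ≤ ρ h) → ∀ u →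
    (∀ F (F! : Unique F) → Truncation.HasPotential F F! ρ u) →
    ∀ hs → Unique hs → ∑ hs (λ h → weight h * ρ h) ≤ u
  ∑-histories-≤ ρ 0≤ρ u potential hs hs! with potential F F!
    where
    F  = List.deduplicate ℤ._≟_ (concatMap values hs)
    F! = deduplicate-! ℤ._≟_ (concatMap values hs)
  ... | Φ , 0≤Φ , step , init = begin
    ∑ hs (λ h → weight h * ρ h)
      ≤⟨ ∑-⊆ (λ h → *-nonneg (weight-nonneg h) (0≤ρ h)) hs (levelsBelow t) hs!
           (λ h h∈ → inj₁ (∈-levelsBelow (length<t h∈) (∈-levels h λ a a∈ →
             ∈-deduplicate⁺ ℤ._≟_ (∈-concatMap⁺ values (Any.map (λ { refl → a∈ }) h∈))))) ⟩
    ∑ (levelsBelow t) (λ h → weight h * ρ h)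
      ≤⟨ x≤x+y (∑-nonneg (λ h → *-nonneg (weight-nonneg h) (0≤Φ 0 h)) (levels t)) ⟩
    ∑ (levelsBelow t) (λ h → weight h * ρ h) + ∑ (levels t) (λ h → weight h * Φ 0 h)
      ≤⟨ supermartingale Φ ρ step t 0 ⟩
    ∑ (levels 0) (λ h → weight h * Φ (t ℕ.+ 0) h)
      ≡⟨ ∑-map start _ (box n) ⟩
    ∑ (box n) (λ x → jointMass p x * Φ (t ℕ.+ 0) (start x))
      ≤⟨ init (t ℕ.+ 0) ⟩
    u ∎
    where
    open Truncation (List.deduplicate ℤ._≟_ (concatMap values hs))
                    (deduplicate-! ℤ._≟_ (concatMap values hs))
    open Average ℝ (List.deduplicate ℤ._≟_ (concatMap values hs))
                   (deduplicate-! ℤ._≟_ (concatMap values hs))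

    -- The sum of the lengths bounds each of them; `suc` makes the bound strict, as `levelsBelow`
    -- requires.
    t = suc (sum (List.map length hs))

    length<t : ∀ {h} → h ∈ˡ hs → length h ℕ.< t
    length<t h∈ = ℕ.s≤s (go h∈)
      where
      go : ∀ {h hs} → h ∈ˡ hs → length h ℕ.≤ sum (List.map length hs)
      go (here refl) = ℕ.m≤m+n _ _
      go {hs = h′ ∷ _} (there h∈) = ℕ.≤-trans (go h∈) (ℕ.m≤n+m _ (length h′))

  -- The constant potential 1 suffices: a halted history collects the reward and has no successors,
  -- any other collects nothing.
  ∑-runMass≤1 : ∀ hs → Unique hs → ∑ hs runMass ≤ 1#
  ∑-runMass≤1 hs hs! = ≤-respˡ-≈ (∑-cong (λ h → *-comm (weight h) (𝟙 (halted h))) hs)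
    (∑-histories-≤ (𝟙 ∘ halted) (𝟙-nonneg ∘ halted) 1# potential hs hs!)
    where
    potential : ∀ F (F! : Unique F) → Truncation.HasPotential F F! (𝟙 ∘ halted) 1#
    potential F F! = (λ _ _ → 1#) , (λ _ _ → 0≤1) , (λ d h → begin
        𝟙 (halted h) + 𝒫 (λ _ → 1#) h
          ≤⟨ +-monoʳ-≤ _ (𝒫-current (λ _ → 0≤1) h) ⟩
        𝟙 (halted h) + ∑ (allFin m) (λ B → choose h B * 𝔼 p (vars (ℬ B)) (λ _ → 1#) (current h))
          ≤⟨ +-monoʳ-≤ _ (∑-mono (λ B → ≤-respʳ-≈ (*-identityʳ (choose h B))
               (*-monoˡ-≤ (Rule.nonneg rule h B) (𝔼-1≤1 (vars (ℬ B)) (current h)))) (allFin m)) ⟩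
        𝟙 (halted h) + ∑ (allFin m) (choose h)
          ≈⟨ +-congˡ (∑-choose h) ⟩
        𝟙 (halted h) + 𝟙 (alive h)
          ≈⟨ halted+alive h ⟩
        1# ∎) ,
      (λ d → ≤-trans (≤-reflexive (∑-box-product p (λ _ → 1#) (Vec.replicate n (+ 0))))
                     (𝔼-1≤1 ⊤ (Vec.replicate n (+ 0))))
      where
      open Truncation F F!
      open Average ℝ F F!

-- Termination with probability 1 and the output distribution.

module Termination (ℝ : CompleteOrderedField) {n m : ℕ} (p : Fin n → Probability.PMF ℝ ℤ)
                   (ℬ : Fin m → Probability.Event ℝ n) (rule : Probability.Rule ℝ ℬ) where

  open CompleteOrderedField ℝ
  open Probability ℝ
  open Sums ℝ
  open PosetReasoning (TotalOrder.poset totalOrder) hiding (start)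
  open MoserTardos p ℬ rule
  open Rule rule using (choose)
  open Runs ℝ p ℬ rule

  aliveMass : ℋ → Carrier
  aliveMass h = weight h * 𝟙 (alive h)

  weight≈run+alive : ∀ h → weight h ≈ runMass h + aliveMass h
  weight≈run+alive h = begin-equality
    weight h                                              ≈⟨ *-identityʳ (weight h) ⟨
    weight h * 1#                                         ≈⟨ *-congˡ (halted+alive h) ⟨
    weight h * (𝟙 (halted h) + 𝟙 (alive h))               ≈⟨ distribˡ (weight h) _ _ ⟩
    weight h * 𝟙 (halted h) + aliveMass h                 ≈⟨ +-congʳ (*-comm (weight h) _) ⟩
    runMass h + aliveMass h                               ∎

  aliveMass-nonneg : ∀ h → 0# ≤ aliveMass h
  aliveMass-nonneg h = *-nonneg (weight-nonneg h) (𝟙-nonneg (alive h))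

  -- The probability that the execution, cut off after t resamplings, is h.
  cutMass : ℕ → ℋ → Carrier
  cutMass t h with ℕ.<-cmp (length h) t
  ... | tri< _ _ _ = runMass h
  ... | tri≈ _ _ _ = weight h
  ... | tri> _ _ _ = 0#

  cutMass-< : ∀ {t} h → length h ℕ.< t → cutMass t h ≡ runMass h
  cutMass-< {t} h lt with ℕ.<-cmp (length h) t
  ... | tri< _ _ _  = refl
  ... | tri≈ ¬lt _ _ = ⊥-elim (¬lt lt)
  ... | tri> ¬lt _ _ = ⊥-elim (¬lt lt)

  cutMass-≡ : ∀ {t} h → length h ≡ t → cutMass t h ≡ weight h
  cutMass-≡ {t} h eq with ℕ.<-cmp (length h) t
  ... | tri< _ ≢ _ = ⊥-elim (≢ eq)
  ... | tri≈ _ _ _ = refl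
  ... | tri> _ ≢ _ = ⊥-elim (≢ eq)

  cutMass-≤ : ∀ t h → cutMass t h ≤ runMass h + 𝟙 (does (length h ℕ.≟ t)) * aliveMass h
  cutMass-≤ t h with ℕ.<-cmp (length h) t
  ... | tri< _ _ _ = x≤x+y (*-nonneg (𝟙-nonneg (does (length h ℕ.≟ t))) (aliveMass-nonneg h))
  ... | tri> _ _ _ = +-nonneg (runMass-nonneg h)
                              (*-nonneg (𝟙-nonneg (does (length h ℕ.≟ t))) (aliveMass-nonneg h))
  ... | tri≈ _ eq _ rewrite dec-true (length h ℕ.≟ t) eq =
    ≤-reflexive (Eq.trans (weight≈run+alive h) (+-congˡ (Eq.sym (*-identityˡ (aliveMass h)))))

  -- The map along which `cutMass (suc t)` refines `cutMass t`: a history of length `suc t` loses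
  -- its last resampling, all others are kept.
  cut : ℕ → ℋ → ℋ
  cut t (start x)        = start x
  cut t (resample h B y) = if does (length h ℕ.≟ t) then h else resample h B y

  cut-short : ∀ {t} h → length h ≢ suc t → cut t h ≡ h
  cut-short (start x)        _  = refl
  cut-short {t} (resample h B y) ≢t rewrite dec-false (length h ℕ.≟ t) (≢t ∘ ≡.cong suc) = refl

  cut-child : ∀ {t} h B y → length h ≡ t → cut t (resample h B y) ≡ h
  cut-child {t} h B y eq rewrite dec-true (length h ℕ.≟ t) eq = refl

  -- No weight is lost in a step: some event is true, so `choose` adds up to 1, and each resampling
  -- kernel has mass 1. The second fact is a supremum over infinitely many states, hence the form of
  -- the statement.
  weight-children : ∀ h → halted h ≡ false → ∀ u →
    (∀ cs → Unique cs → ∑ cs (λ (B , y) → weight (resample h B y)) ≤ u) → weight h ≤ u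
  weight-children h eq u bound = begin
    weight h                              ≈⟨ *-identityʳ (weight h) ⟨
    weight h * 1#                         ≈⟨ *-congˡ total-1 ⟨
    weight h * ∑ (allFin m) (choose h)    ≈⟨ ∑-*ˡ (weight h) (choose h) (allFin m) ⟨
    ∑ (allFin m) (λ B → weight h * choose h B)
      ≤⟨ ∑-fibres proj₁ _ (λ (B , y) → weight (resample h B y)) fibre (allFin m) (Unique.allFin⁺ m) u
           (λ cs cs! _ → bound cs cs!) ⟩
    u ∎
    where
    total-1 : ∑ (allFin m) (choose h) ≈ 1#
    total-1 = Eq.trans (∑-choose h) (Eq.reflexive (≡.cong (𝟙 ∘ not) eq))

    fibre : ∀ B v →
            (∀ cs → Unique cs → All (λ c → proj₁ c ≡ B) cs →
              ∑ cs (λ (B , y) → weight (resample h B y)) ≤ v) →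
            weight h * choose h B ≤ v
    fibre B v below = hasSum-scale (transition-hasSum p (vars (ℬ B)) (current h))
      (*-nonneg (weight-nonneg h) (Rule.nonneg rule h B)) v λ ys ys! → begin
        weight h * choose h B * ∑ ys (resampleMass B (current h))
          ≈⟨ ∑-*ˡ (weight h * choose h B) (resampleMass B (current h)) ys ⟨
        ∑ ys (λ y → weight (resample h B y))
          ≡⟨ ∑-map (B ,_) (λ (B , y) → weight (resample h B y)) ys ⟨
        ∑ (List.map (B ,_) ys) (λ (B , y) → weight (resample h B y))
          ≤⟨ below _ (Unique.map⁺ (proj₂ ∘ ,-injective) ys!)
                     (All.map⁺ (All.universal (λ _ → refl) ys)) ⟩
        v ∎

  -- A history that has halted by time `t` is in its own fibre and keeps its mass; a live one of
  -- length `t` passes its weight on to its children.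
  cutMass-fibre : ∀ t h u →
    (∀ cs → Unique cs → All (λ c → cut t c ≡ h) cs → ∑ cs (cutMass (suc t)) ≤ u) → cutMass t h ≤ u
  cutMass-fibre t h u bound with ℕ.<-cmp (length h) t
  ... | tri> _ _ _ = bound [] [] []
  ... | tri< lt _ _ = begin
    runMass h               ≡⟨ cutMass-< h (ℕ.m<n⇒m<1+n lt) ⟨
    cutMass (suc t) h       ≈⟨ +-identityʳ _ ⟨
    cutMass (suc t) h + 0#  ≤⟨ bound (h ∷ []) ([] ∷ []) (cut-short h (ℕ.<⇒≢ (ℕ.m<n⇒m<1+n lt)) ∷ []) ⟩
    u                       ∎
  ... | tri≈ _ refl _ with halted h in eq
  ... | true = begin
    weight h                ≈⟨ *-identityˡ (weight h) ⟨
    1# * weight h           ≡⟨ ≡.cong (λ b → 𝟙 b * weight h) eq ⟨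
    runMass h               ≡⟨ cutMass-< h (ℕ.n<1+n (length h)) ⟨
    cutMass (suc t) h       ≈⟨ +-identityʳ _ ⟨
    cutMass (suc t) h + 0#  ≤⟨ bound (h ∷ []) ([] ∷ []) (cut-short h (ℕ.<⇒≢ (ℕ.n<1+n _)) ∷ []) ⟩
    u                       ∎
  ... | false = weight-children h eq u λ cs cs! → begin
    ∑ cs (λ (B , y) → weight (resample h B y))
      ≈⟨ ∑-cong (λ (B , y) → Eq.reflexive (cutMass-≡ (resample h B y) refl)) cs ⟨
    ∑ cs (cutMass (suc t) ∘ child)
      ≡⟨ ∑-map child (cutMass (suc t)) cs ⟨
    ∑ (List.map child cs) (cutMass (suc t))
      ≤⟨ bound _ (Unique.map⁺ (λ { {_ , _} {_ , _} refl → refl }) cs!)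
                 (All.map⁺ (All.universal (λ (B , y) → cut-child h B y refl) cs)) ⟩
    u ∎
    where
    child : Fin m × Vec ℤ n → ℋ
    child (B , y) = resample h B y

  -- An execution that is cut off always stops, so the whole mass of the initial states is still
  -- present after any fixed number of resamplings.
  cutMass-sup : ∀ t u → (∀ hs → Unique hs → ∑ hs (cutMass t) ≤ u) → 1# ≤ u
  cutMass-sup zero u bound = hasSum-least (jointMass-hasSum p) u λ xs xs! → begin
    ∑ xs (jointMass p)
      ≈⟨ ∑-cong (λ x → Eq.reflexive (cutMass-≡ (start x) refl)) xs ⟨
    ∑ xs (cutMass 0 ∘ start)
      ≡⟨ ∑-map start (cutMass 0) xs ⟨
    ∑ (List.map start xs) (cutMass 0)
      ≤⟨ bound _ (Unique.map⁺ (λ { refl → refl }) xs!) ⟩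
    u ∎
  cutMass-sup (suc t) u bound = cutMass-sup t u λ hs hs! →
    ∑-fibres (cut t) (cutMass t) (cutMass (suc t)) (cutMass-fibre t) hs hs! u
      (λ cs cs! _ → bound cs cs!)

  ·≈∑ : ∀ a k → k · a ≈ ∑ (upTo k) (λ _ → a)
  ·≈∑ a k = go id k
    where
    go : ∀ (f : ℕ → ℕ) k → k · a ≈ ∑ (List.applyUpTo f k) (λ _ → a)
    go f zero    = Eq.refl
    go f (suc k) = +-congˡ (go (f ∘ suc) k)

  -- Otherwise every level of the tree of executions carries at least the missing
  -- probability, so that the expected number of resamplings is infinite.
  terminates : ∀ C → (∀ hs → Unique hs → ∑ hs aliveMass ≤ C) →
               ∀ u → (∀ hs → Unique hs → ∑ hs runMass ≤ u) → 1# ≤ u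
  terminates C alive≤C u run≤u = begin
    1#              ≈⟨ +-identityˡ 1# ⟨
    0# + 1#         ≈⟨ +-congʳ (-‿inverseʳ u) ⟨
    u + - u + 1#    ≈⟨ +-assoc u (- u) 1# ⟩
    u + (- u + 1#)  ≈⟨ +-congˡ (+-comm (- u) 1#) ⟩
    u + a           ≤⟨ +-monoʳ-≤ u (archimedean multiples) ⟩
    u + 0#          ≈⟨ +-identityʳ u ⟩
    u               ∎
    where
    a = 1# + - u

    -- The cut execution has mass 1. The part that has halted is at most `u`, so at least `a` is
    -- alive after exactly `t` resamplings.
    alive-at : ∀ t v → (∀ hs → Unique hs → All (λ h → length h ≡ t) hs → ∑ hs aliveMass ≤ v) → a ≤ v
    alive-at t v below = x≤y+z⇒x-y≤z (cutMass-sup t (u + v) λ hs hs! → begin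
      ∑ hs (cutMass t)
        ≤⟨ ∑-mono (cutMass-≤ t) hs ⟩
      ∑ hs (λ h → runMass h + 𝟙 (does (length h ℕ.≟ t)) * aliveMass h)
        ≈⟨ ∑-+ runMass _ hs ⟩
      ∑ hs runMass + ∑ hs (λ h → 𝟙 (does (length h ℕ.≟ t)) * aliveMass h)
        ≈⟨ +-congˡ (∑-filter aliveMass (λ h → length h ℕ.≟ t) hs) ⟩
      ∑ hs runMass + ∑ (List.filter (λ h → length h ℕ.≟ t) hs) aliveMass
        ≤⟨ +-mono-≤ (run≤u hs hs!) (below _ (Unique.filter⁺ (λ h → length h ℕ.≟ t) hs!)
             (All.all-filter (λ h → length h ℕ.≟ t) hs)) ⟩
      u + v ∎)

    -- Distinct levels are disjoint fibres of `length`, so `k` copies of `a` fit below `C`.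
    multiples : ∀ k → k · a ≤ C
    multiples k = ≤-respˡ-≈ (Eq.sym (·≈∑ a k))
      (∑-fibres length (λ _ → a) aliveMass alive-at (upTo k) (Unique.upTo⁺ k) C
        (λ hs hs! _ → alive≤C hs hs!))

  -- The distribution of a function of the final state.

  module _ {k : ℕ} (out : Vec ℤ n → Vec ℤ k)
           (total-mass : ∀ u → (∀ hs → Unique hs → ∑ hs runMass ≤ u) → 1# ≤ u) where

    private
      _≟ⱽ_ : DecidableEquality (Vec ℤ k)
      _≟ⱽ_ = Vec.≡-dec ℤ._≟_

      output : ℋ → Vec ℤ k
      output h = out (current h)

      fibreMass : Vec ℤ k → ℋ → Carrier
      fibreMass x h = 𝟙 (does (output h ≟ⱽ x)) * runMass h

      fibreMass-nonneg : ∀ x h → 0# ≤ fibreMass x h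
      fibreMass-nonneg x h = *-nonneg (𝟙-nonneg (does (output h ≟ⱽ x))) (runMass-nonneg h)

      fibreMass-sum : ∀ x → ∃ (HasSum (fibreMass x))
      fibreMass-sum x = summable (fibreMass x) 1# λ hs hs! → ≤-trans
        (∑-mono (λ h → *-≤ˡ (runMass-nonneg h) (𝟙≤1 (does (output h ≟ⱽ x)))) hs)
        (∑-runMass≤1 hs hs!)

      outputMass : Vec ℤ k → Carrier
      outputMass x = proj₁ (fibreMass-sum x)

      outputMass-fibre : ∀ x u →
        (∀ hs → Unique hs → All (λ h → output h ≡ x) hs → ∑ hs runMass ≤ u) → outputMass x ≤ u
      outputMass-fibre x u bound = hasSum-least (proj₂ (fibreMass-sum x)) u λ hs hs! →
        ≤-respˡ-≈ (Eq.sym (∑-filter runMass (λ h → output h ≟ⱽ x) hs))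
          (bound _ (Unique.filter⁺ (λ h → output h ≟ⱽ x) hs!) (All.all-filter _ hs))

      outputs : List ℋ → List (Vec ℤ k)
      outputs hs = List.deduplicate _≟ⱽ_ (List.map output hs)

      split : ∀ hs h → h ∈ˡ hs → runMass h ≤ ∑ (outputs hs) (λ x → fibreMass x h)
      split hs h h∈ = begin
        runMass h            ≈⟨ *-identityˡ (runMass h) ⟨
        1# * runMass h
          ≡⟨ ≡.cong (λ b → 𝟙 b * runMass h) (dec-true (output h ≟ⱽ output h) refl) ⟨
        fibreMass (output h) h
          ≤⟨ ∑-member {f = λ x → fibreMass x h} (λ x → fibreMass-nonneg x h)
               (∈-deduplicate⁺ _≟ⱽ_ (∈-map⁺ output h∈)) ⟩
        ∑ (outputs hs) (λ x → fibreMass x h) ∎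

    -- Each mass is a supremum over a fibre of `output`, so that the total is at most 1 is an
    -- instance of `∑-fibres`. That it is at least 1 is where almost sure termination enters.
    outputPMF : PMF (Vec ℤ k)
    outputPMF = record
      { mass     = outputMass
      ; nonneg   = λ x → hasSum-upper (proj₂ (fibreMass-sum x)) [] []
      ; hasSum-1 = hasSum
          (λ xs xs! → ∑-fibres output outputMass runMass outputMass-fibre xs xs! 1#
            (λ hs hs! _ → ∑-runMass≤1 hs hs!))
          (λ u bound → total-mass u λ hs hs! → begin
            ∑ hs runMass
              ≤⟨ ∑-mono-∈ hs (split hs) ⟩
            ∑ hs (λ h → ∑ (outputs hs) (λ x → fibreMass x h))
              ≈⟨ ∑-swap (λ h x → fibreMass x h) hs (outputs hs) ⟩
            ∑ (outputs hs) (λ x → ∑ hs (fibreMass x))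
              ≤⟨ ∑-mono (λ x → hasSum-upper (proj₂ (fibreMass-sum x)) hs hs!) (outputs hs) ⟩
            ∑ (outputs hs) outputMass
              ≤⟨ bound (outputs hs) (deduplicate-! _≟ⱽ_ (List.map output hs)) ⟩
            u ∎)
      }

    hasOutput : HasOutput out outputPMF
    hasOutput x = proj₂ (fibreMass-sum x)

    Pr-output-≤ : ∀ E u → (∀ hs → Unique hs → ∑ hs (λ h → 𝟙 (E (output h)) * runMass h) ≤ u) →
                  Pr outputPMF E ≤ u
    Pr-output-≤ E u bound = hasSum-least (proj₂ (Pr∃ outputPMF E)) u λ xs xs! →
      ∑-fibres output _ (λ h → 𝟙 (E (output h)) * runMass h) fibre xs xs! u
        (λ hs hs! _ → bound hs hs!)
      where
      fibre : ∀ x v →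
              (∀ hs → Unique hs → All (λ h → output h ≡ x) hs →
                ∑ hs (λ h → 𝟙 (E (output h)) * runMass h) ≤ v) →
              𝟙 (E x) * outputMass x ≤ v
      fibre x v below with E x in eq
      ... | false = ≤-respˡ-≈ (Eq.sym (zeroˡ (outputMass x))) (below [] [] [])
      ... | true  = ≤-respˡ-≈ (Eq.sym (*-identityˡ (outputMass x)))
        (outputMass-fibre x v λ hs hs! hs∈ →
          ≤-trans (∑-mono-∈ hs λ h h∈ → ≤-reflexive (Eq.sym (Eq.trans
            (*-congʳ (Eq.reflexive (≡.cong 𝟙 (≡.trans (≡.cong E (All.lookup hs∈ h∈)) eq))))
            (*-identityˡ (runMass h))))) (below hs hs! hs∈))

-- Combinatorics of stacks of independent layers.

module Stacks (ℝ : CompleteOrderedField) {n m : ℕ} (p : Fin n → Probability.PMF ℝ ℤ)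
              (ℬ : Fin m → Probability.Event ℝ n) (μ : Fin m → CompleteOrderedField.Carrier ℝ)
              (μ≥0 : ∀ B → CompleteOrderedField._≤_ ℝ (CompleteOrderedField.0# ℝ) (μ B)) where

  open CompleteOrderedField ℝ
  open Probability ℝ
  open Sums ℝ
  open PosetReasoning (TotalOrder.poset totalOrder) hiding (start)
  open CommutativeSemigroupProperties *-commutativeSemigroup
    using () renaming (interchange to *-interchange)
  open Truncated p ℬ μ μ≥0 hiding (prodᶠ-nonneg)

  ∼-refl : ∀ {A} → A ∼ A
  ∼-refl = inj₁ refl

  ∼-sym : ∀ {A B} → A ∼ B → B ∼ A
  ∼-sym (inj₁ A≡B) = inj₁ (≡.sym A≡B)
  ∼-sym {A} {B} (inj₂ (i , i∈)) =
    let i∈A , i∈B = x∈p∩q⁻ (vars (ℬ A)) (vars (ℬ B)) i∈ in inj₂ (i , x∈p∩q⁺ (i∈B , i∈A))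

  -- `μ-product` is `∏ μ` by definition.
  ∏ : ∀ {k} → (Fin k → Carrier) → Subset k → Carrier
  ∏ f I = prodᶠ λ i → if does (i ∈? I) then f i else 1#

  ∏-nonneg : ∀ {k} {f : Fin k → Carrier} → (∀ i → 0# ≤ f i) → ∀ I → 0# ≤ ∏ f I
  ∏-nonneg 0≤f I = prodᶠ-nonneg λ i → factor (does (i ∈? I)) i
    where
    factor : ∀ b i → 0# ≤ (if b then _ else 1#)
    factor true  i = 0≤f i
    factor false i = 0≤1

  ∏-mono : ∀ {k} {f g : Fin k → Carrier} → (∀ i → 0# ≤ f i) → (∀ i → f i ≤ g i) →
           ∀ I → ∏ f I ≤ ∏ g I
  ∏-mono 0≤f f≤g I = prodᶠ-mono (λ i → lower (does (i ∈? I)) i) (λ i → factor (does (i ∈? I)) i)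
    where
    lower : ∀ b i → 0# ≤ (if b then _ else 1#)
    lower true  i = 0≤f i
    lower false i = 0≤1

    factor : ∀ b i → (if b then _ else 1#) ≤ (if b then _ else 1#)
    factor true  i = f≤g i
    factor false i = ≤-refl

  prodᶠ-* : ∀ {k} (f g : Fin k → Carrier) → prodᶠ (λ i → f i * g i) ≈ prodᶠ f * prodᶠ g
  prodᶠ-* {zero}  f g = Eq.sym (*-identityˡ 1#)
  prodᶠ-* {suc k} f g = Eq.trans (*-congˡ (prodᶠ-* (f ∘ suc) (g ∘ suc)))
    (*-interchange (f zero) (g zero) (prodᶠ (f ∘ suc)) (prodᶠ (g ∘ suc)))

  ∏-* : ∀ {k} (f g : Fin k → Carrier) I → ∏ (λ i → f i * g i) I ≈ ∏ f I * ∏ g I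
  ∏-* f g I = Eq.trans (prodᶠ-cong λ i → factor (does (i ∈? I)) i) (prodᶠ-*
    (λ i → if does (i ∈? I) then f i else 1#) (λ i → if does (i ∈? I) then g i else 1#))
    where
    factor : ∀ b i → (if b then f i * g i else 1#) ≈ (if b then f i else 1#) * (if b then g i else 1#)
    factor true  i = Eq.refl
    factor false i = Eq.sym (*-identityˡ 1#)

  ∏-⊥ : ∀ {k} (f : Fin k → Carrier) → ∏ f ⊥ ≈ 1#
  ∏-⊥ {zero}  f = Eq.refl
  ∏-⊥ {suc k} f = Eq.trans (*-identityˡ _) (∏-⊥ (f ∘ suc))

  ∏-partition : ∀ {k} (f : Fin k → Carrier) I N → ∏ f I ≈ ∏ f (I ∩ N) * ∏ f (I ∩ ∁ N)
  ∏-partition f []      []      = Eq.sym (*-identityˡ 1#)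
  ∏-partition f (s ∷ I) (t ∷ N) = Eq.trans
    (*-cong (factor s t) (∏-partition (f ∘ suc) I N))
    (*-interchange _ _ (∏ (f ∘ suc) (I ∩ N)) (∏ (f ∘ suc) (I ∩ ∁ N)))
    where
    c = λ (b : Bool) (I : Subset _) → if does (zero ∈? (b ∷ I)) then f zero else 1#

    factor : ∀ s t → c s I ≈ c (s ∧ t) (I ∩ N) * c (s ∧ not t) (I ∩ ∁ N)
    factor true  true  = Eq.sym (*-identityʳ (f zero))
    factor true  false = Eq.sym (*-identityˡ (f zero))
    factor false _     = Eq.sym (*-identityˡ 1#)

  ∈-subsets : ∀ {k} (I : Subset k) → I ∈ˡ subsets k
  ∈-subsets []            = here refl
  ∈-subsets {suc k} (outside ∷ I) =
    ∈-cartesianProductWith⁺ _∷_ {xs = outside ∷ inside ∷ []} {ys = subsets k} (here refl) (∈-subsets I)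
  ∈-subsets {suc k} (inside ∷ I)  =
    ∈-cartesianProductWith⁺ _∷_ {xs = outside ∷ inside ∷ []} {ys = subsets k} (there (here refl)) (∈-subsets I)

  subsets-! : ∀ k → Unique (subsets k)
  subsets-! zero    = [] ∷ []
  subsets-! (suc k) =
    Unique.cartesianProductWith⁺ _∷_ Vec.∷-injective (((λ ()) ∷ []) ∷ [] ∷ []) (subsets-! k)

  -- The map `e` names the event of each index, so that an induction can strip the first bit of `J`
  -- and continue with `e ∘ suc`. Stacks use `e = id`.
  Dominated : ∀ {k} → (Fin k → Fin m) → Subset k → Subset m → Set
  Dominated e J I = ∀ B → B ∈ I → ∃[ C ] C ∈ J × B ∼ e C

  dominated? : ∀ {k} (e : Fin k → Fin m) J I → Dec (Dominated e J I)
  dominated? e J I = Fin.all? λ B → (B ∈? I) →-dec Fin.any? λ C → (C ∈? J) ×-dec (B ∼? e C)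

  Layer : ∀ {k} → (Fin k → Fin m) → Subset k → Subset m → Set
  Layer e J I = Dominated e J I × Independent I

  layer? : ∀ {k} (e : Fin k → Fin m) J I → Dec (Layer e J I)
  layer? e J I = dominated? e J I ×-dec independent? I

  layers : ∀ {k} → (Fin k → Fin m) → Subset k → List (Subset m)
  layers e J = List.filter (layer? e J) (subsets m)

  ∈-layers⁺ : ∀ {k} {e : Fin k → Fin m} {J I} → Layer e J I → I ∈ˡ layers e J
  ∈-layers⁺ {e = e} {J} {I} = ∈-filter⁺ (layer? e J) (∈-subsets I)

  ∈-layers⁻ : ∀ {k} {e : Fin k → Fin m} {J I} → I ∈ˡ layers e J → Layer e J I
  ∈-layers⁻ {e = e} {J} I∈ = proj₂ (∈-filter⁻ (layer? e J) {xs = subsets m} I∈)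

  layers-! : ∀ {k} (e : Fin k → Fin m) J → Unique (layers e J)
  layers-! e J = Unique.filter⁺ (layer? e J) (subsets-! m)

  ∈-independentSets : ∀ {A I} → I ⊆N A → Independent I → I ∈ˡ independentSets A
  ∈-independentSets {A} {I} I⊆N ind =
    ∈-filter⁺ (λ I → (I ⊆N? A) ×-dec independent? I) (∈-subsets I) (I⊆N , ind)

  ⊥-independent : Independent ⊥
  ⊥-independent A B A∈ = ⊥-elim (∉⊥ A∈)

  μ-product-nonneg : ∀ I → 0# ≤ μ-product I
  μ-product-nonneg = ∏-nonneg μ≥0

  -- The factor of `θ A` beside the probability of `A`: the independence polynomial of its inclusive
  -- neighbourhood.
  Z : Fin m → Carrier
  Z A = ∑ (independentSets A) μ-product

  Y : ∀ {k} → (Fin k → Fin m) → Subset k → Carrier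
  Y e J = ∑ (layers e J) μ-product

  Z-nonneg : ∀ A → 0# ≤ Z A
  Z-nonneg A = ∑-nonneg μ-product-nonneg (independentSets A)

  1≤Y : ∀ {k} (e : Fin k → Fin m) J → 1# ≤ Y e J
  1≤Y e J = ≤-respˡ-≈ (∏-⊥ μ) (∑-member μ-product-nonneg
    (∈-layers⁺ {e = e} {J} ((λ B B∈ → ⊥-elim (∉⊥ B∈)) , ⊥-independent)))

  neighbours : Fin m → Subset m
  neighbours A = Vec.tabulate λ B → does (B ∼? A)

  ∈-neighbours⁺ : ∀ {A B} → B ∼ A → B ∈ neighbours A
  ∈-neighbours⁺ {A} {B} B∼A = Vec.lookup⇒[]= B (neighbours A)
    (≡.trans (Vec.lookup∘tabulate (λ B → does (B ∼? A)) B) (dec-true (B ∼? A) B∼A))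

  ∈-neighbours⁻ : ∀ {A B} → B ∈ neighbours A → B ∼ A
  ∈-neighbours⁻ {A} {B} B∈ = does-true (B ∼? A)
    (≡.trans (≡.sym (Vec.lookup∘tabulate (λ B → does (B ∼? A)) B)) (Vec.[]=⇒lookup B∈))

  -- A set dominated by J splits into the neighbours of one member of J and a set
  -- dominated by the other members.
  Y≤∏Z : ∀ {k} (e : Fin k → Fin m) J → Y e J ≤ ∏ (Z ∘ e) J
  Y≤∏Z e [] = begin
    Y e []              ≤⟨ ∑-⊆ μ-product-nonneg (layers e []) (⊥ ∷ []) (layers-! e []) only-⊥ ⟩
    μ-product ⊥ + 0#    ≈⟨ +-identityʳ _ ⟩
    μ-product ⊥         ≈⟨ ∏-⊥ μ ⟩
    1#                  ∎
    where
    only-⊥ : ∀ I → I ∈ˡ layers e [] → I ∈ˡ (⊥ ∷ []) ⊎ μ-product I ≤ 0#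
    only-⊥ I I∈ = inj₁ (here (Empty-unique λ (B , B∈I) → absurd B B∈I))
      where
      absurd : ∀ B → B ∉ I
      absurd B B∈I with proj₁ (∈-layers⁻ {e = e} {[]} I∈) B B∈I
      ... | () , _
  Y≤∏Z e (outside ∷ J) = begin
    Y e (outside ∷ J)             ≤⟨ ∑-⊆ μ-product-nonneg _ _ (layers-! e (outside ∷ J)) sub ⟩
    Y (e ∘ suc) J                 ≤⟨ Y≤∏Z (e ∘ suc) J ⟩
    ∏ (Z ∘ e ∘ suc) J             ≈⟨ *-identityˡ _ ⟨
    1# * ∏ (Z ∘ e ∘ suc) J        ∎
    where
    sub : ∀ I → I ∈ˡ layers e (outside ∷ J) → I ∈ˡ layers (e ∘ suc) J ⊎ μ-product I ≤ 0#
    sub I I∈ with ∈-layers⁻ {e = e} {outside ∷ J} I∈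
    ... | dom , ind = inj₁ (∈-layers⁺ {e = e ∘ suc} {J} (dom′ , ind))
      where
      dom′ : Dominated (e ∘ suc) J I
      dom′ B B∈ with dom B B∈
      ... | suc C , there C∈ , B∼C = C , C∈ , B∼C
  Y≤∏Z e (inside ∷ J) = begin
    Y e (inside ∷ J)
      ≤⟨ ∑-injection split pair-nonneg split-injective (layers-! e (inside ∷ J)) into
           (λ I _ → ≤-reflexive (∏-partition μ I N)) ⟩
    ∑ (List.cartesianProduct (independentSets (e zero)) (layers (e ∘ suc) J)) pair
      ≈⟨ ∑-cartesian pair μ-product μ-product _,_ (λ _ _ → refl) (independentSets (e zero)) _ ⟩
    Z (e zero) * Y (e ∘ suc) J
      ≤⟨ *-monoˡ-≤ (Z-nonneg (e zero)) (Y≤∏Z (e ∘ suc) J) ⟩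
    Z (e zero) * ∏ (Z ∘ e ∘ suc) J ∎
    where
    N : Subset m
    N = neighbours (e zero)

    pair : Subset m × Subset m → Carrier
    pair (I , I′) = μ-product I * μ-product I′

    pair-nonneg : ∀ I → 0# ≤ pair I
    pair-nonneg (I , I′) = *-nonneg (μ-product-nonneg I) (μ-product-nonneg I′)

    split : Subset m → Subset m × Subset m
    split I = I ∩ N , I ∩ ∁ N

    rejoin : ∀ I → (I ∩ N) ∪ (I ∩ ∁ N) ≡ I
    rejoin I = ≡.trans (≡.sym (∩-distribˡ-∪ I N (∁ N)))
                       (≡.trans (≡.cong (I ∩_) (p∪∁p≡⊤ N)) (∩-identityʳ I))

    split-injective : ∀ {I I′} → split I ≡ split I′ → I ≡ I′
    split-injective {I} {I′} eq = ≡.trans (≡.sym (rejoin I))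
      (≡.trans (≡.cong₂ _∪_ (proj₁ (,-injective eq)) (proj₂ (,-injective eq))) (rejoin I′))

    into : ∀ I → I ∈ˡ layers e (inside ∷ J) →
           split I ∈ˡ List.cartesianProduct (independentSets (e zero)) (layers (e ∘ suc) J)
    into I I∈ with ∈-layers⁻ {e = e} {inside ∷ J} I∈
    ... | dom , ind = ∈-cartesianProductWith⁺ _,_
      (∈-independentSets (λ B B∈ → ∈-neighbours⁻ (proj₂ (x∈p∩q⁻ I N B∈)))
        (λ A B A∈ B∈ → ind A B (proj₁ (x∈p∩q⁻ I N A∈)) (proj₁ (x∈p∩q⁻ I N B∈))))
      (∈-layers⁺ {e = e ∘ suc} {J} (dom′ ,
        (λ A B A∈ B∈ → ind A B (proj₁ (x∈p∩q⁻ I (∁ N) A∈)) (proj₁ (x∈p∩q⁻ I (∁ N) B∈)))))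
      where
      dom′ : Dominated (e ∘ suc) J (I ∩ ∁ N)
      dom′ B B∈ with x∈p∩q⁻ I (∁ N) B∈
      ... | B∈I , B∈∁N with dom B B∈I
      ... | zero  , here     , B∼A = ⊥-elim (x∈∁p⇒x∉p B∈∁N (∈-neighbours⁺ B∼A))
      ... | suc C , there C∈ , B∼C = C , C∈ , B∼C

  -- Stacks record the resamplings that a final event A can be traced back to, in
  -- the role of witness trees: the earliest layer is on top, and the bottom layer is
  -- dominated by A itself.
  Stack : ℕ → Set
  Stack = Vec (Subset m)

  Adjacent : Fin m → Subset m → Set
  Adjacent B K = ∃[ C ] C ∈ K × B ∼ C

  adjacent? : ∀ B K → Dec (Adjacent B K)
  adjacent? B K = Fin.any? λ C → (C ∈? K) ×-dec (B ∼? C)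

  ∈-insert⁻ : ∀ {k} {i j : Fin k} K → j ∈ K [ i ]≔ inside → j ≡ i ⊎ j ∈ K
  ∈-insert⁻ {i = zero}  {zero}  (_ ∷ K) _          = inj₁ refl
  ∈-insert⁻ {i = zero}  {suc j} (_ ∷ K) (there j∈) = inj₂ (there j∈)
  ∈-insert⁻ {i = suc i} {zero}  (_ ∷ K) here       = inj₂ here
  ∈-insert⁻ {i = suc i} {suc j} (_ ∷ K) (there j∈) with ∈-insert⁻ K j∈
  ... | inj₁ refl = inj₁ refl
  ... | inj₂ j∈K  = inj₂ (there j∈K)

  ∈-insert : ∀ {k} (i : Fin k) K → i ∈ K [ i ]≔ inside
  ∈-insert i K = Vec.[]≔-updates K i

  ⊆-insert : ∀ {k} {i j : Fin k} K → j ∈ K → j ∈ K [ i ]≔ inside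
  ⊆-insert {i = zero}  (_ ∷ K) here       = here
  ⊆-insert {i = zero}  (_ ∷ K) (there j∈) = there j∈
  ⊆-insert {i = suc i} (_ ∷ K) here       = here
  ⊆-insert {i = suc i} (_ ∷ K) (there j∈) = there (⊆-insert K j∈)

  insert-injective : ∀ {k} {i : Fin k} {K L} → i ∉ K → i ∉ L →
                     K [ i ]≔ inside ≡ L [ i ]≔ inside → K ≡ L
  insert-injective {i = zero} {inside ∷ K}  {_}           i∉K i∉L eq = ⊥-elim (i∉K here)
  insert-injective {i = zero} {outside ∷ K} {inside ∷ L}  i∉K i∉L eq = ⊥-elim (i∉L here)
  insert-injective {i = zero} {outside ∷ K} {outside ∷ L} i∉K i∉L eq =
    ≡.cong (outside ∷_) (Vec.∷-injectiveʳ eq)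
  insert-injective {i = suc i} {s ∷ K} {t ∷ L} i∉K i∉L eq =
    ≡.cong₂ _∷_ (Vec.∷-injectiveˡ eq)
      (insert-injective (i∉K ∘ there) (i∉L ∘ there) (Vec.∷-injectiveʳ eq))

  module _ (A : Fin m) where

    -- The root acts as a layer beneath the bottom one, so domination and adjacency there need no
    -- separate case.
    top : ∀ {d} → Stack d → Subset m
    top []      = ⁅ A ⁆
    top (K ∷ _) = K

    -- The height is exactly `d`, but upper layers may be empty, and only the empty layer is
    -- dominated by an empty one. A fixed height keeps the list finite; one further resampling fills
    -- at most one more layer.
    stacks : ∀ d → List (Stack d)
    stacks zero    = [ [] ]
    stacks (suc d) = concatMap (λ M → List.map (_∷ M) (layers id (top M))) (stacks d)

    ∈-stacks⁺ : ∀ {d} {K} {M : Stack d} → M ∈ˡ stacks d → Layer id (top M) K → (K ∷ M) ∈ˡ stacks (suc d)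
    ∈-stacks⁺ {M = M} M∈ layer = ∈-concatMap⁺ _ (Any.map (λ { refl →
      ∈-map⁺ (_∷ M) (∈-layers⁺ {e = id} {top M} layer) }) M∈)

    ∈-stacks⁻ : ∀ {d} {K} {M : Stack d} → (K ∷ M) ∈ˡ stacks (suc d) → M ∈ˡ stacks d × Layer id (top M) K
    ∈-stacks⁻ {d} KM∈ = go (∈-concatMap⁻ _ KM∈)
      where
      go : ∀ {K} {M : Stack d} {Ms} →
           Any.Any (λ M′ → (K ∷ M) ∈ˡ List.map (_∷ M′) (layers id (top M′))) Ms →
           M ∈ˡ Ms × Layer id (top M) K
      go (here K∈) with ∈-map⁻ _ K∈
      ... | _ , K∈ , refl = here refl , ∈-layers⁻ {e = id} K∈
      go (there M∈) with go M∈
      ... | M∈ , layer = there M∈ , layer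

    stacks-! : ∀ d → Unique (stacks d)
    stacks-! zero    = [] ∷ []
    stacks-! (suc d) = Unique.concat⁺
      (All.map⁺ (All.universal (λ M → Unique.map⁺ Vec.∷-injectiveˡ (layers-! id (top M))) (stacks d)))
      (AllPairs.map⁺ (AllPairs.map (λ M≢M′ {_} (x∈ , x∈′) → distinct M≢M′ x∈ x∈′) (stacks-! d)))
      where
      distinct : ∀ {M M′ : Stack d} → M ≢ M′ → ∀ {x} → x ∈ˡ List.map (_∷ M) (layers id (top M)) →
                 ¬ (x ∈ˡ List.map (_∷ M′) (layers id (top M′)))
      distinct M≢M′ x∈ x∈′ with ∈-map⁻ _ x∈ | ∈-map⁻ _ x∈′
      ... | _ , _ , refl | _ , _ , eq = M≢M′ (Vec.∷-injectiveʳ eq)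

    emptyStack : ∀ d → Stack d
    emptyStack d = Vec.replicate d ⊥

    emptyStack∈ : ∀ d → emptyStack d ∈ˡ stacks d
    emptyStack∈ zero    = here refl
    emptyStack∈ (suc d) = ∈-stacks⁺ (emptyStack∈ d) ((λ B B∈ → ⊥-elim (∉⊥ B∈)) , ⊥-independent)

    -- A resampling of B that precedes those recorded in the stack K ∷ M sinks into
    -- the layer above the first one that it is adjacent to.  If there is none, then B
    -- does not affect the variables of the stack and is forgotten.
    sink : ∀ {d} → Fin m → Subset m → Stack d → Stack (suc d)
    sinkBelow : ∀ {d} → Fin m → Stack d → Stack d

    -- In every use `K` is already known not to be adjacent to `B`; what is tested is the layer
    -- beneath it.
    sink B K M with adjacent? B (top M)
    ... | yes _ = (K [ B ]≔ inside) ∷ M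
    ... | no  _ = K ∷ sinkBelow B M

    sinkBelow B []      = []
    sinkBelow B (K ∷ M) = sink B K M

    -- To undo the sinking, `B` is removed from the topmost layer that contains it, if there is one:
    -- the layers that `B` passed are not adjacent to it, hence by reflexivity of `∼` do not contain
    -- it.
    sink-injective : ∀ {d} {B K K′} {M M′ : Stack d} → B ∉ K → B ∉ K′ →
                     sink B K M ≡ sink B K′ M′ → K ≡ K′ × M ≡ M′
    sink-injective {B = B} {K} {K′} {M} {M′} B∉K B∉K′ eq
      with adjacent? B (top M) | adjacent? B (top M′)
    ... | yes _ | yes _ = insert-injective B∉K B∉K′ (Vec.∷-injectiveˡ eq) , Vec.∷-injectiveʳ eq
    ... | yes _ | no  _ =
      ⊥-elim (B∉K′ (≡.subst (B ∈_) (Vec.∷-injectiveˡ eq) (∈-insert B K)))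
    ... | no  _ | yes _ =
      ⊥-elim (B∉K (≡.subst (B ∈_) (≡.sym (Vec.∷-injectiveˡ eq)) (∈-insert B K′)))
    sink-injective {M = []}    {[]}      _ _ eq | no _ | no _ = Vec.∷-injectiveˡ eq , refl
    sink-injective {M = L ∷ M} {L′ ∷ M′} _ _ eq | no ¬adj | no ¬adj′
      with sink-injective {M = M} {M′} (λ B∈ → ¬adj (_ , B∈ , ∼-refl))
                                       (λ B∈ → ¬adj′ (_ , B∈ , ∼-refl)) (Vec.∷-injectiveʳ eq)
    ... | refl , refl = Vec.∷-injectiveˡ eq , refl

    -- The root stops the descent at the latest, so `B` is not forgotten.
    sink≢empty : ∀ {d} {B} → B ∼ A → ∀ K (M : Stack d) → sink B K M ≢ emptyStack (suc d)
    sink≢empty {B = B} B∼A K M eq with adjacent? B (top M)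
    ... | yes _ = ∉⊥ (≡.subst (B ∈_) (Vec.∷-injectiveˡ eq) (∈-insert B K))
    sink≢empty B∼A K []      eq | no ¬adj = ¬adj (A , x∈⁅x⁆ A , B∼A)
    sink≢empty B∼A K (L ∷ M) eq | no _    = sink≢empty B∼A L M (Vec.∷-injectiveʳ eq)

    ⊆-top-sink : ∀ {d} B K (M : Stack d) {C} → C ∈ K → C ∈ top (sink B K M)
    ⊆-top-sink B K M C∈ with adjacent? B (top M)
    ... | yes _ = ⊆-insert K C∈
    ... | no  _ = C∈

    -- The layer receiving `B` stays independent because `B` is not adjacent to it, and stays
    -- dominated because `B` is adjacent to the one beneath. The layer above it stays dominated
    -- since insertion only enlarges what lies below.
    sink∈stacks : ∀ {d B K} {M : Stack d} → (K ∷ M) ∈ˡ stacks (suc d) → ¬ Adjacent B K →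
                  sink B K M ∈ˡ stacks (suc d)
    sink∈stacks {B = B} {K} {M} KM∈ ¬adjK with ∈-stacks⁻ KM∈ | adjacent? B (top M)
    ... | M∈ , dom , ind | yes adj = ∈-stacks⁺ M∈ (dom′ , ind′)
      where
      dom′ : Dominated id (top M) (K [ B ]≔ inside)
      dom′ C C∈ with ∈-insert⁻ K C∈
      ... | inj₁ refl = adj
      ... | inj₂ C∈K  = dom C C∈K

      ind′ : Independent (K [ B ]≔ inside)
      ind′ C D C∈ D∈ C≢D C∼D with ∈-insert⁻ K C∈ | ∈-insert⁻ K D∈
      ... | inj₁ refl | inj₁ refl = C≢D refl
      ... | inj₁ refl | inj₂ D∈K  = ¬adjK (D , D∈K , C∼D)
      ... | inj₂ C∈K  | inj₁ refl = ¬adjK (C , C∈K , ∼-sym C∼D)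
      ... | inj₂ C∈K  | inj₂ D∈K  = ind C D C∈K D∈K C≢D C∼D
    sink∈stacks {M = []}    KM∈ _ | _ | no _ = KM∈
    sink∈stacks {B = B} {K} {M = L ∷ M} KM∈ _ | LM∈ , dom , ind | no ¬adj =
      ∈-stacks⁺ (sink∈stacks LM∈ ¬adj) (dom′ , ind)
      where
      dom′ : Dominated id (top (sink B L M)) K
      dom′ C C∈ with dom C C∈
      ... | D , D∈L , C∼D = D , ⊆-top-sink B L M D∈L , C∼D

    stackProduct : ∀ {d} → (Fin m → Carrier) → Stack d → Carrier
    stackProduct P []      = 1#
    stackProduct P (K ∷ M) = ∏ P K * stackProduct P M

    stackProduct-nonneg : ∀ {d} {P} → (∀ B → 0# ≤ P B) → (M : Stack d) → 0# ≤ stackProduct P M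
    stackProduct-nonneg 0≤P []      = 0≤1
    stackProduct-nonneg 0≤P (K ∷ M) = *-nonneg (∏-nonneg 0≤P K) (stackProduct-nonneg 0≤P M)

    module _ {P : Fin m → Carrier} (0≤P : ∀ B → 0# ≤ P B) (PZ≤μ : ∀ B → P B * Z B ≤ μ B) where

      private
        -- The plain sum over stacks can only grow with the height. Closing each stack with one more
        -- layer, weighted by `μ` instead of `P`, turns this into a decrease that starts at or below
        -- `Z A`.
        U : ℕ → Carrier
        U d = ∑ (stacks d) λ M → stackProduct P M * Y id (top M)

      -- `PZ≤μ` is applied to every event of the layer: the weight `P` of `K`, together with the
      -- closing layer above it, is absorbed into the weight `μ` of `K` as a closing layer.
      ∏PY≤μ : ∀ K → ∏ P K * Y id K ≤ μ-product K
      ∏PY≤μ K = begin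
        ∏ P K * Y id K           ≤⟨ *-monoˡ-≤ (∏-nonneg 0≤P K) (Y≤∏Z id K) ⟩
        ∏ P K * ∏ Z K            ≈⟨ ∏-* P Z K ⟨
        ∏ (λ B → P B * Z B) K    ≤⟨ ∏-mono (λ B → *-nonneg (0≤P B) (Z-nonneg B)) PZ≤μ K ⟩
        μ-product K              ∎

      U-decreasing : ∀ d → U (suc d) ≤ U d
      U-decreasing d = ≤-trans (≤-reflexive (∑-concatMap _ _ (stacks d))) (∑-mono row (stacks d))
        where
        row : ∀ M → ∑ (List.map (_∷ M) (layers id (top M)))
                      (λ M → stackProduct P M * Y id (top M)) ≤ stackProduct P M * Y id (top M)
        row M = begin
          ∑ (List.map (_∷ M) (layers id (top M))) (λ M → stackProduct P M * Y id (top M))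
            ≡⟨ ∑-map (_∷ M) _ (layers id (top M)) ⟩
          ∑ (layers id (top M)) (λ K → ∏ P K * stackProduct P M * Y id K)
            ≤⟨ ∑-mono (λ K → ≤-trans (≤-reflexive (begin-equality
                 ∏ P K * stackProduct P M * Y id K     ≈⟨ *-congʳ (*-comm _ _) ⟩
                 stackProduct P M * ∏ P K * Y id K     ≈⟨ *-assoc _ _ _ ⟩
                 stackProduct P M * (∏ P K * Y id K)   ∎))
               (*-monoˡ-≤ (stackProduct-nonneg 0≤P M) (∏PY≤μ K))) (layers id (top M)) ⟩
          ∑ (layers id (top M)) (λ K → stackProduct P M * μ-product K)
            ≈⟨ ∑-*ˡ (stackProduct P M) μ-product (layers id (top M)) ⟩
          stackProduct P M * Y id (top M) ∎

      U≤Z : ∀ d → U d ≤ Z A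
      U≤Z zero = begin
        1# * Y id ⁅ A ⁆ + 0#  ≈⟨ Eq.trans (+-identityʳ _) (*-identityˡ _) ⟩
        Y id ⁅ A ⁆            ≤⟨ ∑-⊆ μ-product-nonneg _ _ (layers-! id ⁅ A ⁆) sub ⟩
        Z A                   ∎
        where
        sub : ∀ I → I ∈ˡ layers id ⁅ A ⁆ → I ∈ˡ independentSets A ⊎ μ-product I ≤ 0#
        sub I I∈ with ∈-layers⁻ {e = id} {⁅ A ⁆} I∈
        ... | dom , ind = inj₁ (∈-independentSets (λ B B∈ → let C , C∈ , B∼C = dom B B∈ in
          ≡.subst (B ∼_) (x∈⁅y⁆⇒x≡y A C∈) B∼C) ind)
      U≤Z (suc d) = ≤-trans (U-decreasing d) (U≤Z d)

      ∑-stackProduct≤Z : ∀ d → ∑ (stacks d) (stackProduct P) ≤ Z A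
      -- The empty closing layer has weight 1, so inserting the factor `Y` only increases the sum.
      ∑-stackProduct≤Z d = ≤-trans (∑-mono (λ M → ≤-respˡ-≈ (*-identityʳ _)
        (*-monoˡ-≤ (stackProduct-nonneg 0≤P M) (1≤Y id (top M)))) (stacks d)) (U≤Z d)

-- Stack masses as functions of the state.

module Potential (ℝ : CompleteOrderedField) {n m : ℕ} (p : Fin n → Probability.PMF ℝ ℤ)
                 (ℬ : Fin m → Probability.Event ℝ n) (μ : Fin m → CompleteOrderedField.Carrier ℝ)
                 (μ≥0 : ∀ B → CompleteOrderedField._≤_ ℝ (CompleteOrderedField.0# ℝ) (μ B))
                 (F : List ℤ) (F! : Unique F) where

  open CompleteOrderedField ℝ
  open Probability ℝ
  open Sums ℝ
  open Average ℝ F F!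
  open PosetReasoning (TotalOrder.poset totalOrder) hiding (start)
  open CommutativeSemigroupProperties *-commutativeSemigroup
    using () renaming (x∙yz≈y∙xz to *-swap)
  open Truncated p ℬ μ μ≥0 hiding (prodᶠ-nonneg)
  open Stacks ℝ p ℬ μ μ≥0

  -- Each coin belongs to one event only, so the truncation relates no events that were unrelated
  -- before.
  vars′-disjoint : ∀ {A B} → ¬ (A ∼ B) → Disjoint (vars (ℬ′ A)) (vars (ℬ′ B))
  vars′-disjoint {A} {B} A≁B i i∈A i∈B with splitAt n i | split A i i∈A | split B i i∈B
    where
    split : ∀ C i → i ∈ vars (ℬ′ C) →
            [ lookup (vars (ℬ C)) , lookup ⁅ C ⁆ ]′ (splitAt n i) ≡ inside
    split C i i∈ =
      ≡.trans (≡.sym (Vec.lookup-splitAt n (vars (ℬ C)) ⁅ C ⁆ i)) (Vec.[]=⇒lookup i∈)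
  ... | inj₁ j | in-A | in-B = A≁B (inj₂ (j , x∈p∩q⁺
    (Vec.lookup⇒[]= j (vars (ℬ A)) in-A , Vec.lookup⇒[]= j (vars (ℬ B)) in-B)))
  ... | inj₂ j | in-A | in-B = A≁B (inj₁ (≡.trans
    (≡.sym (x∈⁅y⁆⇒x≡y A (Vec.lookup⇒[]= j ⁅ A ⁆ in-A)))
    (x∈⁅y⁆⇒x≡y B (Vec.lookup⇒[]= j ⁅ B ⁆ in-B))))

  State : Set
  State = Vec ℤ (n ℕ.+ m)

  true′ : Fin m → State → Carrier
  true′ B x = 𝟙 (holds (ℬ′ B) x)

  true′-nonneg : ∀ B x → 0# ≤ true′ B x
  true′-nonneg B x = 𝟙-nonneg (holds (ℬ′ B) x)

  true′-local : ∀ B → Local (vars (ℬ′ B)) (true′ B)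
  true′-local B x y eq = Eq.reflexive (≡.cong 𝟙 (local (ℬ′ B) x y eq))

  R : Fin m → (State → Carrier) → State → Carrier
  R B f x = true′ B x * 𝔼 p′ (vars (ℬ′ B)) f x

  R-mono : ∀ B {f g} → (∀ x → f x ≤ g x) → ∀ x → R B f x ≤ R B g x
  R-mono B f≤g x = *-monoˡ-≤ (true′-nonneg B x) (𝔼-mono p′ (vars (ℬ′ B)) f≤g x)

  R-cong : ∀ B {f g} → (∀ x → f x ≈ g x) → ∀ x → R B f x ≈ R B g x
  R-cong B f≈g x = *-congˡ (𝔼-cong p′ (vars (ℬ′ B)) f≈g x)

  R-nonneg : ∀ B {f} → (∀ x → 0# ≤ f x) → ∀ x → 0# ≤ R B f x
  R-nonneg B 0≤f x = *-nonneg (true′-nonneg B x) (𝔼-nonneg p′ (vars (ℬ′ B)) 0≤f x)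

  R-∑ : ∀ B {A : Set} (f : A → State → Carrier) ks x →
        R B (λ y → ∑ ks (λ k → f k y)) x ≈ ∑ ks (λ k → R B (f k) x)
  R-∑ B f ks x = Eq.trans (*-congˡ (𝔼-∑ p′ (vars (ℬ′ B)) f ks x))
                          (Eq.sym (∑-*ˡ (true′ B x) (λ k → 𝔼 p′ (vars (ℬ′ B)) (f k) x) ks))

  -- Without common variables neither resampling affects the truth of the other event, and the two
  -- integrals commute.
  R-commute : ∀ {A B} → ¬ (A ∼ B) → ∀ f x → R A (R B f) x ≈ R B (R A f) x
  R-commute {A} {B} A≁B f x = begin-equality
    true′ A x * 𝔼 p′ S (λ y → true′ B y * 𝔼 p′ T f y) x
      ≈⟨ *-congˡ (𝔼-pull p′ S (local⇒insensitive (true′-local B) dis) (𝔼 p′ T f) x) ⟩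
    true′ A x * (true′ B x * 𝔼 p′ S (𝔼 p′ T f) x)
      ≈⟨ *-swap (true′ A x) (true′ B x) _ ⟩
    true′ B x * (true′ A x * 𝔼 p′ S (𝔼 p′ T f) x)
      ≈⟨ *-congˡ (*-congˡ (𝔼-commute p′ S T dis f x)) ⟩
    true′ B x * (true′ A x * 𝔼 p′ T (𝔼 p′ S f) x)
      ≈⟨ *-congˡ (𝔼-pull p′ T (local⇒insensitive (true′-local A) (λ i i∈T i∈S → dis i i∈S i∈T))
                              (𝔼 p′ S f) x) ⟨
    true′ B x * 𝔼 p′ T (λ y → true′ A y * 𝔼 p′ S f y) x ∎
    where
    S   = vars (ℬ′ A)
    T   = vars (ℬ′ B)
    dis = vars′-disjoint A≁B

  -- The events act in the order of their indices. For an independent layer the order is immaterial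
  -- by `R-commute`, which `R*-insert` uses to move a new event to its place.
  R* : ∀ {k} → (Fin k → Fin m) → Subset k → (State → Carrier) → State → Carrier
  R* e []            f = f
  R* e (inside ∷ K)  f = R (e zero) (R* (e ∘ suc) K f)
  R* e (outside ∷ K) f = R* (e ∘ suc) K f

  R*-mono : ∀ {k} (e : Fin k → Fin m) K {f g} → (∀ x → f x ≤ g x) → ∀ x → R* e K f x ≤ R* e K g x
  R*-mono e []            f≤g = f≤g
  R*-mono e (inside ∷ K)  f≤g = R-mono (e zero) (R*-mono (e ∘ suc) K f≤g)
  R*-mono e (outside ∷ K) f≤g = R*-mono (e ∘ suc) K f≤g

  R*-nonneg : ∀ {k} (e : Fin k → Fin m) K {f} → (∀ x → 0# ≤ f x) → ∀ x → 0# ≤ R* e K f x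
  R*-nonneg e []            0≤f = 0≤f
  R*-nonneg e (inside ∷ K)  0≤f = R-nonneg (e zero) (R*-nonneg (e ∘ suc) K 0≤f)
  R*-nonneg e (outside ∷ K) 0≤f = R*-nonneg (e ∘ suc) K 0≤f

  R*-⊥ : ∀ {k} (e : Fin k → Fin m) f → R* e ⊥ f ≡ f
  R*-⊥ {zero}  e f = refl
  R*-⊥ {suc k} e f = R*-⊥ (e ∘ suc) f

  R*-commute : ∀ {k} (e : Fin k → Fin m) K B → (∀ C → C ∈ K → ¬ (B ∼ e C)) →
               ∀ f x → R B (R* e K f) x ≈ R* e K (R B f) x
  R*-commute e []            B B≁ f x = Eq.refl
  R*-commute e (inside ∷ K)  B B≁ f x = Eq.trans
    (R-commute (B≁ zero here) (R* (e ∘ suc) K f) x)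
    (R-cong (e zero) (R*-commute (e ∘ suc) K B (λ C C∈ → B≁ (suc C) (there C∈)) f) x)
  R*-commute e (outside ∷ K) B B≁ f x =
    R*-commute (e ∘ suc) K B (λ C C∈ → B≁ (suc C) (there C∈)) f x

  R*-insert : ∀ {k} (e : Fin k → Fin m) K i → (∀ C → C ∈ K → ¬ (e i ∼ e C)) →
              ∀ f x → R (e i) (R* e K f) x ≈ R* e (K [ i ]≔ inside) f x
  R*-insert e (inside ∷ K)  zero    i≁ f x = ⊥-elim (i≁ zero here ∼-refl)
  R*-insert e (outside ∷ K) zero    i≁ f x = Eq.refl
  R*-insert e (inside ∷ K)  (suc i) i≁ f x = Eq.trans
    (R-commute (i≁ zero here) (R* (e ∘ suc) K f) x)
    (R-cong (e zero) (R*-insert (e ∘ suc) K i (λ C C∈ → i≁ (suc C) (there C∈)) f) x)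
  R*-insert e (outside ∷ K) (suc i) i≁ f x =
    R*-insert (e ∘ suc) K i (λ C C∈ → i≁ (suc C) (there C∈)) f x

  module _ {P : Fin m → Carrier} (0≤P : ∀ B → 0# ≤ P B)
           (true≤P : ∀ B x → 𝔼 p′ (vars (ℬ′ B)) (true′ B) x ≤ P B) where

    𝔼-R : ∀ B {f} → (∀ x → 0# ≤ f x) → ∀ x → 𝔼 p′ ⊤ (R B f) x ≤ P B * 𝔼 p′ ⊤ f x
    𝔼-R B {f} 0≤f x = begin
      𝔼 p′ ⊤ (R B f) x
        ≈⟨ 𝔼-regenerate p′ (vars (ℬ′ B)) (true′-local B) f x ⟩
      𝔼 p′ (vars (ℬ′ B)) (true′ B) x * 𝔼 p′ ⊤ f x
        ≤⟨ *-monoʳ-≤ (𝔼-nonneg p′ ⊤ 0≤f x) (true≤P B x) ⟩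
      P B * 𝔼 p′ ⊤ f x ∎

    𝔼-R* : ∀ {k} (e : Fin k → Fin m) K {f} → (∀ x → 0# ≤ f x) → ∀ x →
           𝔼 p′ ⊤ (R* e K f) x ≤ ∏ (P ∘ e) K * 𝔼 p′ ⊤ f x
    𝔼-R* e []            0≤f x = ≤-reflexive (Eq.sym (*-identityˡ _))
    𝔼-R* e (inside ∷ K) {f} 0≤f x = begin
      𝔼 p′ ⊤ (R (e zero) (R* (e ∘ suc) K f)) x
        ≤⟨ 𝔼-R (e zero) (R*-nonneg (e ∘ suc) K 0≤f) x ⟩
      P (e zero) * 𝔼 p′ ⊤ (R* (e ∘ suc) K f) x
        ≤⟨ *-monoˡ-≤ (0≤P (e zero)) (𝔼-R* (e ∘ suc) K 0≤f x) ⟩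
      P (e zero) * (∏ (P ∘ e ∘ suc) K * 𝔼 p′ ⊤ f x)
        ≈⟨ *-assoc (P (e zero)) (∏ (P ∘ e ∘ suc) K) (𝔼 p′ ⊤ f x) ⟨
      ∏ (P ∘ e) (inside ∷ K) * 𝔼 p′ ⊤ f x ∎
    𝔼-R* e (outside ∷ K) {f} 0≤f x =
      ≤-trans (𝔼-R* (e ∘ suc) K 0≤f x) (≤-reflexive (*-congʳ (Eq.sym (*-identityˡ _))))

  module _ (A : Fin m) (E : State → Bool)
           (E-local : ∀ x y → (∀ i → i ∈ vars (ℬ′ A) → lookup x i ≡ lookup y i) → E x ≡ E y) where

    -- The outermost operator is the earliest in time, so the top layer has to be applied last in
    -- the composition.
    stackMass : ∀ {d} → Stack d → State → Carrier
    stackMass []      = 𝟙 ∘ E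
    stackMass (K ∷ M) = R* id K (stackMass M)

    stackMass-nonneg : ∀ {d} (M : Stack d) x → 0# ≤ stackMass M x
    stackMass-nonneg []      x = 𝟙-nonneg (E x)
    stackMass-nonneg (K ∷ M) x = R*-nonneg id K (stackMass-nonneg M) x

    stackMass-empty : ∀ d → stackMass (emptyStack A d) ≡ 𝟙 ∘ E
    stackMass-empty zero    = refl
    stackMass-empty (suc d) = ≡.trans (R*-⊥ id (stackMass (emptyStack A d))) (stackMass-empty d)

    R-root : ∀ {B} → ¬ (B ∼ A) → ∀ x → R B (𝟙 ∘ E) x ≤ 𝟙 (E x)
    R-root {B} B≁A x = begin
      true′ B x * 𝔼 p′ (vars (ℬ′ B)) (𝟙 ∘ E) x
        ≤⟨ *-≤ˡ (𝔼-nonneg p′ (vars (ℬ′ B)) (𝟙-nonneg ∘ E) x) (𝟙≤1 (holds (ℬ′ B) x)) ⟩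
      𝔼 p′ (vars (ℬ′ B)) (𝟙 ∘ E) x
        ≤⟨ 𝔼-insensitive-≤ p′ (vars (ℬ′ B)) (𝟙-nonneg ∘ E) (local⇒insensitive
             (λ x y eq → Eq.reflexive (≡.cong 𝟙 (E-local x y eq))) (vars′-disjoint B≁A)) x ⟩
      𝟙 (E x) ∎

    -- The operator of `B` commutes past every layer that `B` leaves behind. It then joins a layer
    -- without change of mass, or reaches the root, whose variables it does not touch; only there
    -- can mass be lost.
    R-sink : ∀ {d} B K (M : Stack d) → ¬ Adjacent B K → ∀ x →
             R B (stackMass (K ∷ M)) x ≤ stackMass (sink A B K M) x
    R-sink B K M ¬adjK x with adjacent? B (top A M)
    ... | yes _ =
      ≤-reflexive (R*-insert id K B (λ C C∈ B∼C → ¬adjK (C , C∈ , B∼C)) (stackMass M) x)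
    R-sink B K [] ¬adjK x | no ¬adj = begin
      R B (R* id K (𝟙 ∘ E)) x
        ≈⟨ R*-commute id K B (λ C C∈ B∼C → ¬adjK (C , C∈ , B∼C)) (𝟙 ∘ E) x ⟩
      R* id K (R B (𝟙 ∘ E)) x
        ≤⟨ R*-mono id K (R-root (λ B∼A → ¬adj (A , x∈⁅x⁆ A , B∼A))) x ⟩
      R* id K (𝟙 ∘ E) x ∎
    R-sink B K (L ∷ M) ¬adjK x | no ¬adj = begin
      R B (R* id K (stackMass (L ∷ M))) x
        ≈⟨ R*-commute id K B (λ C C∈ B∼C → ¬adjK (C , C∈ , B∼C)) (stackMass (L ∷ M)) x ⟩
      R* id K (R B (stackMass (L ∷ M))) x
        ≤⟨ R*-mono id K (R-sink B L M ¬adj) x ⟩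
      R* id K (stackMass (sink A B L M)) x ∎

    φ : ℕ → State → Carrier
    φ d x = ∑ (stacks A d) (λ M → stackMass M x)

    φ-nonneg : ∀ d x → 0# ≤ φ d x
    φ-nonneg d x = ∑-nonneg (λ M → stackMass-nonneg M x) (stacks A d)

    private
      ¬adjacent-⊥ : ∀ B → ¬ Adjacent B ⊥
      ¬adjacent-⊥ B (C , C∈ , _) = ∉⊥ C∈

      -- Sinking starts at a new empty top layer, to which `B` is vacuously not adjacent; this is
      -- why one resampling raises the height by one.
      sink⊥-injective : ∀ {d} B {M M′ : Stack d} → sink A B ⊥ M ≡ sink A B ⊥ M′ → M ≡ M′
      sink⊥-injective B eq = proj₂ (sink-injective A {B = B} ∉⊥ ∉⊥ eq)

      sink⊥∈stacks : ∀ {d} B {M : Stack d} → M ∈ˡ stacks A d → sink A B ⊥ M ∈ˡ stacks A (suc d)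
      sink⊥∈stacks B M∈ = sink∈stacks A
        (∈-stacks⁺ A M∈ ((λ C C∈ → ⊥-elim (∉⊥ C∈)) , ⊥-independent)) (¬adjacent-⊥ B)

      R-sink⊥ : ∀ {d} B (M : Stack d) x → R B (stackMass M) x ≤ stackMass (sink A B ⊥ M) x
      R-sink⊥ B M x = ≤-trans (≤-reflexive (Eq.reflexive
        (≡.cong (λ f → R B f x) (≡.sym (R*-⊥ id (stackMass M)))))) (R-sink B ⊥ M (¬adjacent-⊥ B) x)

    -- Sinking sends distinct stacks to distinct stacks, so the images make up a part of the sum for
    -- the next height.
    R-φ : ∀ d B x → R B (φ d) x ≤ φ (suc d) x
    R-φ d B x = ≤-trans (≤-reflexive (R-∑ B stackMass (stacks A d) x))
      (∑-injection (sink A B ⊥) (λ M → stackMass-nonneg M x) (sink⊥-injective B) (stacks-! A d)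
        (λ M M∈ → sink⊥∈stacks B M∈) (λ M _ → R-sink⊥ B M x))

    -- For `B` related to `A` the empty stack is not an image under sinking, so its mass `𝟙 (E x)`
    -- is left over to pay for the final event.
    root+R-φ : ∀ d {B} → B ∼ A → ∀ x → 𝟙 (E x) + R B (φ d) x ≤ φ (suc d) x
    root+R-φ d {B} B∼A x = begin
      𝟙 (E x) + R B (φ d) x
        ≤⟨ +-mono-≤ (≤-reflexive (Eq.reflexive (≡.cong (λ f → f x) (≡.sym (stackMass-empty (suc d))))))
             (≤-trans (≤-reflexive (R-∑ B stackMass (stacks A d) x))
               (≤-trans (∑-mono (λ M → R-sink⊥ B M x) (stacks A d))
                 (≤-reflexive (Eq.reflexive
                   (≡.sym (∑-map (sink A B ⊥) (λ M → stackMass M x) (stacks A d))))))) ⟩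
      ∑ (emptyStack A (suc d) ∷ List.map (sink A B ⊥) (stacks A d)) (λ M → stackMass M x)
        ≤⟨ ∑-⊆ (λ M → stackMass-nonneg M x) _ _
             (All.tabulate fresh ∷ Unique.map⁺ (sink⊥-injective B) (stacks-! A d))
             (λ M M∈ → inj₁ (sub M M∈)) ⟩
      φ (suc d) x ∎
      where
      fresh : ∀ {M} → M ∈ˡ List.map (sink A B ⊥) (stacks A d) → emptyStack A (suc d) ≢ M
      fresh M∈ eq with ∈-map⁻ (sink A B ⊥) M∈
      ... | M′ , _ , eq′ = sink≢empty A B∼A ⊥ M′ (≡.trans (≡.sym eq′) (≡.sym eq))

      sub : ∀ M → M ∈ˡ (emptyStack A (suc d) ∷ List.map (sink A B ⊥) (stacks A d)) →
            M ∈ˡ stacks A (suc d)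
      sub M (here refl) = emptyStack∈ A (suc d)
      sub M (there M∈) with ∈-map⁻ (sink A B ⊥) M∈
      ... | M′ , M′∈ , refl = sink⊥∈stacks B M′∈

    φ-root : ∀ d x → 𝟙 (E x) ≤ φ d x
    φ-root d x = ≤-respˡ-≈ (Eq.reflexive (≡.cong (λ f → f x) (stackMass-empty d)))
      (∑-member (λ M → stackMass-nonneg M x) (emptyStack∈ A d))

    module _ {P : Fin m → Carrier} (0≤P : ∀ B → 0# ≤ P B)
             (true≤P : ∀ B x → 𝔼 p′ (vars (ℬ′ B)) (true′ B) x ≤ P B)
             (PZ≤μ : ∀ B → P B * Z B ≤ μ B)
             {r : Carrier} (0≤r : 0# ≤ r)
             (root≤r : ∀ x → 𝔼 p′ (vars (ℬ′ A)) (𝟙 ∘ E) x ≤ r) where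

      𝔼-root : ∀ x → 𝔼 p′ ⊤ (𝟙 ∘ E) x ≤ r
      𝔼-root x = begin
        𝔼 p′ ⊤ (𝟙 ∘ E) x
          ≡⟨ ≡.cong (λ U → 𝔼 p′ U (𝟙 ∘ E) x) (≡.trans (∪-comm (∁ S) S) (p∪∁p≡⊤ S)) ⟨
        𝔼 p′ (∁ S ∪ S) (𝟙 ∘ E) x
          ≈⟨ 𝔼-∪ p′ (∁ S) S (λ i i∈∁S i∈S → x∈∁p⇒x∉p i∈∁S i∈S) (𝟙 ∘ E) x ⟨
        𝔼 p′ (∁ S) (𝔼 p′ S (𝟙 ∘ E)) x
          ≤⟨ 𝔼-mono p′ (∁ S) root≤r x ⟩
        𝔼 p′ (∁ S) (λ _ → r) x
          ≤⟨ 𝔼-insensitive-≤ p′ (∁ S) (λ _ → 0≤r) (λ _ _ _ → Eq.refl) x ⟩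
        r ∎
        where
        S = vars (ℬ′ A)

      𝔼-stackMass : ∀ {d} (M : Stack d) x → 𝔼 p′ ⊤ (stackMass M) x ≤ stackProduct A P M * r
      𝔼-stackMass []      x = ≤-trans (𝔼-root x) (≤-reflexive (Eq.sym (*-identityˡ r)))
      𝔼-stackMass (K ∷ M) x = begin
        𝔼 p′ ⊤ (R* id K (stackMass M)) x    ≤⟨ 𝔼-R* 0≤P true≤P id K (stackMass-nonneg M) x ⟩
        ∏ P K * 𝔼 p′ ⊤ (stackMass M) x      ≤⟨ *-monoˡ-≤ (∏-nonneg 0≤P K) (𝔼-stackMass M x) ⟩
        ∏ P K * (stackProduct A P M * r)    ≈⟨ *-assoc (∏ P K) (stackProduct A P M) r ⟨
        ∏ P K * stackProduct A P M * r      ∎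

      𝔼-φ : ∀ d x → 𝔼 p′ ⊤ (φ d) x ≤ r * Z A
      𝔼-φ d x = begin
        𝔼 p′ ⊤ (φ d) x
          ≈⟨ 𝔼-∑ p′ ⊤ stackMass (stacks A d) x ⟩
        ∑ (stacks A d) (λ M → 𝔼 p′ ⊤ (stackMass M) x)
          ≤⟨ ∑-mono (λ M → 𝔼-stackMass M x) (stacks A d) ⟩
        ∑ (stacks A d) (λ M → stackProduct A P M * r)
          ≈⟨ ∑-*ʳ r (stackProduct A P) (stacks A d) ⟩
        ∑ (stacks A d) (stackProduct A P) * r
          ≤⟨ *-monoʳ-≤ 0≤r (∑-stackProduct≤Z A 0≤P PZ≤μ d) ⟩
        Z A * r
          ≈⟨ *-comm (Z A) r ⟩
        r * Z A ∎

-- The truncated algorithm: coins, rewards and final estimates.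

module Analysis (ℝ : CompleteOrderedField) {n m : ℕ} (p : Fin n → Probability.PMF ℝ ℤ)
                (ℬ : Fin m → Probability.Event ℝ n) (μ : Fin m → CompleteOrderedField.Carrier ℝ)
                (μ≥0 : ∀ B → CompleteOrderedField._≤_ ℝ (CompleteOrderedField.0# ℝ) (μ B))
                (rule : Probability.Rule ℝ (Probability.Truncated.ℬ′ ℝ p ℬ μ μ≥0)) where

  open CompleteOrderedField ℝ
  open Probability ℝ
  open Truncated p ℬ μ μ≥0 hiding (prodᶠ-nonneg)
  open Sums ℝ
  open PosetReasoning (TotalOrder.poset totalOrder) hiding (start)
  open CommutativeSemigroupProperties *-commutativeSemigroup
    using () renaming (x∙yz≈y∙xz to *-swap; x∙yz≈y∙zx to *-rotate)
  open NaturalMin totalOrder using (⊓-sel; x⊓y≤y)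
  open NaturalMax totalOrder using (x≤x⊔y; x≤y⊔x)
  open Stacks ℝ p ℬ μ μ≥0
  open MoserTardos p′ ℬ′ rule
  open Rule rule using (choose)
  open Runs ℝ p′ ℬ′ rule
  open Termination ℝ p′ ℬ′ rule

  Pr-true : Fin m → Carrier
  Pr-true B = Pr (product p) (holds (ℬ B))

  -- One family for both final events: `on` gives `ℬ′ B` itself, `off` gives the event that `B` is
  -- true but its coin fails.
  with-Y : Fin m → (ℤ → Bool) → Vec ℤ (n ℕ.+ m) → Bool
  with-Y B ψ z = holds (ℬ B) (take n z) ∧ ψ (lookup z (n ↑ʳ B))

  with-Y-local : ∀ B ψ x y → (∀ i → i ∈ vars (ℬ′ B) → lookup x i ≡ lookup y i) →
                 with-Y B ψ x ≡ with-Y B ψ y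
  with-Y-local B ψ x y eq = ≡.cong₂ _∧_
    (local (ℬ B) (take n x) (take n y) λ i i∈ → ≡.trans (lookup-take x i)
      (≡.trans (eq (i ↑ˡ m) (Vec.lookup⇒[]= (i ↑ˡ m) _
        (≡.trans (Vec.lookup-++ˡ (vars (ℬ B)) ⁅ B ⁆ i) (Vec.[]=⇒lookup i∈))))
      (≡.sym (lookup-take y i))))
    (≡.cong ψ (eq (n ↑ʳ B) (Vec.lookup⇒[]= (n ↑ʳ B) _
      (≡.trans (Vec.lookup-++ʳ (vars (ℬ B)) ⁅ B ⁆ B) (Vec.[]=⇒lookup (x∈⁅x⁆ B))))))
    where
    lookup-take : ∀ (z : Vec ℤ (n ℕ.+ m)) i → lookup (take n z) i ≡ lookup z (i ↑ˡ m)
    lookup-take z i = ≡.trans (≡.sym (Vec.lookup-++ˡ (take n z) (drop n z) i))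
      (≡.cong (λ v → lookup v (i ↑ˡ m)) (Vec.take++drop≡id n z))

  on off : ℤ → Bool
  on  b = does (b ℤ.≟ + 1)
  off b = not (on b)

  blocked : Fin m → Vec ℤ (n ℕ.+ m) → Bool
  blocked B = with-Y B off

  θ≈0-or-q : ∀ B → θ B ≈ 0# ⊎ q B ≈ 1# ⊎ q B * θ B ≈ μ B
  θ≈0-or-q B with θ B ≟ 0#
  ... | yes θ≈0 = inj₁ θ≈0
  ... | no  θ≉0 with ⊓-sel 1# (μ B * θ B ⁻¹)
  ... | inj₁ q≈1   = inj₂ (inj₁ q≈1)
  ... | inj₂ q≈μ/θ = inj₂ (inj₂ (begin-equality
    (1# ⊓ (μ B * θ B ⁻¹)) * θ B  ≈⟨ *-congʳ q≈μ/θ ⟩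
    μ B * θ B ⁻¹ * θ B         ≈⟨ *-assoc (μ B) (θ B ⁻¹) (θ B) ⟩
    μ B * (θ B ⁻¹ * θ B)       ≈⟨ *-congˡ (Eq.trans (*-comm (θ B ⁻¹) (θ B)) (*-inverseʳ (θ B) θ≉0)) ⟩
    μ B * 1#                   ≈⟨ *-identityʳ (μ B) ⟩
    μ B                        ∎))

  qθ≤μ : ∀ B → q B * θ B ≤ μ B
  qθ≤μ B with θ B ≟ 0#
  ... | yes θ≈0 = ≤-trans (≤-reflexive (Eq.trans (*-identityˡ (θ B)) θ≈0)) (μ≥0 B)
  ... | no  θ≉0 = begin
    (1# ⊓ (μ B * θ B ⁻¹)) * θ B  ≤⟨ *-monoʳ-≤ (θ≥0 B) (x⊓y≤y 1# (μ B * θ B ⁻¹)) ⟩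
    μ B * θ B ⁻¹ * θ B         ≈⟨ *-assoc (μ B) (θ B ⁻¹) (θ B) ⟩
    μ B * (θ B ⁻¹ * θ B)       ≈⟨ *-congˡ (Eq.trans (*-comm (θ B ⁻¹) (θ B)) (*-inverseʳ (θ B) θ≉0)) ⟩
    μ B * 1#                   ≈⟨ *-identityʳ (μ B) ⟩
    μ B                        ∎

  -- The maximum in the theorem comes from the minimum in `q`: the left side is 0 if `θ B` is 0 or
  -- `q B` is 1, and otherwise `q B * θ B` equals `μ B`.
  [1-q]θ≤ : ∀ B → (1# - q B) * θ B ≤ 0# ⊔ (θ B - μ B)
  [1-q]θ≤ B with θ≈0-or-q B
  ... | inj₁ θ≈0 = begin
    (1# - q B) * θ B     ≈⟨ *-congˡ θ≈0 ⟩
    (1# - q B) * 0#      ≈⟨ zeroʳ (1# - q B) ⟩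
    0#                   ≤⟨ x≤x⊔y 0# (θ B - μ B) ⟩
    0# ⊔ (θ B - μ B)     ∎
  ... | inj₂ (inj₁ q≈1) = begin
    (1# - q B) * θ B     ≈⟨ *-congʳ (Eq.trans (+-congˡ (-‿cong q≈1)) (-‿inverseʳ 1#)) ⟩
    0# * θ B             ≈⟨ zeroˡ (θ B) ⟩
    0#                   ≤⟨ x≤x⊔y 0# (θ B - μ B) ⟩
    0# ⊔ (θ B - μ B)     ∎
  ... | inj₂ (inj₂ qθ≈μ) = begin
    (1# - q B) * θ B             ≈⟨ distribʳ (θ B) 1# (- q B) ⟩
    1# * θ B + - q B * θ B       ≈⟨ +-cong (*-identityˡ (θ B))
                                     (Eq.trans (Eq.sym (-‿distribˡ-* (q B) (θ B))) (-‿cong qθ≈μ)) ⟩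
    θ B - μ B                    ≤⟨ x≤y⊔x 0# (θ B - μ B) ⟩
    0# ⊔ (θ B - μ B)             ∎
    where
    open RingProperties ring using (-‿distribˡ-*)

  P : Fin m → Carrier
  P B = Pr-true B * q B

  P-nonneg : ∀ B → 0# ≤ P B
  P-nonneg B = *-nonneg (Pr-nonneg (product p) (holds (ℬ B))) (q≥0 B)

  PZ≤μ : ∀ B → P B * Z B ≤ μ B
  PZ≤μ B = begin
    Pr-true B * q B * Z B    ≈⟨ *-congʳ (*-comm (Pr-true B) (q B)) ⟩
    q B * Pr-true B * Z B    ≈⟨ *-assoc (q B) (Pr-true B) (Z B) ⟩
    q B * θ B                ≤⟨ qθ≤μ B ⟩
    μ B                      ∎

  count : Fin m → ℋ → Carrier
  count A h = #resamplings A h · 1#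

  count-nonneg : ∀ A h → 0# ≤ count A h
  count-nonneg A h = go (#resamplings A h)
    where
    go : ∀ k → 0# ≤ k · 1#
    go zero    = ≤-refl
    go (suc k) = +-nonneg 0≤1 (go k)

  -- Potentials for resamplings, failed coins and live histories.

  module _ (F : List ℤ) (F! : Unique F) where

    open Average ℝ F F!
    open Truncation F F!
    open Potential ℝ p ℬ μ μ≥0 F F!

    private
      Y-mass : Fin m → ℤ → Carrier
      Y-mass B = mass (bernoulli (q B) (q≥0 B) (q≤1 B))

      Y-mass-nonneg : ∀ B b → 0# ≤ Y-mass B b
      Y-mass-nonneg B = nonneg (bernoulli (q B) (q≥0 B) (q≤1 B))

    ∑-on : ∀ B → ∑ F (λ b → Y-mass B b * 𝟙 (on b)) ≤ q B
    ∑-on B = ≤-trans (∑-mono le F) (∑-delta (Y-mass-nonneg B) ℤ._≟_ (+ 1) F F!)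
      where
      le : ∀ b → Y-mass B b * 𝟙 (on b) ≤ 𝟙 (does (+ 1 ℤ.≟ b)) * Y-mass B b
      le (+ 0)           = ≤-reflexive (*-comm _ _)
      le (+ 1)           = ≤-reflexive (*-comm _ _)
      le (+ suc (suc _)) = ≤-reflexive (*-comm _ _)
      le -[1+ _ ]        = ≤-reflexive (*-comm _ _)

    ∑-off : ∀ B → ∑ F (λ b → Y-mass B b * 𝟙 (off b)) ≤ 1# - q B
    ∑-off B = ≤-trans (∑-mono le F) (∑-delta (Y-mass-nonneg B) ℤ._≟_ (+ 0) F F!)
      where
      le : ∀ b → Y-mass B b * 𝟙 (off b) ≤ 𝟙 (does (+ 0 ℤ.≟ b)) * Y-mass B b
      le (+ 0)           = ≤-reflexive (*-comm _ _)
      le (+ 1)           = ≤-reflexive (Eq.trans (zeroʳ _) (Eq.sym (zeroˡ _)))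
      -- The predicate `off` holds for these values too, but the coin gives them no mass.
      le (+ suc (suc _)) = ≤-reflexive (Eq.trans (zeroˡ _) (Eq.sym (zeroˡ _)))
      le -[1+ _ ]        = ≤-reflexive (Eq.trans (zeroˡ _) (Eq.sym (zeroˡ _)))

    -- The coin is independent of the other variables and is integrated first, at cost `c`. What
    -- remains concerns `ℬ B` alone, and `𝔼-≤-sup` bounds it by its probability.
    𝔼-with-Y : ∀ B ψ {c} → 0# ≤ c → ∑ F (λ b → Y-mass B b * 𝟙 (ψ b)) ≤ c →
               ∀ z → 𝔼 p′ (vars (ℬ′ B)) (𝟙 ∘ with-Y B ψ) z ≤ Pr-true B * c
    𝔼-with-Y B ψ {c} 0≤c ψ≤c z = begin
      𝔼 p′ (S Vec.++ ⁅ B ⁆) (𝟙 ∘ with-Y B ψ) z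
        ≡⟨ ≡.cong (𝔼 p′ (S Vec.++ ⁅ B ⁆) (𝟙 ∘ with-Y B ψ)) (Vec.take++drop≡id n z) ⟨
      𝔼 p′ (S Vec.++ ⁅ B ⁆) (𝟙 ∘ with-Y B ψ) (x Vec.++ y)
        ≈⟨ 𝔼-++ p′ S ⁅ B ⁆ (𝟙 ∘ with-Y B ψ) x y ⟩
      𝔼 pˣ S (λ x₁ → 𝔼 pʸ ⁅ B ⁆ (λ y₁ → 𝟙 (with-Y B ψ (x₁ Vec.++ y₁))) y) x
        ≤⟨ 𝔼-mono pˣ S inner x ⟩
      𝔼 pˣ S (λ x₁ → c * g x₁) x
        ≈⟨ 𝔼-pull pˣ S (λ _ _ _ → Eq.refl) g x ⟩
      c * 𝔼 pˣ S g x
        ≈⟨ *-congˡ (𝔼-cong-PMF (λ i → ≡.cong [ p , _ ]′ (Fin.splitAt-↑ˡ n i m)) S g x) ⟩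
      c * 𝔼 p S g x
        ≤⟨ *-monoˡ-≤ 0≤c (𝔼-≤-sup p S (λ y → 𝟙-nonneg (holds (ℬ B) y))
             (λ x y eq → Eq.reflexive (≡.cong 𝟙 (local (ℬ B) x y eq))) (Pr-true B)
             (hasSum-upper (proj₂ (Pr∃ (product p) (holds (ℬ B))))) x) ⟩
      c * Pr-true B
        ≈⟨ *-comm c (Pr-true B) ⟩
      Pr-true B * c ∎
      where
      S  = vars (ℬ B)
      x  = take n z
      y  = drop n z
      pˣ = λ i → p′ (i ↑ˡ m)
      pʸ = λ j → p′ (n ↑ʳ j)

      g : Vec ℤ n → Carrier
      g x = 𝟙 (holds (ℬ B) x)

      𝟙-∧ : ∀ a b → 𝟙 (a ∧ b) ≈ 𝟙 a * 𝟙 b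
      𝟙-∧ true  b = Eq.sym (*-identityˡ (𝟙 b))
      𝟙-∧ false b = Eq.sym (zeroˡ (𝟙 b))

      take-++ : ∀ {k} (x : Vec ℤ k) (y : Vec ℤ m) → take k (x Vec.++ y) ≡ x
      take-++ []      y = refl
      take-++ (a ∷ x) y = ≡.cong (a ∷_) (take-++ x y)

      factor : ∀ x₁ y₁ → 𝟙 (with-Y B ψ (x₁ Vec.++ y₁)) ≈ g x₁ * 𝟙 (ψ (lookup y₁ B))
      factor x₁ y₁ = Eq.trans (𝟙-∧ (holds (ℬ B) (take n (x₁ Vec.++ y₁))) _)
        (*-cong (Eq.reflexive (≡.cong g (take-++ x₁ y₁)))
                (Eq.reflexive (≡.cong (𝟙 ∘ ψ) (Vec.lookup-++ʳ x₁ y₁ B))))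

      inner : ∀ x₁ → 𝔼 pʸ ⁅ B ⁆ (λ y₁ → 𝟙 (with-Y B ψ (x₁ Vec.++ y₁))) y ≤ c * g x₁
      inner x₁ = begin
        𝔼 pʸ ⁅ B ⁆ (λ y₁ → 𝟙 (with-Y B ψ (x₁ Vec.++ y₁))) y
          ≈⟨ 𝔼-cong pʸ ⁅ B ⁆ (factor x₁) y ⟩
        𝔼 pʸ ⁅ B ⁆ (λ y₁ → g x₁ * 𝟙 (ψ (lookup y₁ B))) y
          ≈⟨ 𝔼-pull pʸ ⁅ B ⁆ (λ _ _ _ → Eq.refl) (λ y₁ → 𝟙 (ψ (lookup y₁ B))) y ⟩
        g x₁ * 𝔼 pʸ ⁅ B ⁆ (λ y₁ → 𝟙 (ψ (lookup y₁ B))) y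
          ≈⟨ *-congˡ (𝔼-singleton pʸ B (𝟙 ∘ ψ) y) ⟩
        g x₁ * ∑ F (λ b → mass (pʸ B) b * 𝟙 (ψ b))
          ≡⟨ ≡.cong (λ Q → g x₁ * ∑ F (λ b → mass Q b * 𝟙 (ψ b)))
               (≡.cong [ p , _ ]′ (Fin.splitAt-↑ʳ n m B)) ⟩
        g x₁ * ∑ F (λ b → Y-mass B b * 𝟙 (ψ b))
          ≤⟨ *-monoˡ-≤ (𝟙-nonneg (holds (ℬ B) x₁)) ψ≤c ⟩
        g x₁ * c
          ≈⟨ *-comm (g x₁) c ⟩
        c * g x₁ ∎

    true≤P : ∀ B z → 𝔼 p′ (vars (ℬ′ B)) (true′ B) z ≤ P B
    true≤P B = 𝔼-with-Y B on (q≥0 B) (∑-on B)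

    blocked≤ : ∀ B z → 𝔼 p′ (vars (ℬ′ B)) (𝟙 ∘ blocked B) z ≤ Pr-true B * (1# - q B)
    blocked≤ B = 𝔼-with-Y B off (x≤y⇒0≤y-x (q≤1 B)) (∑-off B)

    φ-true φ-blocked : Fin m → ℕ → State → Carrier
    φ-true    A = φ A (holds (ℬ′ A)) (local (ℬ′ A))
    φ-blocked A = φ A (blocked A) (with-Y-local A off)

    private
      -- An arbitrary state: `𝔼 p′ ⊤` integrates out every coordinate.
      origin : State
      origin = Vec.replicate (n ℕ.+ m) (+ 0)

    𝔼-φ-true≤μ : ∀ A d x → 𝔼 p′ ⊤ (φ-true A d) x ≤ μ A
    𝔼-φ-true≤μ A d x = ≤-trans
      (𝔼-φ A (holds (ℬ′ A)) (local (ℬ′ A)) P-nonneg true≤P PZ≤μ (P-nonneg A) (true≤P A) d x)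
      (PZ≤μ A)

    𝔼-φ-blocked≤ : ∀ A d x → 𝔼 p′ ⊤ (φ-blocked A d) x ≤ 0# ⊔ (θ A - μ A)
    𝔼-φ-blocked≤ A d x = begin
      𝔼 p′ ⊤ (φ-blocked A d) x
        ≤⟨ 𝔼-φ A (blocked A) (with-Y-local A off) P-nonneg true≤P PZ≤μ
             (*-nonneg (Pr-nonneg (product p) (holds (ℬ A))) (x≤y⇒0≤y-x (q≤1 A))) (blocked≤ A) d x ⟩
      Pr-true A * (1# - q A) * Z A    ≈⟨ *-congʳ (*-comm (Pr-true A) (1# - q A)) ⟩
      (1# - q A) * Pr-true A * Z A    ≈⟨ *-assoc (1# - q A) (Pr-true A) (Z A) ⟩
      (1# - q A) * θ A                ≤⟨ [1-q]θ≤ A ⟩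
      0# ⊔ (θ A - μ A)                ∎

    𝒫-≤-∑R : ∀ {f} → (∀ x → 0# ≤ f x) → ∀ h →
             𝒫 (f ∘ current) h ≤ ∑ (allFin m) (λ B → choose h B * R B f (current h))
    𝒫-≤-∑R {f} 0≤f h = ≤-trans (𝒫-current 0≤f h) (≤-reflexive (∑-cong (λ B →
      Eq.trans (*-congʳ (choose-true h B)) (*-assoc (choose h B) (true′ B (current h)) _)) (allFin m)))

    ∑-choose-≤ : ∀ h {f : Fin m → Carrier} {c} → (∀ B → f B ≤ c) →
                 ∑ (allFin m) (λ B → choose h B * f B) ≤ 𝟙 (alive h) * c
    ∑-choose-≤ h {f} {c} f≤c = begin
      ∑ (allFin m) (λ B → choose h B * f B)
        ≤⟨ ∑-mono (λ B → *-monoˡ-≤ (Rule.nonneg rule h B) (f≤c B)) (allFin m) ⟩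
      ∑ (allFin m) (λ B → choose h B * c)    ≈⟨ ∑-*ʳ c (choose h) (allFin m) ⟩
      ∑ (allFin m) (choose h) * c            ≈⟨ *-congʳ (∑-choose h) ⟩
      𝟙 (alive h) * c                        ∎

    -- The reward is the chance that `A` is resampled next. Only the branch that selects `A` has to
    -- pay, and there the empty stack is spare.
    step-true : ∀ A d h → choose h A + 𝒫 (φ-true A d ∘ current) h ≤ φ-true A (suc d) (current h)
    step-true A d h = begin
      choose h A + 𝒫 (φ-true A d ∘ current) h
        ≤⟨ +-mono-≤ root-part (𝒫-≤-∑R (φ-nonneg A _ (local (ℬ′ A)) d) h) ⟩
      ∑ (allFin m) (λ B → choose h B * root B) +
      ∑ (allFin m) (λ B → choose h B * R B (φ-true A d) x)
        ≈⟨ ∑-+ _ _ (allFin m) ⟨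
      ∑ (allFin m) (λ B → choose h B * root B + choose h B * R B (φ-true A d) x)
        ≈⟨ ∑-cong (λ B → distribˡ (choose h B) (root B) (R B (φ-true A d) x)) (allFin m) ⟨
      ∑ (allFin m) (λ B → choose h B * (root B + R B (φ-true A d) x))
        ≤⟨ ∑-choose-≤ h per-event ⟩
      𝟙 (alive h) * φ-true A (suc d) x
        ≤⟨ *-≤ˡ (φ-nonneg A _ (local (ℬ′ A)) (suc d) x) (𝟙≤1 (alive h)) ⟩
      φ-true A (suc d) x ∎
      where
      x = current h

      -- Spreads the reward over the possible choices, so that each branch is estimated by itself.
      root : Fin m → Carrier
      root B = 𝟙 (does (A Fin.≟ B)) * true′ A x

      root-part : choose h A ≤ ∑ (allFin m) (λ B → choose h B * root B)
      root-part = begin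
        choose h A                        ≈⟨ choose-true h A ⟩
        choose h A * true′ A x            ≈⟨ *-congˡ (*-identityˡ (true′ A x)) ⟨
        choose h A * (1# * true′ A x)
          ≡⟨ ≡.cong (λ b → choose h A * (𝟙 b * true′ A x)) (dec-true (A Fin.≟ A) refl) ⟨
        choose h A * root A
          ≤⟨ ∑-member {f = λ B → choose h B * root B} (λ B → *-nonneg (Rule.nonneg rule h B)
               (*-nonneg (𝟙-nonneg (does (A Fin.≟ B))) (true′-nonneg A x))) (∈-allFin A) ⟩
        ∑ (allFin m) (λ B → choose h B * root B) ∎

      per-event : ∀ B → root B + R B (φ-true A d) x ≤ φ-true A (suc d) x
      per-event B with A Fin.≟ B
      ... | yes refl = ≤-trans (≤-reflexive (+-congʳ (*-identityˡ (true′ A x))))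
                               (root+R-φ A _ (local (ℬ′ A)) d ∼-refl x)
      ... | no  _    = ≤-trans
        (≤-reflexive (Eq.trans (+-congʳ (zeroˡ (true′ A x))) (+-identityˡ _)))
        (R-φ A _ (local (ℬ′ A)) d B x)

    -- The reward falls due only at halted histories, where nothing is resampled, so one potential
    -- serves both alternatives.
    step-blocked : ∀ A d h → 𝟙 (halted h) * 𝟙 (blocked A (current h)) + 𝒫 (φ-blocked A d ∘ current) h ≤
                             φ-blocked A (suc d) (current h)
    step-blocked A d h = begin
      𝟙 (halted h) * 𝟙 (blocked A x) + 𝒫 (φ-blocked A d ∘ current) h
        ≤⟨ +-mono-≤ (*-monoˡ-≤ (𝟙-nonneg (halted h)) (φ-root A _ blocked-local (suc d) x))
             (≤-trans (𝒫-≤-∑R (φ-nonneg A _ blocked-local d) h)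
                      (∑-choose-≤ h (λ B → R-φ A _ blocked-local d B x))) ⟩
      𝟙 (halted h) * φ-blocked A (suc d) x + 𝟙 (alive h) * φ-blocked A (suc d) x
        ≈⟨ distribʳ _ (𝟙 (halted h)) (𝟙 (alive h)) ⟨
      (𝟙 (halted h) + 𝟙 (alive h)) * φ-blocked A (suc d) x
        ≈⟨ Eq.trans (*-congʳ (halted+alive h)) (*-identityˡ _) ⟩
      φ-blocked A (suc d) x ∎
      where
      x = current h
      blocked-local = with-Y-local A off

    𝒫-count : ∀ A h → 𝒫 (count A) h ≤ 𝟙 (alive h) * count A h + choose h A
    𝒫-count A h = begin
      𝒫 (count A) h
        ≤⟨ ∑-mono (λ B → *-monoˡ-≤ (Rule.nonneg rule h B) (per-event B)) (allFin m) ⟩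
      ∑ (allFin m) (λ B → choose h B * (count A h + 𝟙 (does (A Fin.≟ B))))
        ≈⟨ ∑-cong (λ B → Eq.trans (distribˡ (choose h B) _ _)
             (+-congˡ (*-comm (choose h B) (𝟙 (does (A Fin.≟ B)))))) (allFin m) ⟩
      ∑ (allFin m) (λ B → choose h B * count A h + 𝟙 (does (A Fin.≟ B)) * choose h B)
        ≈⟨ ∑-+ _ _ (allFin m) ⟩
      ∑ (allFin m) (λ B → choose h B * count A h) +
      ∑ (allFin m) (λ B → 𝟙 (does (A Fin.≟ B)) * choose h B)
        ≤⟨ +-mono-≤ (∑-choose-≤ h (λ _ → ≤-refl))
             (∑-delta (Rule.nonneg rule h) Fin._≟_ A (allFin m) (Unique.allFin⁺ m)) ⟩
      𝟙 (alive h) * count A h + choose h A ∎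
      where
      count-resample : ∀ B y → count A (resample h B y) ≈ count A h + 𝟙 (does (A Fin.≟ B))
      count-resample B y rewrite does-⇔ (mk⇔ ≡.sym ≡.sym) (A Fin.≟ B) (B Fin.≟ A)
        with does (B Fin.≟ A)
      ... | true  = +-comm 1# (count A h)
      ... | false = Eq.sym (+-identityʳ (count A h))

      per-event : ∀ B → ∑ (box (n ℕ.+ m)) (λ y →
          resampleMass B (current h) y * count A (resample h B y)) ≤ count A h + 𝟙 (does (A Fin.≟ B))
      per-event B = begin
        ∑ (box (n ℕ.+ m)) (λ y → resampleMass B (current h) y * count A (resample h B y))
          ≈⟨ ∑-cong (λ y → *-congˡ (count-resample B y)) (box (n ℕ.+ m)) ⟩
        ∑ (box (n ℕ.+ m)) (λ y → resampleMass B (current h) y * c)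
          ≈⟨ ∑-*ʳ c (resampleMass B (current h)) (box (n ℕ.+ m)) ⟩
        ∑ (box (n ℕ.+ m)) (resampleMass B (current h)) * c
          ≤⟨ *-≤ˡ (+-nonneg (count-nonneg A h) (𝟙-nonneg (does (A Fin.≟ B))))
                  (∑-box-transition-≤1 (vars (ℬ′ B)) (current h)) ⟩
        c ∎
        where
        c = count A h + 𝟙 (does (A Fin.≟ B))

    -- Resamplings are credited only upon termination. The potential therefore adds those already
    -- made to the bound for those to come.
    step-count : ∀ A d h →
      𝟙 (halted h) * count A h + 𝒫 (λ h → count A h + φ-true A d (current h)) h ≤
      count A h + φ-true A (suc d) (current h)
    step-count A d h = begin
      𝟙 (halted h) * count A h + 𝒫 (λ h → count A h + φ-true A d (current h)) h
        ≤⟨ +-monoʳ-≤ _ (≤-trans (≤-reflexive (𝒫-+ (count A) (φ-true A d ∘ current) h))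
             (+-mono-≤ (𝒫-count A h) ≤-refl)) ⟩
      𝟙 (halted h) * count A h +
        (𝟙 (alive h) * count A h + choose h A + 𝒫 (φ-true A d ∘ current) h)
        ≈⟨ +-congˡ (+-assoc _ _ _) ⟩
      𝟙 (halted h) * count A h +
        (𝟙 (alive h) * count A h + (choose h A + 𝒫 (φ-true A d ∘ current) h))
        ≈⟨ +-assoc _ _ _ ⟨
      𝟙 (halted h) * count A h + 𝟙 (alive h) * count A h +
        (choose h A + 𝒫 (φ-true A d ∘ current) h)
        ≤⟨ +-mono-≤ (≤-reflexive (Eq.trans (Eq.sym (distribʳ (count A h) _ _))
             (Eq.trans (*-congʳ (halted+alive h)) (*-identityˡ (count A h))))) (step-true A d h) ⟩
      count A h + φ-true A (suc d) (current h) ∎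

    -- A live history selects exactly one event, so its reward is the sum of the rewards in
    -- `step-true`, and the potentials add up.
    step-alive : ∀ d h → 𝟙 (alive h) + 𝒫 (λ h → ∑ (allFin m) (λ A → φ-true A d (current h))) h ≤
                         ∑ (allFin m) (λ A → φ-true A (suc d) (current h))
    step-alive d h = begin
      𝟙 (alive h) + 𝒫 (λ h → ∑ (allFin m) (λ A → φ-true A d (current h))) h
        ≈⟨ +-cong (Eq.sym (∑-choose h)) (𝒫-∑ (λ A → φ-true A d ∘ current) (allFin m) h) ⟩
      ∑ (allFin m) (choose h) + ∑ (allFin m) (λ A → 𝒫 (φ-true A d ∘ current) h)
        ≈⟨ ∑-+ _ _ (allFin m) ⟨
      ∑ (allFin m) (λ A → choose h A + 𝒫 (φ-true A d ∘ current) h)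
        ≤⟨ ∑-mono (λ A → step-true A d h) (allFin m) ⟩
      ∑ (allFin m) (λ A → φ-true A (suc d) (current h)) ∎

    init-≤ : ∀ (f : State → Carrier) {u} → 𝔼 p′ ⊤ f origin ≤ u →
             ∑ (box (n ℕ.+ m)) (λ x → jointMass p′ x * f x) ≤ u
    init-≤ f le = ≤-trans (≤-reflexive (∑-box-product p′ f origin)) le

    potential-blocked : ∀ A → HasPotential (λ h → 𝟙 (halted h) * 𝟙 (blocked A (current h))) (0# ⊔ (θ A - μ A))
    potential-blocked A =
      (λ d h → φ-blocked A d (current h)) ,
      (λ d h → φ-nonneg A _ (with-Y-local A off) d (current h)) ,
      step-blocked A ,
      (λ d → init-≤ (φ-blocked A d) (𝔼-φ-blocked≤ A d origin))

    potential-count : ∀ A → HasPotential (λ h → 𝟙 (halted h) * count A h) (μ A)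
    potential-count A =
      (λ d h → count A h + φ-true A d (current h)) ,
      (λ d h → +-nonneg (count-nonneg A h) (φ-nonneg A _ (local (ℬ′ A)) d (current h))) ,
      step-count A ,
      (λ d → init-≤ (λ x → 0# + φ-true A d x) (≤-trans
        (𝔼-mono p′ ⊤ (λ x → ≤-reflexive (+-identityˡ (φ-true A d x))) origin)
        (𝔼-φ-true≤μ A d origin)))

    potential-alive : HasPotential (𝟙 ∘ alive) (∑ (allFin m) μ)
    potential-alive =
      (λ d h → ∑ (allFin m) (λ A → φ-true A d (current h))) ,
      (λ d h → ∑-nonneg (λ A → φ-nonneg A _ (local (ℬ′ A)) d (current h)) (allFin m)) ,
      step-alive ,
      (λ d → init-≤ (λ x → ∑ (allFin m) (λ A → φ-true A d x)) (≤-trans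
        (≤-reflexive (𝔼-∑ p′ ⊤ (λ A → φ-true A d) (allFin m) origin))
        (∑-mono (λ A → 𝔼-φ-true≤μ A d origin) (allFin m))))

  total-mass : ∀ u → (∀ hs → Unique hs → ∑ hs runMass ≤ u) → 1# ≤ u
  total-mass = terminates (∑ (allFin m) μ)
    (∑-histories-≤ (𝟙 ∘ alive) (𝟙-nonneg ∘ alive) (∑ (allFin m) μ) potential-alive)

  ∑-output≤ : ∀ B hs → Unique hs →
    ∑ hs (λ h → 𝟙 (holds (ℬ B) (take n (current h))) * runMass h) ≤ 0# ⊔ (θ B - μ B)
  ∑-output≤ B hs hs! = ≤-trans (∑-mono le hs)
    (∑-histories-≤ (λ h → 𝟙 (halted h) * 𝟙 (blocked B (current h)))
      (λ h → *-nonneg (𝟙-nonneg (halted h)) (𝟙-nonneg (blocked B (current h)))) _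
      (λ F F! → potential-blocked F F! B) hs hs!)
    where
    halted⇒blocked : ∀ h → halted h ≡ true →
                     holds (ℬ B) (take n (current h)) ≡ blocked B (current h)
    halted⇒blocked h eq with holds (ℬ B) (take n (current h)) | halted⇒false h eq B
    ... | false | _        = refl
    ... | true  | on≡false = ≡.sym (≡.cong not on≡false)

    le : ∀ h → 𝟙 (holds (ℬ B) (take n (current h))) * runMass h ≤
               weight h * (𝟙 (halted h) * 𝟙 (blocked B (current h)))
    le h with halted h in eq
    ... | true  = ≤-reflexive (Eq.trans
      (*-rotate (𝟙 (holds (ℬ B) (take n (current h)))) 1# (weight h)) (Eq.trans (*-comm _ _)
      (Eq.trans (*-assoc (weight h) _ 1#) (*-congˡ (Eq.trans (*-comm _ 1#)
      (*-congˡ (Eq.reflexive (≡.cong 𝟙 (halted⇒blocked h eq)))))))))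
    ... | false = ≤-reflexive (Eq.trans
      (Eq.trans (*-congˡ (zeroˡ (weight h))) (zeroʳ _))
      (Eq.sym (Eq.trans (*-congˡ (zeroˡ _)) (zeroʳ (weight h)))))

  ∑-resamplings≤μ : ∀ B hs → Unique hs → ∑ hs (λ h → #resamplings B h · runMass h) ≤ μ B
  ∑-resamplings≤μ B hs hs! = ≤-trans
    (≤-reflexive (∑-cong (λ h → Eq.trans (·≈* (#resamplings B h) (runMass h))
      (*-rotate (#resamplings B h · 1#) (𝟙 (halted h)) (weight h) ⟨≈⟩ *-swap′ h)) hs))
    (∑-histories-≤ (λ h → 𝟙 (halted h) * (#resamplings B h · 1#))
      (λ h → *-nonneg (𝟙-nonneg (halted h)) (count-nonneg B h)) (μ B)
      (λ F F! → potential-count F F! B) hs hs!)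
    where
    _⟨≈⟩_ = Eq.trans

    *-swap′ : ∀ h → 𝟙 (halted h) * (weight h * (#resamplings B h · 1#)) ≈
                    weight h * (𝟙 (halted h) * (#resamplings B h · 1#))
    *-swap′ h = *-swap (𝟙 (halted h)) (weight h) (#resamplings B h · 1#)

    ·≈* : ∀ k x → k · x ≈ (k · 1#) * x
    ·≈* zero    x = Eq.sym (zeroˡ x)
    ·≈* (suc k) x = Eq.trans (+-cong (Eq.sym (*-identityˡ x)) (·≈* k x))
                             (Eq.sym (distribʳ x 1# (k · 1#)))

theorem6p1 : (ℝ : CompleteOrderedField) →
    let open CompleteOrderedField ℝ
        open Probability ℝ in
    ∀ {n m : ℕ} (p : Fin n → PMF ℤ) (ℬ : Fin m → Event n)
      (μ : Fin m → Carrier) (μ≥0 : ∀ B → 0# ≤ μ B) →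
    let open Truncated p ℬ μ μ≥0 in
    (rule : Rule ℬ′) →
    let open MoserTardos p′ ℬ′ rule in
    Σ[ Ω′ ∈ PMF (Vec ℤ n) ]
      ( HasOutput (take n) Ω′
      × (∀ B → Pr Ω′ (holds (ℬ B)) ≤ 0# ⊔ (θ B - μ B))
      × (∀ B → ∃[ e ] (ExpectedResamplings B e × e ≤ μ B)) )
theorem6p1 ℝ {n} p ℬ μ μ≥0 rule =
  outputPMF (take n) total-mass ,
  hasOutput (take n) total-mass ,
  (λ B → Pr-output-≤ (take n) total-mass (holds (ℬ B)) _ (∑-output≤ B)) ,
  (λ B → let e , e-sum = summable _ (μ B) (∑-resamplings≤μ B) in
    e , e-sum , hasSum-least e-sum (μ B) (∑-resamplings≤μ B))
  where
  open Probability ℝ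
  open Truncated p ℬ μ μ≥0
  open Termination ℝ p′ ℬ′ rule
  open Analysis ℝ p ℬ μ μ≥0 rule
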